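{- Let $G$ be a PTPG. If there exists a non-trivial $L$-shaped floor-plan corresponding to $G$, then: (i) $G$ contains at most five corner implying paths (CIPs); and (ii) $G$ contains at least one triplet $(a,b,c)$ of exterior vertices (so $(a,b)$ and $(b,c)$ are edges of $G$) such that $a$ is not adjacent to $c$, and $a$ and $c$ have no common neighbour other than $b$.
   Context: A PTPG (properly triangulated planar graph) is a bi-connected plane graph in which every face except the exterior face is a triangle and which has no separating triangle (a cycle of length three with at least one vertex in its interior). Exterior vertices are those on the outer face. A corner implying path (CIP) is a path of consecutive vertices $u_1,u_2,\dots,u_n$ on the outer boundary of $G$ such that $u_1$ and $u_n$ are adjacent and no other pair of non-consecutive vertices of the path is adjacent. A triplet $(a,b,c)$ denotes three vertices such that $(a,b)$ and $(b,c)$ are edges. A floor-plan is a partition of a polygon by axis-parallel segments into modules; two modules are adjacent if they share a wall segment of positive length. An $L$-shaped floor-plan is a floor-plan all of whose modules are rectangles and whose boundary is a rectilinear polygon with exactly one concave corner (a corner with interior angle $270^\circ$). It is non-trivial if it cannot be transformed into a rectangular floor-plan by stretching or shrinking its outer walls while preserving all adjacencies between modules. A floor-plan corresponds to $G$ if its modules are in bijection with the vertices of $G$ and two modules are adjacent exactly when the corresponding vertices are adjacent in $G$.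
   Formalization: The walls of the floor-plans (the given L-shaped one and the rectangular ones that non-triviality rules out) have rational instead of real coordinates. -}

module Defs where

open import Data.Nat as ℕ using (ℕ; zero; suc; _+_; _*_; _≤ᵇ_)
open import Data.Fin as Fin using (Fin; toℕ; _≟_)
open import Data.List using (List; []; _∷_; length; lookup; map; concatMap; filter; allFin; upTo)
open import Data.Bool.ListAction using (and)
open import Data.List.Membership.Propositional using (_∈_; _∉_)
open import Data.List.Relation.Unary.Unique.Propositional using (Unique)
open import Data.List.Relation.Unary.All using (All)
open import Data.Bool using (Bool; true; false; if_then_else_; T)
open import Data.Bool.Properties using (T?)
open import Data.Product using (Σ; ∃; _×_; _,_; proj₁; proj₂)
open import Data.Sum using (_⊎_)
open import Data.Empty using (⊥)
open import Data.Rational as ℚ using (ℚ; _<_; _≤_; _⊔_; _⊓_)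
open import Relation.Binary.PropositionalEquality using (_≡_; _≢_)
open import Relation.Nullary using (¬_)
open import Relation.Nullary.Decidable using (⌊_⌋; does)

-- cyclic successor of x in a cyclic list (x returned if x is absent)
cnext : ∀ {n} → List (Fin n) → Fin n → Fin n
cnext [] x = x
cnext {n} (h ∷ t) x = go (h ∷ t)
  where
  go : List (Fin n) → Fin n
  go [] = x
  go (y ∷ []) = if does (y ≟ x) then h else x
  go (y ∷ z ∷ r) = if does (y ≟ x) then z else go (z ∷ r)

iter : ∀ {A : Set} → ℕ → (A → A) → A → A
iter zero f a = a
iter (suc k) f a = f (iter k f a)

Dart : ℕ → Set
Dart n = Fin n × Fin n

-- A (connected, simple) graph with a rotation system:
-- rot v = cyclic order of the neighbours of v around v.
record RotSystem (n : ℕ) : Set where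
  field
    rot        : Fin n → List (Fin n)
    rot-unique : ∀ v → Unique (rot v)
    rot-irrefl : ∀ v → v ∉ rot v
    rot-sym    : ∀ u v → u ∈ rot v → v ∈ rot u

module _ {n : ℕ} (R : RotSystem n) where
  open RotSystem R

  Adj : Fin n → Fin n → Set
  Adj u v = v ∈ rot u

  -- face-traversal permutation on darts
  φ : Dart n → Dart n
  φ (u , v) = (v , cnext (rot v) u)

  SameFace : Dart n → Dart n → Set
  SameFace d e = ∃ λ k → iter k φ d ≡ e

  darts : List (Dart n)
  darts = concatMap (λ u → map (λ v → (u , v)) (rot u)) (allFin n)

  key : Dart n → ℕ
  key (u , v) = toℕ u * n + toℕ v

  isFaceRep : Dart n → Bool
  isFaceRep d = and (map (λ k → key d ≤ᵇ key (iter k φ d)) (upTo (length darts)))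

  numFaces : ℕ
  numFaces = length (filter (λ d → T? (isFaceRep d)) darts)

  data Reach (bad : Fin n → Set) : Fin n → Fin n → Set where
    here : ∀ {u} → Reach bad u u
    step : ∀ {u v w} → Adj u v → ¬ bad v → Reach bad v w → Reach bad u w

  Connected : Set
  Connected = ∀ u v → Reach (λ _ → ⊥) u v

  BiConnected : Set
  BiConnected = Connected × (∀ x u v → u ≢ x → v ≢ x → Reach (_≡ x) u v)

  -- genus 0 (Euler's formula V - E + F = 2, with 2E = number of darts)
  Spherical : Set
  Spherical = 2 * n + 2 * numFaces ≡ length darts + 4

-- A plane graph: connected spherical rotation system with a chosen
-- dart of the exterior face (exterior face = φ-orbit of `outer`).
record PlaneGraph (n : ℕ) : Set where
  field
    rs        : RotSystem n
    connected : Connected rs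
    spherical : Spherical rs
    outer     : Dart n
    outer-adj : Adj rs (proj₁ outer) (proj₂ outer)
  open RotSystem rs public

module _ {n : ℕ} (G : PlaneGraph n) where
  open PlaneGraph G

  E : Fin n → Fin n → Set
  E = Adj rs

  OuterDart : Dart n → Set
  OuterDart d = SameFace rs outer d

  IsTriangleFace : Dart n → Set
  IsTriangleFace d = (iter 3 (φ rs) d ≡ d) × (φ rs d ≢ d)

  -- darts reachable from the exterior face without crossing edges
  -- satisfying `blocked` (used to define the two sides of a cycle)
  data Outside (blocked : Fin n → Fin n → Set) : Dart n → Set where
    start : Outside blocked outer
    walk  : ∀ {d} → Outside blocked d → Outside blocked (φ rs d)
    cross : ∀ {u v} → Outside blocked (u , v) → ¬ blocked u v → Outside blocked (v , u)

  OnTri : Fin n → Fin n → Fin n → Fin n → Fin n → Set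
  OnTri a b c u v = ((u ≡ a × v ≡ b) ⊎ (u ≡ b × v ≡ a))
                  ⊎ ((u ≡ b × v ≡ c) ⊎ (u ≡ c × v ≡ b))
                  ⊎ ((u ≡ c × v ≡ a) ⊎ (u ≡ a × v ≡ c))

  -- a 3-cycle a b c with a vertex in its interior (the side not
  -- containing the exterior face)
  SeparatingTriangle : Fin n → Fin n → Fin n → Set
  SeparatingTriangle a b c =
    E a b × E b c × E c a ×
    ∃ λ x → x ≢ a × x ≢ b × x ≢ c ×
      ∃ λ y → E x y × ¬ Outside (OnTri a b c) (x , y)

  ExteriorVertex : Fin n → Set
  ExteriorVertex u = ∃ λ v → OuterDart (u , v)

record IsPTPG {n : ℕ} (G : PlaneGraph n) : Set where
  open PlaneGraph G
  field
    biconnected : BiConnected rs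
    inner-tri   : ∀ u v → E G u v → ¬ OuterDart G (u , v) → IsTriangleFace G (u , v)
    no-sep-tri  : ∀ a b c → ¬ SeparatingTriangle G a b c

record IsCIP {n : ℕ} (G : PlaneGraph n) (ps : List (Fin n)) : Set where
  field
    long        : 3 ℕ.≤ length ps
    distinct    : Unique ps
    consecutive : ∀ (i j : Fin (length ps)) → suc (toℕ i) ≡ toℕ j →
                  OuterDart G (lookup ps i , lookup ps j)
    ends        : ∀ (i j : Fin (length ps)) → toℕ i ≡ 0 → suc (toℕ j) ≡ length ps →
                  E G (lookup ps i) (lookup ps j) × ¬ OuterDart G (lookup ps j , lookup ps i)
    no-chords   : ∀ (i j : Fin (length ps)) → suc (toℕ i) ℕ.< toℕ j →
                  ¬ (toℕ i ≡ 0 × suc (toℕ j) ≡ length ps) →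
                  ¬ E G (lookup ps i) (lookup ps j)

AtMostFiveCIPs : ∀ {n} → PlaneGraph n → Set
AtMostFiveCIPs {n} G = ∀ (cs : List (List (Fin n))) → Unique cs → All (IsCIP G) cs → length cs ℕ.≤ 5

record Rect : Set where
  field
    x₁ x₂ y₁ y₂ : ℚ
    wpos : x₁ < x₂
    hpos : y₁ < y₂

module _ (r : Rect) where
  open Rect r
  InOpen : ℚ → ℚ → Set
  InOpen x y = (x₁ < x × x < x₂) × (y₁ < y × y < y₂)
  InClosed : ℚ → ℚ → Set
  InClosed x y = (x₁ ≤ x × x ≤ x₂) × (y₁ ≤ y × y ≤ y₂)

RectAdjacent : Rect → Rect → Set
RectAdjacent r s =
  ((Rect.x₂ r ≡ Rect.x₁ s ⊎ Rect.x₂ s ≡ Rect.x₁ r) × (Rect.y₁ r ⊔ Rect.y₁ s < Rect.y₂ r ⊓ Rect.y₂ s))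
  ⊎ ((Rect.y₂ r ≡ Rect.y₁ s ⊎ Rect.y₂ s ≡ Rect.y₁ r) × (Rect.x₁ r ⊔ Rect.x₁ s < Rect.x₂ r ⊓ Rect.x₂ s))

-- partition of a region (given by its interior) into rectangles indexed by Fin n
record FloorPlanOn (n : ℕ) (Inside : ℚ → ℚ → Set) : Set where
  field
    mod      : Fin n → Rect
    within   : ∀ i x y → InOpen (mod i) x y → Inside x y
    disjoint : ∀ i j → i ≢ j → ∀ x y → InOpen (mod i) x y → ¬ InOpen (mod j) x y
    cover    : ∀ x y → Inside x y → ∃ λ i → InClosed (mod i) x y

-- An L-shaped region: box [X₀,X₁]×[Y₀,Y₁] minus a notch box sharing exactly
-- one corner with it (rectilinear polygon with exactly one concave corner).
record LRegion : Set where
  field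
    X₀ X₁ Y₀ Y₁ NX₀ NX₁ NY₀ NY₁ : ℚ
    nx : (NX₀ ≡ X₀ × X₀ < NX₁ × NX₁ < X₁) ⊎ (NX₁ ≡ X₁ × X₀ < NX₀ × NX₀ < X₁)
    ny : (NY₀ ≡ Y₀ × Y₀ < NY₁ × NY₁ < Y₁) ⊎ (NY₁ ≡ Y₁ × Y₀ < NY₀ × NY₀ < Y₁)

LInside : LRegion → ℚ → ℚ → Set
LInside L x y = (X₀ < x × x < X₁) × (Y₀ < y × y < Y₁) ×
                ¬ ((NX₀ ≤ x × x ≤ NX₁) × (NY₀ ≤ y × y ≤ NY₁))
  where open LRegion L

record RectRegion : Set where
  field
    X₀ X₁ Y₀ Y₁ : ℚ
    wpos : X₀ < X₁
    hpos : Y₀ < Y₁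

RInside : RectRegion → ℚ → ℚ → Set
RInside B x y = (X₀ < x × x < X₁) × (Y₀ < y × y < Y₁)
  where open RectRegion B

record LFloorPlan (n : ℕ) : Set where
  field
    region : LRegion
    plan   : FloorPlanOn n (LInside region)

record RFloorPlan (n : ℕ) : Set where
  field
    region : RectRegion
    plan   : FloorPlanOn n (RInside region)

Corresponds : ∀ {n} {I : ℚ → ℚ → Set} → PlaneGraph n → FloorPlanOn n I → Set
Corresponds {n} G F = ∀ (i j : Fin n) → i ≢ j →
  (RectAdjacent (FloorPlanOn.mod F i) (FloorPlanOn.mod F j) → E G i j) ×
  (E G i j → RectAdjacent (FloorPlanOn.mod F i) (FloorPlanOn.mod F j))

-- F' arises from the L-shaped F by stretching/shrinking outer walls only:
-- every side of a module that lies entirely in the interior of F's region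
-- (an inner wall) keeps its position.
KeepsInnerWalls : ∀ {n} → LFloorPlan n → RFloorPlan n → Set
KeepsInnerWalls {n} F F' = ∀ (i : Fin n) →
    ((∀ y → y₁ i < y → y < y₂ i → Ins (x₁ i) y) → Rect.x₁ (m' i) ≡ x₁ i)
  × ((∀ y → y₁ i < y → y < y₂ i → Ins (x₂ i) y) → Rect.x₂ (m' i) ≡ x₂ i)
  × ((∀ x → x₁ i < x → x < x₂ i → Ins x (y₁ i)) → Rect.y₁ (m' i) ≡ y₁ i)
  × ((∀ x → x₁ i < x → x < x₂ i → Ins x (y₂ i)) → Rect.y₂ (m' i) ≡ y₂ i)
  where
  Ins = LInside (LFloorPlan.region F)
  m = FloorPlanOn.mod (LFloorPlan.plan F)
  m' = FloorPlanOn.mod (RFloorPlan.plan F')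
  x₁ x₂ y₁ y₂ : Fin n → ℚ
  x₁ i = Rect.x₁ (m i)
  x₂ i = Rect.x₂ (m i)
  y₁ i = Rect.y₁ (m i)
  y₂ i = Rect.y₂ (m i)

NonTrivial : ∀ {n} → PlaneGraph n → LFloorPlan n → Set
NonTrivial {n} G F = ¬ (∃ λ (F' : RFloorPlan n) →
  Corresponds G (RFloorPlan.plan F') × KeepsInnerWalls F F')

GoodTriplet : ∀ {n} → PlaneGraph n → Fin n → Fin n → Fin n → Set
GoodTriplet G a b c =
  ExteriorVertex G a × ExteriorVertex G b × ExteriorVertex G c ×
  a ≢ c × E G a b × E G b c × ¬ E G a c ×
  (∀ x → E G a x → E G c x → x ≡ b)

{-# OPTIONS --safe #-}
module Submission where

open import Defs
open import Data.Nat as ℕ using (ℕ; zero; suc; _+_; _*_; _∸_; z≤n; s≤s; _⊓_; _≡ᵇ_)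
import Data.Nat.Properties as ℕ
open import Data.Nat.DivMod using (_%_; _/_; m≡m%n+[m/n]*n; m%n<n)
open import Data.Nat.Tactic.RingSolver using (solve-∀)
open import Data.Fin as Fin using (Fin; toℕ; combine)
open import Data.Fin.Patterns using (0F; 1F; 2F; 3F; 4F)
import Data.Fin.Properties as Fin
open import Data.List using (List; []; _∷_; _++_; length; lookup; map; filter; allFin; concatMap; tabulate)
open import Data.List.Properties
  using (length-++; length-map; length-tabulate; filter-notAll; filter-all; filter-accept; filter-reject; tabulate-cong; tabulate-lookup)
open import Data.List.Membership.Propositional using (_∈_; _∉_)
open import Data.List.Membership.Propositional.Properties
  using (∈-lookup; ∈-concatMap⁺; ∈-concatMap⁻; ∈-map⁺; ∈-map⁻; ∈-filter⁺; ∈-filter⁻; ∈-allFin; ∈-upTo⁺; ∈-++⁻; ∈-++⁺ˡ; ∈-++⁺ʳ)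
open import Data.List.Relation.Unary.Any as Any using (Any; here; there)
open import Data.List.Relation.Unary.Any.Properties using (lookup-index)
open import Data.List.Relation.Unary.All as All using (All; []; _∷_)
import Data.List.Relation.Unary.All.Properties as All
open import Data.List.Relation.Unary.AllPairs as AllPairs using (AllPairs; []; _∷_)
import Data.List.Relation.Unary.AllPairs.Properties as AllPairs
open import Data.List.Relation.Unary.Unique.Propositional using (Unique)
import Data.List.Relation.Unary.Unique.Propositional.Properties as Unique
open import Data.Bool using (Bool; true; false; if_then_else_; T; _∧_; _∨_; not)
open import Data.Bool.Properties using (T?)
open import Data.Bool.ListAction using (and)
open import Data.Product using (∃; ∃₂; _×_; _,_; proj₁; proj₂; swap)
open import Data.Product.Properties using (,-injective; ,-injectiveˡ; ,-injectiveʳ; ≡-dec)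
open import Data.Sum as Sum using (_⊎_; inj₁; inj₂; [_,_]′)
open import Data.Empty using (⊥; ⊥-elim)
open import Data.Unit using (tt)
open import Data.Rational as ℚ using (ℚ; _⊔_)
import Data.Rational.Properties as ℚ
open import Function using (_∘_)
open import Relation.Binary.Definitions using (tri<; tri≈; tri>)
open import Relation.Binary.Structures using (IsStrictTotalOrder)
import Relation.Binary.Construct.Flip.EqAndOrd as Flip
open import Relation.Binary.PropositionalEquality
open import Relation.Nullary using (¬_; Dec; yes; no; contradiction; ¬?; _×-dec_; _⊎-dec_)
open import Relation.Nullary.Decidable using (does; dec-true; dec-false)

-- In a floor plan a common neighbour of two adjacent modules sits at an end of their common wall, and there is
-- at most one at each end. Hence modules that follow each other along the boundary have at most one common
-- neighbour. In a PTPG an edge off the exterior face has two common neighbours, so those edges are exterior.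
--
-- At the concave corner either a module a, the module at the corner and a module c, consecutive along the
-- boundary, form the required triplet, or one module bounds a whole wall of the notch; then the modules along
-- the other wall can be stretched over the notch, and the floor plan is trivial.
--
-- By Euler's formula the exterior face is a simple cycle (otherwise there is a cut vertex), so it coincides with
-- the boundary cycle of the floor plan. Along the boundary the modules strictly between two adjacent ones
-- include one at a convex corner of the region. Thus each CIP has a convex corner in its interior. Two
-- CIPs with a common interior vertex are equal, since neither contains the chord of the other and chords do not
-- cross, again by Euler's formula. As there are five convex corners, there are at most five CIPs.

-- Permutations and cyclic lists

-- The correspondence between `G` and the floor plan concerns adjacency only: nothing relates the
-- rotation system to the drawing. So the exterior face has to be recognised from common neighbours,
-- and the two orientations may be opposite. One exterior contact fixes the direction of all of
-- them; the opposite case is reduced to the other by exchanging the axes. Planarity is available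
-- only as the count V - E + F = 2. Each topological statement (no vertex is met twice, chords do
-- not cross) is derived by exhibiting a closed curve and showing that the edges it does not cross
-- still connect the graph, which `euler` forbids. On the geometric side only the order of the
-- coordinates enters. The cover by closed modules is turned into a cover of small quadrants at each
-- point. After that, each local configuration of at most four modules is a finite statement about
-- two linear orders, settled by a verified decision procedure.

Unique⇒lookup-injective : ∀ {A : Set} {xs : List A} → Unique xs → ∀ i j → lookup xs i ≡ lookup xs j → i ≡ j
Unique⇒lookup-injective (_ ∷ _) Fin.zero Fin.zero _ = refl
Unique⇒lookup-injective {xs = _ ∷ xs} (x∉ ∷ _) Fin.zero (Fin.suc j) e = contradiction e (All.lookup x∉ (∈-lookup j))
Unique⇒lookup-injective {xs = _ ∷ xs} (x∉ ∷ _) (Fin.suc i) Fin.zero e = contradiction (sym e) (All.lookup x∉ (∈-lookup i))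
Unique⇒lookup-injective (_ ∷ u) (Fin.suc i) (Fin.suc j) e = cong Fin.suc (Unique⇒lookup-injective u i j e)

index-injective : ∀ {A : Set} {x y : A} {xs} (p : x ∈ xs) (q : y ∈ xs) → Any.index p ≡ Any.index q → x ≡ y
index-injective {xs = xs} p q e = trans (lookup-index p) (trans (cong (lookup xs) e) (sym (lookup-index q)))

pigeonhole-list : ∀ {A : Set} {m} (ys : List A) → length ys ℕ.< m → (f : Fin m → A) → (∀ i → f i ∈ ys) →
                  ∃₂ λ i j → i Fin.< j × f i ≡ f j
pigeonhole-list ys lt f f∈ =
  let i , j , i<j , e = Fin.pigeonhole lt (λ i → Any.index (f∈ i))
  in i , j , i<j , index-injective (f∈ i) (f∈ j) e

Unique⇒length≤ : ∀ {A : Set} {xs : List A} → Unique xs → ∀ ys → (∀ {x} → x ∈ xs → x ∈ ys) → length xs ℕ.≤ length ys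
Unique⇒length≤ {xs = xs} u ys sub with length xs ℕ.≤? length ys
... | yes p = p
... | no ¬p =
  let i , j , i<j , e = pigeonhole-list ys (ℕ.≰⇒> ¬p) (lookup xs) (λ i → sub (∈-lookup i))
  in contradiction (Unique⇒lookup-injective u i j e) (Fin.<⇒≢ i<j)

least : ∀ {P : ℕ → Set} → (∀ k → Dec (P k)) → ∀ k → P k → ∃ λ m → P m × m ℕ.≤ k × (∀ j → j ℕ.< m → ¬ P j)
least P? zero p = 0 , p , z≤n , λ _ ()
least {P} P? (suc k) p with P? 0
... | yes p₀ = 0 , p₀ , z≤n , λ _ ()
... | no ¬p₀ with least (P? ∘ suc) k p
... | m , pm , m≤k , min = suc m , pm , s≤s m≤k , λ { zero _ → ¬p₀ ; (suc j) (s≤s j<m) → min j j<m }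

module _ {A : Set} (f : A → A) where

  iter-+ : ∀ m k x → iter (m + k) f x ≡ iter m f (iter k f x)
  iter-+ zero    k x = refl
  iter-+ (suc m) k x = cong f (iter-+ m k x)

  iter-* : ∀ k p x → iter p f x ≡ x → iter (k * p) f x ≡ x
  iter-* zero    p x e = refl
  iter-* (suc k) p x e = trans (iter-+ p (k * p) x) (trans (cong (iter p f) (iter-* k p x e)) e)

  -- After `k` steps, `k * q` further steps complete `k` full periods. This inverts steps along an
  -- orbit without subtraction.
  iter-back : ∀ k q x → iter (suc q) f x ≡ x → iter (k * q) f (iter k f x) ≡ x
  iter-back k q x e = trans (sym (iter-+ (k * q) k x))
    (trans (cong (λ m → iter m f x) (trans (ℕ.+-comm (k * q) k) (sym (ℕ.*-suc k q)))) (iter-* k (suc q) x e))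

  iter-% : ∀ k q x → iter (suc q) f x ≡ x → iter (k % suc q) f x ≡ iter k f x
  iter-% k q x e = sym (trans (cong (λ m → iter m f x) (m≡m%n+[m/n]*n k (suc q)))
    (trans (iter-+ (k % suc q) (k / suc q * suc q) x) (cong (iter (k % suc q) f) (iter-* (k / suc q) (suc q) x e))))

  module _ (inj : ∀ {x y} → f x ≡ f y → x ≡ y) where

    iter-injective : ∀ k {x y} → iter k f x ≡ iter k f y → x ≡ y
    iter-injective zero    e = e
    iter-injective (suc k) e = iter-injective k (inj e)

    abstract
      iter-period : ∀ xs x → (∀ k → iter k f x ∈ xs) → ∃ λ q → q ℕ.< length xs × iter (suc q) f x ≡ x
      iter-period xs x mem =
        let i , j , i<j , e = pigeonhole-list xs ℕ.≤-refl (λ i → iter (toℕ i) f x) (λ i → mem (toℕ i))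
            q , toℕj≡       = ℕ.m≤n⇒∃[o]m+o≡n i<j
            shift : toℕ j ≡ toℕ i + suc q
            shift = trans (sym toℕj≡) (sym (ℕ.+-suc (toℕ i) q))
        in q ,
           ℕ.≤-trans (ℕ.m≤n+m (suc q) (toℕ i)) (subst (ℕ._≤ length xs) shift (ℕ.≤-pred (Fin.toℕ<n j))) ,
           sym (iter-injective (toℕ i) (trans e (trans (cong (λ m → iter m f x) shift) (iter-+ (toℕ i) (suc q) x))))

-- The local loop of cnext, recovered by unification since it cannot be named from outside.
cnext-loop : ∀ {n} → Fin n → List (Fin n) → Fin n → List (Fin n) → Fin n
cnext-unfold : ∀ {n} (h : Fin n) t x → cnext (h ∷ t) x ≡ cnext-loop h t x (h ∷ t)
cnext-loop = _
cnext-unfold h t x with h ∷ t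
... | w = refl {x = cnext-loop h t x w}

-- Positions are plain numbers rather than elements of `Fin (length xs)`, so that `suc i` can be
-- formed before it is known to be in range.
data At {A : Set} : List A → ℕ → A → Set where
  here  : ∀ {x xs} → At (x ∷ xs) 0 x
  there : ∀ {x y xs i} → At xs i x → At (y ∷ xs) (suc i) x

module _ {A : Set} where

  At⇒∈ : ∀ {xs : List A} {i x} → At xs i x → x ∈ xs
  At⇒∈ here = here refl
  At⇒∈ (there p) = there (At⇒∈ p)

  ∈⇒At : ∀ {xs : List A} {x} → x ∈ xs → ∃ λ i → At xs i x
  ∈⇒At (here refl) = 0 , here
  ∈⇒At (there p) = let i , q = ∈⇒At p in suc i , there q

  At-< : ∀ {xs : List A} {i x} → At xs i x → i ℕ.< length xs
  At-< here = s≤s z≤n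
  At-< (there p) = s≤s (At-< p)

  At-total : ∀ (xs : List A) {i} → i ℕ.< length xs → ∃ λ x → At xs i x
  At-total (x ∷ xs) {zero} _ = x , here
  At-total (x ∷ xs) {suc i} (s≤s lt) = let y , p = At-total xs lt in y , there p

  At-functional : ∀ {xs : List A} {i x y} → At xs i x → At xs i y → x ≡ y
  At-functional here here = refl
  At-functional (there p) (there q) = At-functional p q

  At-injective : ∀ {xs : List A} {i j x} → Unique xs → At xs i x → At xs j x → i ≡ j
  At-injective _ here here = refl
  At-injective (x∉ ∷ _) here (there q) = contradiction refl (All.lookup x∉ (At⇒∈ q))
  At-injective (x∉ ∷ _) (there p) here = contradiction refl (All.lookup x∉ (At⇒∈ p))
  At-injective (_ ∷ u) (there p) (there q) = cong suc (At-injective u p q)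

module _ {n} (h : Fin n) (t : List (Fin n)) where

  cnext-loop-step : ∀ {ys i x z} → Unique ys → At ys i x → At ys (suc i) z → cnext-loop h t x ys ≡ z
  cnext-loop-step {y ∷ z ∷ r} u here (there here) rewrite dec-true (y Fin.≟ y) refl = refl
  cnext-loop-step {y ∷ w ∷ r} {x = x} (y∉ ∷ u) (there p) (there q)
    rewrite dec-false (y Fin.≟ x) (All.lookup y∉ (At⇒∈ p)) = cnext-loop-step u p q

  cnext-loop-last : ∀ {ys i x} → Unique ys → At ys i x → suc i ≡ length ys → cnext-loop h t x ys ≡ h
  cnext-loop-last {y ∷ []} u here e rewrite dec-true (y Fin.≟ y) refl = refl
  cnext-loop-last {y ∷ w ∷ r} {x = x} (y∉ ∷ u) (there p) e
    rewrite dec-false (y Fin.≟ x) (All.lookup y∉ (At⇒∈ p)) = cnext-loop-last u p (ℕ.suc-injective e)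

  cnext-loop-∉ : ∀ {ys x} → x ∉ ys → cnext-loop h t x ys ≡ x
  cnext-loop-∉ {[]} _ = refl
  cnext-loop-∉ {y ∷ []} {x} x∉ rewrite dec-false (y Fin.≟ x) (λ e → x∉ (here (sym e))) = refl
  cnext-loop-∉ {y ∷ z ∷ r} {x} x∉ =
    trans (cong (λ b → if b then z else cnext-loop h t x (z ∷ r)) (dec-false (y Fin.≟ x) (λ e → x∉ (here (sym e)))))
          (cnext-loop-∉ {z ∷ r} (x∉ ∘ there))

cnext-step : ∀ {n} {xs : List (Fin n)} {i x z} → Unique xs → At xs i x → At xs (suc i) z → cnext xs x ≡ z
cnext-step {xs = h ∷ t} {x = x} u p q = trans (cnext-unfold h t x) (cnext-loop-step h t u p q)

cnext-last : ∀ {n} {xs : List (Fin n)} {i x h} → Unique xs → At xs i x → suc i ≡ length xs → At xs 0 h → cnext xs x ≡ h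
cnext-last {xs = h ∷ t} {x = x} u p e here = trans (cnext-unfold h t x) (cnext-loop-last h t u p e)

cnext-∉ : ∀ {n} {xs : List (Fin n)} {x} → x ∉ xs → cnext xs x ≡ x
cnext-∉ {xs = []} _ = refl
cnext-∉ {xs = h ∷ t} {x} x∉ = trans (cnext-unfold h t x) (cnext-loop-∉ h t x∉)

module _ {n} {xs : List (Fin n)} (u : Unique xs) where

  private
    data Step (x : Fin n) : Set where
      inside : ∀ {i z} → At xs i x → At xs (suc i) z → cnext xs x ≡ z → Step x
      wrap   : ∀ {i z} → At xs i x → suc i ≡ length xs → At xs 0 z → cnext xs x ≡ z → Step x

    step? : ∀ {x} → x ∈ xs → Step x
    step? x∈ with ∈⇒At x∈
    ... | i , p with ℕ.m≤n⇒m<n∨m≡n (At-< p)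
    ... | inj₁ lt = let z , q = At-total xs lt in inside p q (cnext-step u p q)
    ... | inj₂ e  = let z , q = At-total xs (ℕ.≤-trans (s≤s z≤n) (At-< p)) in wrap p e q (cnext-last u p e q)

  cnext-∈ : ∀ {x} → x ∈ xs → cnext xs x ∈ xs
  cnext-∈ x∈ with step? x∈
  ... | inside _ q e = subst (_∈ xs) (sym e) (At⇒∈ q)
  ... | wrap _ _ q e = subst (_∈ xs) (sym e) (At⇒∈ q)

  private
    cnext-injective-∈ : ∀ {x y} → x ∈ xs → y ∈ xs → cnext xs x ≡ cnext xs y → x ≡ y
    cnext-injective-∈ x∈ y∈ e with step? x∈ | step? y∈
    ... | inside p q e₁ | inside p′ q′ e₂ with trans (sym e₁) (trans e e₂)
    ...   | refl with At-injective u q q′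
    ...   | refl = At-functional p p′
    cnext-injective-∈ x∈ y∈ e | inside p q e₁ | wrap _ _ q′ e₂ with trans (sym e₁) (trans e e₂)
    ...   | refl with () ← At-injective u q q′
    cnext-injective-∈ x∈ y∈ e | wrap _ _ q e₁ | inside _ q′ e₂ with trans (sym e₁) (trans e e₂)
    ...   | refl with () ← At-injective u q q′
    cnext-injective-∈ x∈ y∈ e | wrap p l _ _ | wrap p′ l′ _ _ with ℕ.suc-injective (trans l (sym l′))
    ...   | refl = At-functional p p′

  private
    _∈?_ : (x : Fin n) (ys : List (Fin n)) → Dec (x ∈ ys)
    x ∈? ys = Any.any? (x Fin.≟_) ys

  cnext-injective : ∀ {x y} → cnext xs x ≡ cnext xs y → x ≡ y
  cnext-injective {x} {y} e with x ∈? xs | y ∈? xs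
  ... | yes p | yes q = cnext-injective-∈ p q e
  ... | yes p | no q = contradiction (subst (_∈ xs) (trans e (cnext-∉ q)) (cnext-∈ p)) q
  ... | no p | yes q = contradiction (subst (_∈ xs) (trans (sym e) (cnext-∉ p)) (cnext-∈ q)) p
  ... | no p | no q = trans (sym (cnext-∉ p)) (trans e (cnext-∉ q))

  private
    from-head : ∀ {h} → At xs 0 h → ∀ i {x} → At xs i x → iter i (cnext xs) h ≡ x
    from-head h₀ zero p = At-functional h₀ p
    from-head h₀ (suc i) p with At-total xs (ℕ.<-trans (ℕ.n<1+n i) (At-< p))
    ... | y , q = trans (cong (cnext xs) (from-head h₀ i q)) (cnext-step u q p)

  cnext-iter-∈ : ∀ k {x} → x ∈ xs → iter k (cnext xs) x ∈ xs
  cnext-iter-∈ zero x∈ = x∈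
  cnext-iter-∈ (suc k) x∈ = cnext-∈ (cnext-iter-∈ k x∈)

  cnext-transitive : ∀ {x y} → x ∈ xs → y ∈ xs → ∃ λ k → iter k (cnext xs) x ≡ y
  cnext-transitive {x} {y} x∈ y∈ =
    let i , p = ∈⇒At x∈
        j , r = ∈⇒At y∈
        h , h₀ = At-total xs (ℕ.≤-trans (s≤s z≤n) (At-< p))
        from = from-head h₀ i p
        q , _ , per = iter-period (cnext xs) cnext-injective xs h (λ k → cnext-iter-∈ k (At⇒∈ h₀))
    -- From `x` at position `i`, `i * q` steps lead back to the head `h`, and `j` more reach `y`.
    in j + i * q ,
       trans (iter-+ (cnext xs) j (i * q) x)
         (trans (cong (iter j (cnext xs)) (trans (cong (iter (i * q) (cnext xs)) (sym from)) (iter-back (cnext xs) i q h per)))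
           (from-head h₀ j r))

-- The Jordan curve theorem for rotation systems

module _ {A : Set} where

  abstract
    merge : (A → ℕ) → A → A → A → ℕ
    merge c a b x = if does (c x ℕ.≟ c a) then c b else c x

    merge-≡ : ∀ c a b x → c x ≡ c a → merge c a b x ≡ c b
    merge-≡ c a b x e rewrite dec-true (c x ℕ.≟ c a) e = refl

    merge-≢ : ∀ c a b x → c x ≢ c a → merge c a b x ≡ c x
    merge-≢ c a b x e rewrite dec-false (c x ℕ.≟ c a) e = refl

    merge-resp : ∀ c a b {x y} → c x ≡ c y → merge c a b x ≡ merge c a b y
    merge-resp c a b {x} {y} e rewrite e = refl

  -- Union-find by relabelling: starting from the classes of `c`, each pair fuses two classes. With
  -- vertex numbers for `c` this gives the components of a graph, with `faceLabel` the faces joined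
  -- across a set of edges.
  labels : (A → ℕ) → List (A × A) → A → ℕ
  labels c []             = c
  labels c ((a , b) ∷ es) = merge (labels c es) a b

  merge-glue : ∀ c a b → merge c a b a ≡ merge c a b b
  merge-glue c a b with c b ℕ.≟ c a
  ... | yes e = merge-resp c a b (sym e)
  ... | no ¬e = trans (merge-≡ c a b a refl) (sym (merge-≢ c a b b ¬e))

  labels-resp : ∀ c es {x y} → c x ≡ c y → labels c es x ≡ labels c es y
  labels-resp c []             e = e
  labels-resp c ((a , b) ∷ es) e = merge-resp (labels c es) a b (labels-resp c es e)

  labels-glue : ∀ c {es a b} → (a , b) ∈ es → labels c es a ≡ labels c es b
  labels-glue c {_ ∷ es} (here refl) = merge-glue (labels c es) _ _
  labels-glue c {(a , b) ∷ es} (there p) = merge-resp (labels c es) a b (labels-glue c p)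

  Distinct : (A → ℕ) → List A → Set
  Distinct c = AllPairs (λ x y → c x ≢ c y)

  filter-≢-length : ∀ c a xs → Distinct c xs → length xs ℕ.≤ suc (length (filter (λ x → ¬? (c x ℕ.≟ c a)) xs))
  filter-≢-length c a [] [] = z≤n
  filter-≢-length c a (x ∷ xs) (px ∷ pxs) = go (c x ℕ.≟ c a)
    where
    P? = λ x → ¬? (c x ℕ.≟ c a)
    go : Dec (c x ≡ c a) → length (x ∷ xs) ℕ.≤ suc (length (filter P? (x ∷ xs)))
    go (yes e) rewrite filter-reject P? {x} {xs} (λ ne → ne e)
                     | filter-all P? (All.map (λ ne e′ → ne (trans e (sym e′))) px) = ℕ.≤-refl
    go (no ¬e) rewrite filter-accept P? {x} {xs} ¬e = s≤s (filter-≢-length c a xs pxs)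

  private
    merge-distinct : ∀ c a b xs → All (λ x → c x ≢ c a) xs → Distinct c xs → Distinct (merge c a b) xs
    merge-distinct c a b [] _ _ = []
    merge-distinct c a b (x ∷ xs) (n ∷ ns) (p ∷ ps) =
      All.zipWith (λ {y} (n′ , q) e → q (trans (sym (merge-≢ c a b x n)) (trans e (merge-≢ c a b y n′)))) (ns , p)
      ∷ merge-distinct c a b xs ns ps

  -- A fusion costs at most one class: dropping the representative labelled like `a` leaves the
  -- labels of the others unchanged, hence distinct.
  labels-count : ∀ c es xs → Distinct c xs → ∃ λ ys →
                 Distinct (labels c es) ys × (∀ {x} → x ∈ ys → x ∈ xs) × length xs ℕ.≤ length ys + length es
  labels-count c [] xs d = xs , d , (λ p → p) , ℕ.m≤m+n _ _
  labels-count c ((a , b) ∷ es) xs d =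
    let ys , dys , sub , le = labels-count c es xs d
        c′ = labels c es
        P? = λ x → ¬? (c′ x ℕ.≟ c′ a)
    in filter P? ys ,
       merge-distinct c′ a b (filter P? ys) (All.all-filter P? ys) (AllPairs.filter⁺ P? dys) ,
       (λ p → sub (proj₁ (∈-filter⁻ P? {xs = ys} p))) ,
       ℕ.≤-trans le (ℕ.≤-trans (ℕ.+-monoˡ-≤ (length es) (filter-≢-length c′ a ys dys))
                               (ℕ.≤-reflexive (sym (ℕ.+-suc _ (length es)))))

  labels-connected : ∀ c es xs → Distinct c xs → 
                     (∀ {x y} → x ∈ xs → y ∈ xs → labels c es x ≡ labels c es y) → length xs ℕ.≤ suc (length es)
  labels-connected c es xs d const with labels-count c es xs d
  ... | [] , _ , _ , le = ℕ.≤-trans le (ℕ.n≤1+n _)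
  ... | _ ∷ [] , _ , _ , le = le
  ... | x ∷ y ∷ _ , (ne ∷ _) ∷ _ , sub , _ = contradiction (const (sub (here refl)) (sub (there (here refl)))) ne

-- Darts, and the contour of a forest

_≟ᵈ_ : ∀ {n} (d e : Dart n) → Dec (d ≡ e)
_≟ᵈ_ = ≡-dec Fin._≟_ Fin._≟_

module Darts {n : ℕ} (R : RotSystem n) where
  open RotSystem R public

  IsDart : Dart n → Set
  IsDart (u , v) = Adj R u v

  α σ ϕ : Dart n → Dart n
  α (u , v) = v , u
  σ (u , v) = u , cnext (rot u) v
  ϕ = φ R

  α-dart : ∀ {d} → IsDart d → IsDart (α d)
  α-dart = rot-sym _ _

  σ-dart : ∀ {d} → IsDart d → IsDart (σ d)
  σ-dart = cnext-∈ (rot-unique _)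

  ϕ-dart : ∀ {d} → IsDart d → IsDart (ϕ d)
  ϕ-dart p = σ-dart (α-dart p)

  Adj-irrefl : ∀ {u} → ¬ Adj R u u
  Adj-irrefl = rot-irrefl _

  Adj⇒≢ : ∀ {u v} → Adj R u v → u ≢ v
  Adj⇒≢ p refl = Adj-irrefl p

  σ-injective : ∀ {d e} → σ d ≡ σ e → d ≡ e
  σ-injective {u , v} {u′ , v′} eq with ,-injective eq
  ... | refl , e = cong (u ,_) (cnext-injective (rot-unique u) e)

  ϕ-injective : ∀ {d e} → ϕ d ≡ ϕ e → d ≡ e
  ϕ-injective eq = cong α (σ-injective eq)

  ∈-darts : ∀ {d} → IsDart d → d ∈ darts R
  ∈-darts {u , v} p = ∈-concatMap⁺ _ (Any.map (λ { refl → ∈-map⁺ (u ,_) p }) (∈-allFin u))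

  darts-∈ : ∀ {d} → d ∈ darts R → IsDart d
  darts-∈ {u , v} p with Any.satisfied (∈-concatMap⁻ (λ u → map (u ,_) (rot u)) {allFin n} p)
  ... | w , q with ∈-map⁻ (w ,_) q
  ... | _ , r , refl = r

  darts-unique : Unique (darts R)
  darts-unique = Unique.concat⁺
    (All.map⁺ (All.universal (λ u → Unique.map⁺ ,-injectiveʳ (rot-unique u)) (allFin n)))
    (AllPairs.map⁺ (AllPairs.map (λ u≢v {_} pq → u≢v (trans (sym (proj₁∈ (proj₁ pq))) (proj₁∈ (proj₂ pq)))) (Unique.allFin⁺ n)))
    where
    proj₁∈ : ∀ {u xs d} → d ∈ map (u ,_) xs → proj₁ d ≡ u
    proj₁∈ {u} p with ∈-map⁻ (u ,_) p
    ... | _ , _ , refl = refl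

  iter-dart : ∀ (f : Dart n → Dart n) → (∀ {d} → IsDart d → IsDart (f d)) → ∀ k {d} → IsDart d → IsDart (iter k f d)
  iter-dart f pres zero p = p
  iter-dart f pres (suc k) p = pres (iter-dart f pres k p)

  dart-period : ∀ (f : Dart n → Dart n) → (∀ {d e} → f d ≡ f e → d ≡ e) → (∀ {d} → IsDart d → IsDart (f d)) →
                ∀ {d} → IsDart d → ∃ λ q → q ℕ.< length (darts R) × iter (suc q) f d ≡ d
  dart-period f inj pres p = iter-period f inj (darts R) _ (λ k → ∈-darts (iter-dart f pres k p))

  ϕ-period : ∀ {d} → IsDart d → ∃ λ q → q ℕ.< length (darts R) × iter (suc q) ϕ d ≡ d
  ϕ-period = dart-period ϕ ϕ-injective ϕ-dart

  SameFace-sym : ∀ {d e} → IsDart d → SameFace R d e → SameFace R e d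
  SameFace-sym {d} p (k , refl) with ϕ-period p
  ... | q , _ , per = k * q , iter-back ϕ k q d per

  SameFace-trans : ∀ {d e f} → SameFace R d e → SameFace R e f → SameFace R d f
  SameFace-trans {d} (k , refl) (l , refl) = l + k , iter-+ ϕ l k d

  SameFace-bounded : ∀ {d e} → IsDart d → SameFace R d e → ∃ λ k → k ℕ.< length (darts R) × iter k ϕ d ≡ e
  SameFace-bounded {d} p (k , e) with ϕ-period p
  ... | q , q<N , per = k % suc q , ℕ.≤-trans (m%n<n k (suc q)) q<N , trans (iter-% ϕ k q d per) e

  SameFace? : ∀ {d} → IsDart d → ∀ e → Dec (SameFace R d e)
  SameFace? {d} p e with ℕ.anyUpTo? (λ k → iter k ϕ d ≟ᵈ e) (length (darts R))
  ... | yes (k , _ , eq) = yes (k , eq)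
  ... | no ¬q = no (¬q ∘ SameFace-bounded p)

  onEdge : List (Dart n) → Dart n → Set
  onEdge es d = d ∈ es ⊎ α d ∈ es

  onEdge? : ∀ es d → Dec (onEdge es d)
  onEdge? es d = Any.any? (d ≟ᵈ_) es ⊎-dec Any.any? (α d ≟ᵈ_) es

  abstract
    -- `σ ∘ τ es` interpolates between the rotation `σ` (no edges) and the face permutation `ϕ` (all
    -- edges).
    τ : List (Dart n) → Dart n → Dart n
    τ es d = if does (onEdge? es d) then α d else d

    τ-on : ∀ es {d} → onEdge es d → τ es d ≡ α d
    τ-on es {d} p rewrite dec-true (onEdge? es d) p = refl

    τ-off : ∀ es {d} → ¬ onEdge es d → τ es d ≡ d
    τ-off es {d} p rewrite dec-false (onEdge? es d) p = refl

  module _ (es : List (Dart n)) where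

    private
      onEdge-α : ∀ {d} → onEdge es d → onEdge es (α d)
      onEdge-α (inj₁ p) = inj₂ p
      onEdge-α (inj₂ p) = inj₁ p

    τ-involutive : ∀ d → τ es (τ es d) ≡ d
    τ-involutive d = go (onEdge? es d)
      where
      go : Dec (onEdge es d) → τ es (τ es d) ≡ d
      go (yes p) = trans (cong (τ es) (τ-on es p)) (τ-on es (onEdge-α p))
      go (no ¬p) = trans (cong (τ es) (τ-off es ¬p)) (τ-off es ¬p)

    τ-injective : ∀ {d e} → τ es d ≡ τ es e → d ≡ e
    τ-injective {d} {e} eq = trans (sym (τ-involutive d)) (trans (cong (τ es) eq) (τ-involutive e))

    τ-dart : ∀ {d} → IsDart d → IsDart (τ es d)
    τ-dart {d} p = go (onEdge? es d)
      where
      go : Dec (onEdge es d) → IsDart (τ es d)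
      go (yes q) = subst IsDart (sym (τ-on es q)) (α-dart p)
      go (no ¬q) = subst IsDart (sym (τ-off es ¬q)) p

  lab : List (Dart n) → Fin n → ℕ
  lab = labels toℕ

  data Forest : List (Dart n) → Set where
    []  : Forest []
    _∷_ : ∀ {a b es} → (Adj R a b × lab es a ≢ lab es b) → Forest es → Forest ((a , b) ∷ es)

  -- The boundary of a neighbourhood of a tree is a single closed curve: the permutation σ ∘ τ
  -- walks around the forest, and adding an edge between two components joins their contours.
  contour : ∀ {es} → Forest es → (f : Dart n → ℕ) → (∀ {d} → IsDart d → f (σ (τ es d)) ≡ f d) →
            ∀ {d e} → IsDart d → IsDart e → lab es (proj₁ d) ≡ lab es (proj₁ e) → f d ≡ f e
  contour [] f inv {u , u′} {v , v′} p q l with Fin.toℕ-injective l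
  ... | refl with cnext-transitive (rot-unique u) p q
  ... | k , e = trans (sym (rotate k)) (cong (f ∘ (u ,_)) e)
    where
    rotate : ∀ k → f (u , iter k (cnext (rot u)) u′) ≡ f (u , u′)
    rotate zero = refl
    rotate (suc k) = trans (cong (f ∘ σ) (sym (τ-off [] {u , iter k (cnext (rot u)) u′} λ { (inj₁ ()) ; (inj₂ ()) })))
      (trans (inv {u , iter k (cnext (rot u)) u′} (cnext-iter-∈ (rot-unique u) k p)) (rotate k))
  contour {(a , b) ∷ es} ((ab , a≁b) ∷ forest) f inv {d} {e} p q l = joined
    where
    es⁺ = (a , b) ∷ es
    π = σ ∘ τ es
    d₀ = (b , a)
    ba = α-dart {a , b} ab

    same-component : ∀ {d} → onEdge es d → lab es (proj₁ d) ≡ lab es (proj₂ d)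
    same-component (inj₁ p) = labels-glue toℕ p
    same-component (inj₂ p) = sym (labels-glue toℕ p)

    off-ab : ¬ onEdge es (a , b)
    off-ab = a≁b ∘ same-component

    off-ba : ¬ onEdge es (b , a)
    off-ba = a≁b ∘ sym ∘ same-component

    on-ab : onEdge es⁺ (a , b)
    on-ab = inj₁ (here refl)

    on-ba : onEdge es⁺ (b , a)
    on-ba = inj₂ (here refl)

    τ-same : ∀ {d} → d ≢ (a , b) → d ≢ (b , a) → τ es⁺ d ≡ τ es d
    τ-same {d} n₁ n₂ = go (onEdge? es d)
      where
      go : Dec (onEdge es d) → τ es⁺ d ≡ τ es d
      go (yes p) = trans (τ-on es⁺ ([ inj₁ ∘ there , inj₂ ∘ there ]′ p)) (sym (τ-on es p))
      go (no ¬p) = trans (τ-off es⁺ λ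
        { (inj₁ (here e)) → n₁ e
        ; (inj₁ (there p)) → ¬p (inj₁ p)
        ; (inj₂ (here e)) → n₂ (cong α e)
        ; (inj₂ (there p)) → ¬p (inj₂ p) }) (sym (τ-off es ¬p))

    inv-off : ∀ {d} → IsDart d → d ≢ (a , b) → d ≢ (b , a) → f (π d) ≡ f d
    inv-off p n₁ n₂ = trans (cong (f ∘ σ) (sym (τ-same n₁ n₂))) (inv p)

    π-dart : ∀ {d} → IsDart d → IsDart (π d)
    π-dart = σ-dart ∘ τ-dart es

    π-component : ∀ d → lab es (proj₁ (π d)) ≡ lab es (proj₁ d)
    π-component d = go (onEdge? es d)
      where
      go : Dec (onEdge es d) → lab es (proj₁ (π d)) ≡ lab es (proj₁ d)
      go (yes p) = trans (cong (lab es ∘ proj₁) (τ-on es p)) (sym (same-component p))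
      go (no ¬p) = cong (lab es ∘ proj₁) (τ-off es ¬p)

    orbit-component : ∀ k → lab es (proj₁ (iter k π d₀)) ≡ lab es b
    orbit-component zero = refl
    orbit-component (suc k) = trans (π-component (iter k π d₀)) (orbit-component k)

    -- The `π`-orbit of `(b , a)` stays in the component of `b`, so it never meets `(a , b)`. Until
    -- it returns to `d₀`, the new edge does not affect it and `f` is constant along it. The second
    -- alternative records that it has returned.
    orbit-value : ∀ k → f (iter (suc k) π d₀) ≡ f (π d₀) ⊎ f (π d₀) ≡ f d₀
    orbit-value zero = inj₁ refl
    orbit-value (suc k) with orbit-value k
    ... | inj₂ e = inj₂ e
    ... | inj₁ e with iter (suc k) π d₀ ≟ᵈ d₀
    ...   | yes r = inj₂ (trans (sym e) (cong f r))
    ...   | no r = inj₁ (trans (inv-off (iter-dart π π-dart (suc k) ba)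
                                 (λ r′ → a≁b (trans (cong (lab es ∘ proj₁) (sym r′)) (orbit-component (suc k)))) r) e)

    returns : f (π d₀) ≡ f d₀
    returns with dart-period π (τ-injective es ∘ σ-injective) π-dart ba
    ... | q , _ , per with orbit-value q
    ...   | inj₂ e = e
    ...   | inj₁ e = trans (sym e) (cong f per)

    f-edge : f (b , a) ≡ f (a , b)
    f-edge = trans (sym returns) (trans (cong (f ∘ σ) (trans (τ-off es off-ba) (sym (τ-on es⁺ on-ab)))) (inv ab))

    inv′ : ∀ {d} → IsDart d → f (π d) ≡ f d
    inv′ {d} p with d ≟ᵈ (a , b) | d ≟ᵈ (b , a)
    ... | no n₁ | no n₂ = inv-off p n₁ n₂
    ... | _ | yes refl = returns
    ... | yes refl | _ =
      trans (cong (f ∘ σ) (trans (τ-off es off-ab) (sym (τ-on es⁺ on-ba)))) (trans (inv ba) f-edge)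

    IH : ∀ {d e} → IsDart d → IsDart e → lab es (proj₁ d) ≡ lab es (proj₁ e) → f d ≡ f e
    IH = contour forest f inv′

    joined : f d ≡ f e
    joined with lab es (proj₁ d) ℕ.≟ lab es a | lab es (proj₁ e) ℕ.≟ lab es a
    ... | yes x | yes y = IH p q (trans x (sym y))
    ... | no x  | no y  = IH p q (trans (sym (merge-≢ (lab es) a b _ x)) (trans l (merge-≢ (lab es) a b _ y)))
    ... | yes x | no y  = trans (IH p ab x) (trans (sym f-edge)
      (IH ba q (trans (sym (merge-≡ (lab es) a b _ x)) (trans l (merge-≢ (lab es) a b _ y)))))
    ... | no x  | yes y = trans (IH p ba (trans (sym (merge-≢ (lab es) a b _ x)) (trans l (merge-≡ (lab es) a b _ y))))
      (trans f-edge (IH ab q (sym y)))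

-- Counting faces, and Euler's formula as a separation theorem

module Faces {n : ℕ} (R : RotSystem n) where
  open Darts R

  private
    N = length (darts R)

  minKey : ℕ → Dart n → ℕ
  minKey zero    d = key R d
  minKey (suc k) d = key R (iter (suc k) ϕ d) ⊓ minKey k d

  minKey-≤ : ∀ k d j → j ℕ.≤ k → minKey k d ℕ.≤ key R (iter j ϕ d)
  minKey-≤ zero d zero z≤n = ℕ.≤-refl
  minKey-≤ (suc k) d j j≤k with ℕ.m≤n⇒m<n∨m≡n j≤k
  ... | inj₁ (s≤s lt) = ℕ.≤-trans (ℕ.m⊓n≤n _ (minKey k d)) (minKey-≤ k d j lt)
  ... | inj₂ refl     = ℕ.m⊓n≤m _ (minKey k d)

  minKey-attained : ∀ k d → ∃ λ j → minKey k d ≡ key R (iter j ϕ d)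
  minKey-attained zero d = 0 , refl
  minKey-attained (suc k) d with ℕ.⊓-sel (key R (iter (suc k) ϕ d)) (minKey k d)
  ... | inj₁ e = suc k , e
  ... | inj₂ e = let j , e′ = minKey-attained k d in j , trans e e′

  -- The least key on the face of `d`, since `N` steps exhaust the orbit. The darts counted by
  -- `numFaces` attain it, so different ones carry different labels.
  faceLabel : Dart n → ℕ
  faceLabel = minKey N

  faceLabel-≤ : ∀ {d e} → IsDart d → SameFace R d e → faceLabel d ℕ.≤ key R e
  faceLabel-≤ {d} p s with SameFace-bounded p s
  ... | k , k<N , refl = minKey-≤ N d k (ℕ.<⇒≤ k<N)

  faceLabel-mono : ∀ {d e} → IsDart d → SameFace R d e → faceLabel d ℕ.≤ faceLabel e
  faceLabel-mono {d} {e} p s with minKey-attained N e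
  ... | j , eq = subst (faceLabel d ℕ.≤_) (sym eq) (faceLabel-≤ p (SameFace-trans s (j , refl)))

  faceLabel-ϕ : ∀ {d} → IsDart d → faceLabel (ϕ d) ≡ faceLabel d
  faceLabel-ϕ p = ℕ.≤-antisym (faceLabel-mono (ϕ-dart p) (SameFace-sym p (1 , refl))) (faceLabel-mono p (1 , refl))

  key-injective : ∀ {d e} → key R d ≡ key R e → d ≡ e
  key-injective {u , v} {u′ , v′} eq = cong₂ _,_ (Fin.combine-injectiveˡ u v u′ v′ c) (Fin.combine-injectiveʳ u v u′ v′ c)
    where
    toℕ-key : ∀ (u v : Fin n) → toℕ (combine u v) ≡ key R (u , v)
    toℕ-key u v = trans (Fin.toℕ-combine u v) (cong (_+ toℕ v) (ℕ.*-comm n (toℕ u)))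
    c : combine u v ≡ combine u′ v′
    c = Fin.toℕ-injective (trans (toℕ-key u v) (trans eq (sym (toℕ-key u′ v′))))

  private
    and-∈ : ∀ {bs b} → T (and bs) → b ∈ bs → T b
    and-∈ {true ∷ bs} t (here refl) = _
    and-∈ {true ∷ bs} t (there p) = and-∈ t p

  faceLabel-rep : ∀ {d} → IsDart d → T (isFaceRep R d) → faceLabel d ≡ key R d
  faceLabel-rep {d} p rep with minKey-attained N d
  ... | j , eq with SameFace-bounded p (j , refl)
  ... | k , k<N , e = ℕ.≤-antisym (faceLabel-≤ p (0 , refl))
    (subst (key R d ℕ.≤_) (sym (trans eq (cong (key R) (sym e))))
      (ℕ.≤ᵇ⇒≤ _ _ (and-∈ rep (∈-map⁺ _ (∈-upTo⁺ k<N)))))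

  faceReps : List (Dart n)
  faceReps = filter (λ d → T? (isFaceRep R d)) (darts R)

  private
    strengthen : ∀ {xs} → (∀ {d} → d ∈ xs → IsDart d × T (isFaceRep R d)) → Unique xs → Distinct faceLabel xs
    strengthen ok [] = []
    strengthen ok (p ∷ ps) =
      All.tabulate (λ {e} e∈ eq → All.lookup p e∈
        (key-injective (trans (sym (label (here refl))) (trans eq (label (there e∈))))))
      ∷ strengthen (ok ∘ there) ps
      where
      label = λ {d} d∈ → faceLabel-rep {d} (proj₁ (ok d∈)) (proj₂ (ok d∈))

  faceReps-distinct : Distinct faceLabel faceReps
  faceReps-distinct = strengthen
    (λ d∈ → let p , q = ∈-filter⁻ (λ d → T? (isFaceRep R d)) {xs = darts R} d∈ in darts-∈ p , q)
    (Unique.filter⁺ (λ d → T? (isFaceRep R d)) darts-unique)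

  edges : List (Dart n)
  edges = filter (λ d → proj₁ d Fin.<? proj₂ d) (darts R)

  edges-∈ : ∀ {d} → d ∈ edges → IsDart d × proj₁ d Fin.< proj₂ d
  edges-∈ p = let q , lt = ∈-filter⁻ (λ d → proj₁ d Fin.<? proj₂ d) {xs = darts R} p in darts-∈ q , lt

  ∈-edges : ∀ {u v} → Adj R u v → (u , v) ∈ edges ⊎ (v , u) ∈ edges
  ∈-edges {u} {v} p with Fin.<-cmp u v
  ... | tri< lt _ _ = inj₁ (∈-filter⁺ (λ d → proj₁ d Fin.<? proj₂ d) (∈-darts p) lt)
  ... | tri≈ _ e _  = contradiction e (Adj⇒≢ p)
  ... | tri> _ _ gt = inj₂ (∈-filter⁺ (λ d → proj₁ d Fin.<? proj₂ d) (∈-darts (α-dart p)) gt)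

  edges-length : length edges + length edges ℕ.≤ length (darts R)
  edges-length = subst (ℕ._≤ length (darts R))
    (trans (length-++ edges) (cong (length edges +_) (length-map α edges)))
    (Unique⇒length≤ (Unique.++⁺ uE (Unique.map⁺ (cong α) uE) disj) (darts R) sub)
    where
    uE : Unique edges
    uE = Unique.filter⁺ (λ d → proj₁ d Fin.<? proj₂ d) darts-unique
    disj : ∀ {d} → ¬ (d ∈ edges × d ∈ map α edges)
    disj (p , q) with ∈-map⁻ α q
    ... | _ , r , refl = Fin.<-asym (proj₂ (edges-∈ p)) (proj₂ (edges-∈ r))
    sub : ∀ {d} → d ∈ edges ++ map α edges → d ∈ darts R
    sub p with ∈-++⁻ edges p
    ... | inj₁ q = ∈-darts (proj₁ (edges-∈ q))
    ... | inj₂ q with ∈-map⁻ α q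
    ...   | _ , r , refl = ∈-darts (α-dart (proj₁ (edges-∈ r)))

  module _ (S : Dart n → Set) (S? : ∀ d → Dec (S d)) where

    -- The outcome of Kruskal's algorithm on the edges outside `S`: `tree` is a spanning forest of
    -- them, `rest` collects the edges in `S` and those that would close a cycle.
    record Split (es : List (Dart n)) : Set where
      field
        tree rest  : List (Dart n)
        forest     : Forest tree
        tree-∉     : ∀ {d} → d ∈ tree → d ∈ es × ¬ S d
        covered    : ∀ {d} → d ∈ es → d ∈ tree ⊎ d ∈ rest
        size       : length tree + length rest ≡ length es
        spans      : ∀ {u v} → (u , v) ∈ es → ¬ S (u , v) → lab tree u ≡ lab tree v

    split : ∀ es → (∀ {d} → d ∈ es → IsDart d) → Split es
    split [] _ = record
      { tree = [] ; rest = [] ; forest = [] ; tree-∉ = λ () ; covered = λ () ; size = refl ; spans = λ () }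
    split ((a , b) ∷ es) ok = extend (S? (a , b)) (lab tree a ℕ.≟ lab tree b)
      where
      open Split (split es (ok ∘ there))
      reject : (¬ S (a , b) → lab tree a ≡ lab tree b) → Split ((a , b) ∷ es)
      reject same = record
        { tree = tree ; rest = (a , b) ∷ rest ; forest = forest
        ; tree-∉ = λ p → let q , s = tree-∉ p in there q , s
        ; covered = λ { (here e) → inj₂ (here e) ; (there p) → [ inj₁ , inj₂ ∘ there ]′ (covered p) }
        ; size = trans (ℕ.+-suc (length tree) (length rest)) (cong suc size)
        ; spans = λ { (here refl) ¬s → same ¬s ; (there p) ¬s → spans p ¬s } }
      extend : Dec (S (a , b)) → Dec (lab tree a ≡ lab tree b) → Split ((a , b) ∷ es)
      extend (yes s) _ = reject (λ ¬s → contradiction s ¬s)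
      extend (no _) (yes e) = reject (λ _ → e)
      extend (no ¬s) (no ne) = record
        { tree = (a , b) ∷ tree ; rest = rest ; forest = (ok (here refl) , ne) ∷ forest
        ; tree-∉ = λ { (here refl) → here refl , ¬s ; (there p) → let q , s = tree-∉ p in there q , s }
        ; covered = λ { (here e) → inj₁ (here e) ; (there p) → [ inj₁ ∘ there , inj₂ ]′ (covered p) }
        ; size = cong suc size
        ; spans = λ { (here refl) _ → merge-glue (lab tree) a b
                    ; (there p) ¬s′ → merge-resp (lab tree) a b (spans p ¬s′) } }

  -- A closed curve on the sphere separates: the curve crosses exactly the edges in S, and s only once.
  -- If the edges outside S were connected, they would contain a spanning tree with n - 1 edges,
  -- the faces would be connected across the other edges even without s, and V - E + F < 2.
  euler : Spherical R → (S : Dart n → Set) → (∀ d → Dec (S d)) → (∀ {d} → S d → S (α d)) →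
    (∀ (c : Fin n → ℕ) → (∀ {u v} → Adj R u v → ¬ S (u , v) → c u ≡ c v) → ∀ u v → c u ≡ c v) →
    ∀ s → IsDart s → S s →
    (∀ (f : Dart n → ℕ) → (∀ {d} → IsDart d → f (ϕ d) ≡ f d) →
      (∀ {d} → IsDart d → S d → d ≢ s → α d ≢ s → f (α d) ≡ f d) → f (α s) ≡ f s) → ⊥
  euler sph S S? S-α connected s s-dart s∈S curve = ℕ.<-irrefl refl (begin-strict
      length (darts R) + 4                      ≡⟨ sph ⟨
      2 * n + 2 * length faceReps               ≤⟨ ℕ.+-mono-≤ (ℕ.*-monoʳ-≤ 2 n≤) (ℕ.*-monoʳ-≤ 2 F≤) ⟩
      -- The contradiction comes from `s`, which lies in `rest` but is not counted in `crossed`.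
      2 * suc (length tree) + 2 * suc (length crossed)  <⟨ ℕ.+-monoʳ-< (2 * suc (length tree)) (ℕ.*-monoʳ-< 2 (s≤s crossed<)) ⟩
      2 * suc (length tree) + 2 * suc (length rest) ≡⟨ arith (length tree) (length rest) ⟩
      ((length tree + length rest) + (length tree + length rest)) + 4 ≡⟨ cong (λ m → m + m + 4) size ⟩
      (length edges + length edges) + 4         ≤⟨ ℕ.+-monoˡ-≤ 4 edges-length ⟩
      length (darts R) + 4                      ∎)
    where
    open ℕ.≤-Reasoning
    open Split (split S S? edges (proj₁ ∘ edges-∈))

    arith : ∀ t r → 2 * suc t + 2 * suc r ≡ ((t + r) + (t + r)) + 4
    arith = solve-∀

    ≢s? : ∀ d → Dec (¬ (d ≡ s ⊎ α d ≡ s))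
    ≢s? d = ¬? ((d ≟ᵈ s) ⊎-dec (α d ≟ᵈ s))

    crossed : List (Dart n)
    crossed = filter ≢s? rest

    in-rest : ∀ {d} → S d → d ∈ edges → d ∈ rest
    in-rest p q with covered q
    ... | inj₁ t = contradiction p (proj₂ (tree-∉ t))
    ... | inj₂ r = r

    crossed< : length crossed ℕ.< length rest
    crossed< = filter-notAll ≢s? rest (witness (∈-edges s-dart))
      where
      witness : s ∈ edges ⊎ α s ∈ edges → Any (λ d → ¬ ¬ (d ≡ s ⊎ α d ≡ s)) rest
      witness (inj₁ p) = Any.map (λ { refl ne → ne (inj₁ refl) }) (in-rest s∈S p)
      witness (inj₂ p) = Any.map (λ { refl ne → ne (inj₂ refl) }) (in-rest (S-α s∈S) p)

    tree-label : ∀ u v → lab tree u ≡ lab tree v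
    tree-label = connected (lab tree) (λ p ¬s → [ (λ q → spans q ¬s) , (λ q → sym (spans q (¬s ∘ S-α))) ]′ (∈-edges p))

    n≤ : n ℕ.≤ suc (length tree)
    n≤ = subst (ℕ._≤ suc (length tree)) (length-tabulate {n = n} (λ i → i))
      (labels-connected toℕ tree (allFin n) (AllPairs.map (λ ne → ne ∘ Fin.toℕ-injective) (Unique.allFin⁺ n)) (λ _ _ → tree-label _ _))

    darts-list = map (λ d → d , α d) crossed

    f : Dart n → ℕ
    f = labels faceLabel darts-list

    f-ϕ : ∀ {d} → IsDart d → f (ϕ d) ≡ f d
    f-ϕ p = labels-resp faceLabel darts-list (faceLabel-ϕ p)

    f-crossed : ∀ {d} → d ∈ crossed ⊎ α d ∈ crossed → f (α d) ≡ f d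
    f-crossed (inj₁ p) = sym (labels-glue faceLabel (∈-map⁺ (λ d → d , α d) p))
    f-crossed (inj₂ p) = labels-glue faceLabel (∈-map⁺ (λ d → d , α d) p)

    f-rest : ∀ {d} → d ∈ rest ⊎ α d ∈ rest → d ≢ s → α d ≢ s → f (α d) ≡ f d
    f-rest (inj₁ p) n₁ n₂ = f-crossed (inj₁ (∈-filter⁺ ≢s? p [ n₁ , n₂ ]′))
    f-rest (inj₂ p) n₁ n₂ = f-crossed (inj₂ (∈-filter⁺ ≢s? p [ n₂ , n₁ ]′))

    -- Although `f` does not join faces across `s` by construction, following the rest of the closed
    -- curve leads from one side of `s` to the other.
    f-s : f (α s) ≡ f s
    f-s = curve f f-ϕ (λ p q n₁ n₂ → f-rest ([ inj₁ ∘ in-rest q , inj₂ ∘ in-rest (S-α q) ]′ (∈-edges p)) n₁ n₂)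

    f-off-tree : ∀ {d} → IsDart d → ¬ onEdge tree d → f (α d) ≡ f d
    f-off-tree {d} p off with d ≟ᵈ s | α d ≟ᵈ s
    ... | yes refl | _ = f-s
    ... | no _ | yes refl = sym f-s
    ... | no n₁ | no n₂ = f-rest
      ([ [ (λ t → contradiction (inj₁ t) off) , inj₁ ]′ ∘ covered , [ (λ t → contradiction (inj₂ t) off) , inj₂ ]′ ∘ covered ]′ (∈-edges p)) n₁ n₂

    -- On the tree, a step of the contour is a step along a face. Off the tree, `σ d` is `ϕ (α d)`,
    -- and the edge of `d` may be crossed without changing `f`.
    f-contour : ∀ {d} → IsDart d → f (σ (τ tree d)) ≡ f d
    f-contour {d} p = go (onEdge? tree d)
      where
      go : Dec (onEdge tree d) → f (σ (τ tree d)) ≡ f d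
      go (yes on) = trans (cong (f ∘ σ) (τ-on tree on)) (f-ϕ p)
      go (no off) = trans (cong (f ∘ σ) (τ-off tree off)) (trans (f-ϕ (α-dart p)) (f-off-tree p off))

    -- The spanning tree has a single contour, which passes every dart, so the gluings along
    -- `crossed` already unite all faces.
    F≤ : length faceReps ℕ.≤ suc (length crossed)
    F≤ = subst (λ m → length faceReps ℕ.≤ suc m) (length-map _ crossed) count
      where
      count : length faceReps ℕ.≤ suc (length darts-list)
      count = labels-connected faceLabel darts-list faceReps faceReps-distinct
        (λ p q → contour forest f f-contour (rep p) (rep q) (tree-label _ _))
        where
        rep : ∀ {d} → d ∈ faceReps → IsDart d
        rep p = darts-∈ (proj₁ (∈-filter⁻ (λ d → T? (isFaceRep R d)) {xs = darts R} p))

-- The exterior face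

-- A return to `x` after `suc i` steps would allow `z` to be reached in `r ∸ suc i` steps, before
-- the first time `r`.
no-return : ∀ {A : Set} (f : A → A) {x z r} → (∀ j → j ℕ.< r → iter j f x ≢ z) → iter r f x ≡ z →
            ∀ {i} → i ℕ.< r → iter (suc i) f x ≢ x
no-return f {x} {z} {r} min end {i} i<r back = min (r ∸ suc i) (ℕ.∸-monoʳ-< (s≤s z≤n) i<r)
  (trans (cong (iter (r ∸ suc i) f) (sym back))
    (trans (sym (iter-+ f (r ∸ suc i) (suc i) x)) (trans (cong (λ m → iter m f x) (ℕ.m∸n+n≡m i<r)) end)))

module Plane {n : ℕ} (G : PlaneGraph n) (isPTPG : IsPTPG G) where
  open PlaneGraph G using (rs; connected; spherical; outer; outer-adj)
  open IsPTPG isPTPG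
  open Darts rs
  open Faces rs using (euler)

  Outer : Dart n → Set
  Outer = OuterDart G

  next : Fin n → Fin n → Fin n
  next v = cnext (rot v)

  Outer⇒dart : ∀ {d} → Outer d → IsDart d
  Outer⇒dart (k , refl) = iter-dart ϕ ϕ-dart k outer-adj

  Outer? : ∀ d → Dec (Outer d)
  Outer? = SameFace? outer-adj

  Outer-ϕ : ∀ {d} → Outer d → Outer (ϕ d)
  Outer-ϕ (k , e) = suc k , cong ϕ e

  Outer-iter : ∀ k {d} → Outer d → Outer (iter k ϕ d)
  Outer-iter zero o = o
  Outer-iter (suc k) o = Outer-ϕ (Outer-iter k o)

  Outer-ϕ⁻ : ∀ {d} → Outer d → ∃ λ e → Outer e × ϕ e ≡ d
  Outer-ϕ⁻ {d} o with ϕ-period (Outer⇒dart o)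
  ... | q , _ , per = iter q ϕ d , Outer-iter q o , per

  Outer-SameFace : ∀ {d e} → Outer d → Outer e → SameFace rs d e
  Outer-SameFace o o′ = SameFace-trans (SameFace-sym outer-adj o) o′

  ϕ-invariant : ∀ (f : Dart n → ℕ) → (∀ {d} → IsDart d → f (ϕ d) ≡ f d) → ∀ {d e} → IsDart d → SameFace rs d e → f e ≡ f d
  ϕ-invariant f inv p (zero , refl) = refl
  ϕ-invariant f inv p (suc k , refl) = trans (inv (iter-dart ϕ ϕ-dart k p)) (ϕ-invariant f inv p (k , refl))

  record Triangle (u v : Fin n) : Set where
    field
      third   : Adj rs v (next v u)
      closes  : Adj rs u (next v u)
      turn₁   : next (next v u) v ≡ u
      turn₂   : next u (next v u) ≡ v

  triangle : ∀ {u v} → Adj rs u v → ¬ Outer (u , v) → Triangle u v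
  triangle {u} {v} uv inner with ,-injective (proj₁ (inner-tri u v uv inner))
  ... | e₁ , e₂ = record
    { third  = vw
    ; closes = rot-sym _ _ (subst (Adj rs (next v u)) e₁ (cnext-∈ (rot-unique (next v u)) (rot-sym _ _ vw)))
    ; turn₁  = e₁
    ; turn₂  = subst (λ x → next x (next v u) ≡ v) e₁ e₂ }
    where
    vw : Adj rs v (next v u)
    vw = cnext-∈ (rot-unique v) (rot-sym _ _ uv)

  CommonNbr : Fin n → Fin n → Fin n → Set
  CommonNbr i j x = Adj rs i x × Adj rs j x

  no-common⇒outer : ∀ {i j} → Adj rs i j → (∀ x → ¬ CommonNbr i j x) → Outer (i , j)
  no-common⇒outer {i} {j} ij none with Outer? (i , j)
  ... | yes o = o
  ... | no ¬o = contradiction (closes , third) (none (next j i))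
    where open Triangle (triangle ij ¬o)

  -- If both faces at an edge are inner triangles with the same third vertex, then they are the
  -- whole graph, and no face is left for the exterior.
  unique-common⇒outer : ∀ {i j} → Adj rs i j → (∀ x y → CommonNbr i j x → CommonNbr i j y → x ≡ y) →
                        Outer (i , j) ⊎ Outer (j , i)
  unique-common⇒outer {i} {j} ij unique with Outer? (i , j) | Outer? (j , i)
  ... | yes o | _ = inj₁ o
  ... | no _ | yes o = inj₂ o
  -- Each of `i`, `j`, `w` has only the other two as neighbours. By connectedness `outer` is one of
  -- their six darts, and each of these lies on the face of `(i , j)` or of `(j , i)`.
  ... | no ¬o | no ¬o′ = absurd (reach (connected i (proj₁ outer)) (inj₁ refl)) outer-adj refl
    where
    module T  = Triangle (triangle ij ¬o)
    module T′ = Triangle (triangle (rot-sym _ _ ij) ¬o′)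
    w = next j i
    w≡ : next i j ≡ w
    w≡ = unique _ _ (T′.third , T′.closes) (T.closes , T.third)

    two-cycle : ∀ {v x y} → next v x ≡ y → next v y ≡ x → Adj rs v x → ∀ {z} → Adj rs v z → z ≡ x ⊎ z ≡ y
    two-cycle {v} {x} {y} xy yx vx vz with cnext-transitive (rot-unique v) vx vz
    ... | k , refl = orbit k
      where
      orbit : ∀ k → iter k (next v) x ≡ x ⊎ iter k (next v) x ≡ y
      orbit zero = inj₁ refl
      orbit (suc k) = [ (λ e → inj₂ (trans (cong (next v) e) xy)) , (λ e → inj₁ (trans (cong (next v) e) yx)) ]′ (orbit k)

    at-i : ∀ {z} → Adj rs i z → z ≡ j ⊎ z ≡ w
    at-i = two-cycle w≡ T.turn₂ ij
    at-j : ∀ {z} → Adj rs j z → z ≡ i ⊎ z ≡ w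
    at-j = two-cycle refl (subst (λ x → next j x ≡ i) w≡ T′.turn₂) (rot-sym _ _ ij)
    at-w : ∀ {z} → Adj rs w z → z ≡ j ⊎ z ≡ i
    at-w = two-cycle T.turn₁ (subst (λ x → next x i ≡ j) w≡ T′.turn₁) (rot-sym _ _ T.third)

    Here : Fin n → Set
    Here x = x ≡ i ⊎ x ≡ j ⊎ x ≡ w

    closed : ∀ {x z} → Here x → Adj rs x z → Here z
    closed (inj₁ refl) p = [ (λ e → inj₂ (inj₁ e)) , (λ e → inj₂ (inj₂ e)) ]′ (at-i p)
    closed (inj₂ (inj₁ refl)) p = [ inj₁ , (λ e → inj₂ (inj₂ e)) ]′ (at-j p)
    closed (inj₂ (inj₂ refl)) p = [ (λ e → inj₂ (inj₁ e)) , inj₁ ]′ (at-w p)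

    reach : ∀ {x y} → Reach rs (λ _ → ⊥) x y → Here x → Here y
    reach here h = h
    reach (step p _ r) h = reach r (closed h p)

    onFace : ∀ {d e} → IsDart d → (k : ℕ) → iter k ϕ d ≡ e → outer ≡ e → Outer d
    onFace p k eq refl = SameFace-sym p (k , eq)

    ji = rot-sym _ _ ij

    absurd : ∀ {x y} → Here x → Adj rs x y → outer ≡ (x , y) → Outer (i , j) ⊎ Outer (j , i)
    absurd (inj₁ refl) p with at-i p
    ... | inj₁ refl = λ eq → inj₁ (onFace ij 0 refl eq)
    ... | inj₂ refl = λ eq → inj₂ (onFace ji 1 (cong (i ,_) w≡) eq)
    absurd (inj₂ (inj₁ refl)) p with at-j p
    ... | inj₁ refl = λ eq → inj₂ (onFace ji 0 refl eq)
    ... | inj₂ refl = λ eq → inj₁ (onFace ij 1 refl eq)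
    absurd (inj₂ (inj₂ refl)) p with at-w p
    ... | inj₁ refl = λ eq → inj₂ (onFace ji 2
      (trans (cong (λ x → ϕ (i , x)) w≡) (cong (w ,_) (subst (λ x → next x i ≡ j) w≡ T′.turn₁))) eq)
    ... | inj₂ refl = λ eq → inj₁ (onFace ij 2 (cong (w ,_) T.turn₁) eq)

  -- If the exterior face visits v twice, a closed curve through v and the exterior face
  -- separates the neighbours of v, so v is a cut vertex.
  outer-pred-unique : ∀ {t t′ v} → Outer (t , v) → Outer (t′ , v) → t ≡ t′
  outer-pred-unique {t} {t′} {v} o o′ with t Fin.≟ t′
  ... | yes e = e
  ... | no t≢t′ with cnext-transitive (rot-unique v) (rot-sym _ _ (Outer⇒dart o)) (rot-sym _ _ (Outer⇒dart o′))
  -- The rotation at `v` leads from `t` through `w 1`, ..., `w r`, the last being `t′`. The curve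
  -- leaves the exterior face in the angle between `t` and `w 1`, crosses the edges from `v` to
  -- `w 1`, ..., `w r`, and is back in the exterior face after `t′`.
  ... | k , hit with least (λ k → iter k (next v) t Fin.≟ t′) k hit
  ... | zero , e , _ = contradiction e t≢t′
  ... | suc r′ , end , _ , min = ⊥-elim (euler spherical S S? S-α conn s (v-w 1) (inj₁ (refl , 0 , s≤s z≤n , refl)) curve)
    where
    r = suc r′
    w : ℕ → Fin n
    w i = iter i (next v) t

    vt : Adj rs v t
    vt = rot-sym _ _ (Outer⇒dart o)

    v-w : ∀ i → Adj rs v (w i)
    v-w i = cnext-iter-∈ (rot-unique v) i vt

    Crossed : Fin n → Set
    Crossed x = ∃ λ i → i ℕ.< r × w (suc i) ≡ x

    Crossed? : ∀ x → Dec (Crossed x)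
    Crossed? x = ℕ.anyUpTo? (λ i → w (suc i) Fin.≟ x) r

    S : Dart n → Set
    S (x , y) = (x ≡ v × Crossed y) ⊎ (y ≡ v × Crossed x)

    S? : ∀ d → Dec (S d)
    S? (x , y) = ((x Fin.≟ v) ×-dec Crossed? y) ⊎-dec ((y Fin.≟ v) ×-dec Crossed? x)

    S-α : ∀ {d} → S d → S (α d)
    S-α (inj₁ p) = inj₂ p
    S-α (inj₂ p) = inj₁ p

    s : Dart n
    s = v , w 1

    -- The uncrossed edge to `t` keeps `v` connected to the other vertices, which are joined to each
    -- other without `v` by biconnectivity.
    no-cross-t : ¬ Crossed t
    no-cross-t (i , i<r , e) = no-return (next v) min end i<r e

    conn : ∀ (c : Fin n → ℕ) → (∀ {x y} → Adj rs x y → ¬ S (x , y) → c x ≡ c y) → ∀ x y → c x ≡ c y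
    conn c c-edge x y = trans (to-t x) (sym (to-t y))
      where
      along : ∀ {x y} → x ≢ v → Reach rs (_≡ v) x y → c x ≡ c y
      along x≢v here = refl
      along x≢v (step p y≢v q) = trans (c-edge p λ { (inj₁ (e , _)) → x≢v e ; (inj₂ (e , _)) → y≢v e }) (along y≢v q)

      t≢v : t ≢ v
      t≢v = Adj⇒≢ (Outer⇒dart o)

      to-t : ∀ x → c x ≡ c t
      to-t x with x Fin.≟ v
      ... | yes refl = c-edge vt λ { (inj₁ (_ , q)) → no-cross-t q ; (inj₂ (e , _)) → t≢v e }
      ... | no x≢v = along x≢v (proj₂ biconnected v x t x≢v t≢v)

    curve : ∀ (f : Dart n → ℕ) → (∀ {d} → IsDart d → f (ϕ d) ≡ f d) →
            (∀ {d} → IsDart d → S d → d ≢ s → α d ≢ s → f (α d) ≡ f d) → f (α s) ≡ f s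
    curve f f-ϕ f-cross =
      trans (sym (around r′ ℕ.≤-refl))
        (trans (cong (λ x → f (x , v)) end)
          (trans (ϕ-invariant f f-ϕ (Outer⇒dart o) (Outer-SameFace o o′)) (sym (f-ϕ (Outer⇒dart o)))))
      where
      around : ∀ i → i ℕ.< r → f (w (suc i) , v) ≡ f (w 1 , v)
      around zero _ = refl
      around (suc i) lt = trans
        (f-cross (v-w (2 + i)) (inj₁ (refl , suc i , lt , refl))
          (λ e → no-return (next v) min end (ℕ.<⇒≤ lt) (cnext-injective (rot-unique v) (,-injectiveʳ e)))
          (λ e → Adj⇒≢ (v-w (2 + i)) (sym (,-injectiveˡ e))))
        (trans (f-ϕ {w (suc i) , v} (rot-sym _ _ (v-w (suc i)))) (around i (ℕ.<⇒≤ lt)))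

  outer-succ-unique : ∀ {v w w′} → Outer (v , w) → Outer (v , w′) → w ≡ w′
  outer-succ-unique o o′ with Outer-ϕ⁻ o | Outer-ϕ⁻ o′
  ... | (t , _) , p , refl | (t′ , _) , p′ , refl with outer-pred-unique p p′
  ... | refl = refl

-- Corner implying paths

module Arcs {n : ℕ} (G : PlaneGraph n) (isPTPG : IsPTPG G) where
  open PlaneGraph G using (rs; connected; spherical; outer; outer-adj)
  open Darts rs
  open Faces rs using (euler)
  open Plane G isPTPG

  vertexAt : Dart n → ℕ → Fin n
  vertexAt d i = proj₁ (iter i ϕ d)

  -- A dart of the exterior face determines all that follow, so a CIP is encoded by its first dart
  -- and its number `l` of edges. Equality of CIPs then reduces to equality of these two.
  record Arc (d : Dart n) (l : ℕ) : Set where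
    field
      long      : 2 ℕ.≤ l
      on-outer  : Outer d
      distinct  : ∀ {i j} → i ℕ.< j → j ℕ.≤ l → vertexAt d i ≢ vertexAt d j
      chord     : Adj rs (vertexAt d 0) (vertexAt d l)
      not-outer : ¬ Outer (vertexAt d l , vertexAt d 0)
      no-chords : ∀ {i j} → suc i ℕ.< j → j ℕ.≤ l → ¬ (i ≡ 0 × j ≡ l) → ¬ Adj rs (vertexAt d i) (vertexAt d j)

  source-determines : ∀ {d e} → Outer d → Outer e → proj₁ d ≡ proj₁ e → d ≡ e
  source-determines o o′ refl = cong (_ ,_) (outer-succ-unique o o′)

  module _ {d₀ : Dart n} {l′ : ℕ} (arc : Arc d₀ (suc l′)) where
    open Arc arc

    private
      l = suc l′
      u = vertexAt d₀
      a = u 0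
      b = u 1
      z = u l
      e = u l′

      1≤l′ : 1 ℕ.≤ l′
      1≤l′ = ℕ.≤-pred long

      a≢z : a ≢ z
      a≢z = distinct (s≤s z≤n) ℕ.≤-refl

      ab = Outer⇒dart on-outer

      ez-outer : Outer (e , z)
      ez-outer = Outer-iter l′ on-outer

    -- The chord a z cuts the sphere: a closed curve leaves the exterior face through the edge a b,
    -- crosses the edges at a up to the chord, then the edges at z up to the edge e z.
    chord-separates : ∀ {j y} → 0 ℕ.< j → j ℕ.< l → ∃ (λ y′ → Outer (y , y′)) → (∀ i → i ℕ.≤ l → y ≢ u i) → ¬ Adj rs (u j) y
    chord-separates {j} {y} 0<j j<l (y′ , oy) y∉ xy
      with cnext-transitive (rot-unique a) ab chord | cnext-transitive (rot-unique z) (rot-sym _ _ chord) (rot-sym _ _ (Outer⇒dart ez-outer))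
    ... | k₁ , hit₁ | k₂ , hit₂
      with least (λ k → iter k (next a) b Fin.≟ z) k₁ hit₁ | least (λ k → iter k (next z) a Fin.≟ e) k₂ hit₂
    ... | zero , end , _ | _ = distinct {1} {l} long ℕ.≤-refl end
    ... | _ | zero , end , _ = distinct {0} {l′} 1≤l′ (ℕ.n≤1+n l′) end
    ... | suc r₁ , end , _ , min | suc r₂ , end′ , _ , min′ =
      euler spherical S S? S-α conn s ab (inj₁ (inj₁ (refl , 0 , s≤s z≤n , refl))) curve
      where
      r = suc r₁
      r′ = suc r₂

      w w′ : ℕ → Fin n
      w i = iter i (next a) b
      w′ i = iter i (next z) a

      a-w : ∀ i → Adj rs a (w i)
      a-w i = cnext-iter-∈ (rot-unique a) i ab

      z-w′ : ∀ i → Adj rs z (w′ i)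
      z-w′ i = cnext-iter-∈ (rot-unique z) i (rot-sym _ _ chord)

      Near-a Near-z : Fin n → Set
      Near-a x = ∃ λ i → i ℕ.< r × w i ≡ x
      Near-z x = ∃ λ i → i ℕ.< r′ × w′ (suc i) ≡ x

      CrossedFrom : Fin n → Fin n → Set
      CrossedFrom p q = (p ≡ a × Near-a q) ⊎ (p ≡ z × Near-z q)

      CrossedFrom? : ∀ p q → Dec (CrossedFrom p q)
      CrossedFrom? p q = ((p Fin.≟ a) ×-dec ℕ.anyUpTo? (λ i → w i Fin.≟ q) r) ⊎-dec
                         ((p Fin.≟ z) ×-dec ℕ.anyUpTo? (λ i → w′ (suc i) Fin.≟ q) r′)

      S : Dart n → Set
      S (p , q) = CrossedFrom p q ⊎ CrossedFrom q p

      S? : ∀ d → Dec (S d)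
      S? (p , q) = CrossedFrom? p q ⊎-dec CrossedFrom? q p

      S-α : ∀ {d} → S d → S (α d)
      S-α (inj₁ p) = inj₂ p
      S-α (inj₂ p) = inj₁ p

      s : Dart n
      s = a , b

      w≢a : ∀ i → w i ≢ a
      w≢a i eq = Adj⇒≢ (a-w i) (sym eq)

      w′≢z : ∀ i → w′ i ≢ z
      w′≢z i eq = Adj⇒≢ (z-w′ i) (sym eq)

      w′≢a : ∀ {i} → i ℕ.< r′ → w′ (suc i) ≢ a
      w′≢a = no-return (next z) min′ end′

      near-≢a : ∀ {x} → Near-a x ⊎ Near-z x → x ≢ a
      near-≢a (inj₁ (i , _ , refl)) = w≢a i
      near-≢a (inj₂ (i , i< , refl)) = w′≢a i<

      near-≢z : ∀ {x} → Near-a x ⊎ Near-z x → x ≢ z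
      near-≢z (inj₁ (i , i< , refl)) = min i i<
      near-≢z (inj₂ (i , i< , refl)) = w′≢z (suc i)

      pred = Outer-ϕ⁻ on-outer
      t = proj₁ (proj₁ pred)

      ta-outer : Outer (t , a)
      ta-outer = subst (λ x → Outer (t , x)) (,-injectiveˡ (proj₂ (proj₂ pred))) (proj₁ (proj₂ pred))

      next-t : next a t ≡ b
      next-t = outer-succ-unique (Outer-ϕ ta-outer) on-outer

      w≢t : ∀ {i} → i ℕ.< r → w i ≢ t
      w≢t i< eq = no-return (next a) min end i< (trans (cong (next a) eq) next-t)

      wa : ∀ i → Adj rs (w i) a
      wa i = rot-sym _ _ (a-w i)

      w′z : ∀ i → Adj rs (w′ i) z
      w′z i = rot-sym _ _ (z-w′ i)

      fan-a : ∀ {i} → i ℕ.< r → Triangle (w i) a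
      fan-a {i} i< = triangle (wa i) (λ o → w≢t i< (outer-pred-unique o ta-outer))

      fan-z : ∀ {i} → suc i ℕ.< r′ → Triangle (w′ (suc i)) z
      fan-z {i} i< = triangle (w′z (suc i)) (λ o → min′ (suc i) i< (outer-pred-unique o ez-outer))

      -- The last triangle of the fan at `a` has the chord as a side, so it is also where the fan at
      -- `z` begins. Here the curve turns from one fan to the other without crossing the chord.
      corner : next z a ≡ w r₁
      corner = subst (λ x → next x a ≡ w r₁) end (Triangle.turn₁ (fan-a {r₁} ℕ.≤-refl))

      -- Everything is joined to `b` by uncrossed edges: the ends of the crossed edges through the
      -- outer sides of the fan triangles, the inner vertices of the arc along the arc, `y` by the
      -- supposed edge, `a` from `y` along the exterior face, `z` by the chord. Other vertices hang
      -- on these.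
      conn : ∀ (c : Fin n → ℕ) → (∀ {p q} → Adj rs p q → ¬ S (p , q) → c p ≡ c q) → ∀ p q → c p ≡ c q
      conn c c-edge p q = trans (all p) (sym (all q))
        where
        γ = c b

        c-away : ∀ {p q} → Adj rs p q → p ≢ a → p ≢ z → q ≢ a → q ≢ z → c p ≡ c q
        c-away pq p≢a p≢z q≢a q≢z = c-edge pq λ
          { (inj₁ (inj₁ (e , _))) → p≢a e ; (inj₁ (inj₂ (e , _))) → p≢z e
          ; (inj₂ (inj₁ (e , _))) → q≢a e ; (inj₂ (inj₂ (e , _))) → q≢z e }

        c-w : ∀ i → i ℕ.< r → c (w i) ≡ γ
        c-w zero _ = refl
        c-w (suc i) i< = trans (sym (c-away (Triangle.closes (fan-a (ℕ.<⇒≤ i<)))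
          (w≢a i) (min i (ℕ.<⇒≤ i<)) (w≢a (suc i)) (min (suc i) i<))) (c-w i (ℕ.<⇒≤ i<))

        c-w′ : ∀ i → i ℕ.< r′ → c (w′ (suc i)) ≡ γ
        c-w′ zero _ = trans (cong c corner) (c-w r₁ ℕ.≤-refl)
        c-w′ (suc i) i< = trans (sym (c-away (Triangle.closes (fan-z i<))
          (w′≢a (ℕ.<⇒≤ i<)) (w′≢z (suc i)) (w′≢a i<) (w′≢z (2 + i)))) (c-w′ i (ℕ.<⇒≤ i<))

        c-near : ∀ {x} → Near-a x ⊎ Near-z x → c x ≡ γ
        c-near (inj₁ (i , i< , refl)) = c-w i i<
        c-near (inj₂ (i , i< , refl)) = c-w′ i i<

        c-u : ∀ i → suc i ℕ.< l → c (u (suc i)) ≡ γ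
        c-u zero _ = refl
        c-u (suc i) i< = trans (sym (c-away (Outer⇒dart (Outer-iter (suc i) on-outer))
          (≢a (ℕ.<⇒≤ i<)) (≢z (ℕ.<⇒≤ i<)) (≢a i<) (≢z i<))) (c-u i (ℕ.<⇒≤ i<))
          where
          ≢a : ∀ {i} → suc i ℕ.< l → u (suc i) ≢ a
          ≢a lt eq = distinct (s≤s z≤n) (ℕ.<⇒≤ lt) (sym eq)
          ≢z : ∀ {i} → suc i ℕ.< l → u (suc i) ≢ z
          ≢z lt = distinct lt ℕ.≤-refl

        c-x : ∀ j → 0 ℕ.< j → j ℕ.< l → c (u j) ≡ γ
        c-x (suc i) _ lt = c-u i lt

        y≢a : y ≢ a
        y≢a = y∉ 0 z≤n

        c-y : c y ≡ γ
        c-y = trans (sym (c-away xy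
          (λ eq → distinct 0<j (ℕ.<⇒≤ j<l) (sym eq)) (distinct j<l ℕ.≤-refl) y≢a (y∉ l ℕ.≤-refl))) (c-x j 0<j j<l)

        no-near-a : ¬ (Near-a a ⊎ Near-z a)
        no-near-a p = near-≢a p refl

        v : ℕ → Fin n
        v = vertexAt (y , y′)

        c-a : c a ≡ γ
        c-a with Outer-SameFace oy on-outer
        ... | k , hit with least (λ k → v k Fin.≟ a) k (cong proj₁ hit)
        ... | zero , end , _ = contradiction end y≢a
        ... | suc k′ , end , _ , first = trans (sym last-edge) (c-v k′ ℕ.≤-refl)
          where
          -- Since predecessors on the exterior face are unique, the walk from `y` can enter the arc
          -- only at its first vertex `a`.
          outside : ∀ i → i ℕ.< suc k′ → ∀ q → q ℕ.≤ l → v i ≢ u q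
          outside zero _ = y∉
          outside (suc i) i< zero _ eq = first (suc i) i< eq
          outside (suc i) i< (suc q) q≤ eq = outside i (ℕ.<⇒≤ i<) q (ℕ.<⇒≤ q≤)
            (outer-pred-unique (subst (λ x → Outer (v i , x)) eq (Outer-iter i oy)) (Outer-iter q on-outer))

          c-v : ∀ i → i ℕ.< suc k′ → c (v i) ≡ γ
          c-v zero _ = c-y
          c-v (suc i) i< = trans (sym (c-away (Outer⇒dart (Outer-iter i oy))
            (outside i (ℕ.<⇒≤ i<) 0 z≤n) (outside i (ℕ.<⇒≤ i<) l ℕ.≤-refl)
            (outside (suc i) i< 0 z≤n) (outside (suc i) i< l ℕ.≤-refl))) (c-v i (ℕ.<⇒≤ i<))

          va-outer : Outer (v k′ , a)
          va-outer = subst (λ x → Outer (v k′ , x)) end (Outer-iter k′ oy)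

          last-edge : c (v k′) ≡ c a
          last-edge = c-edge (Outer⇒dart va-outer) λ
            { (inj₁ (inj₁ (_ , near))) → no-near-a (inj₁ near)
            ; (inj₁ (inj₂ (_ , near))) → no-near-a (inj₂ near)
            ; (inj₂ (inj₁ (_ , i , i< , eq))) → w≢t i< (trans eq (outer-pred-unique va-outer ta-outer))
            ; (inj₂ (inj₂ (eq , _))) → a≢z eq }

        c-z : c z ≡ γ
        c-z = trans (sym (c-edge chord λ
          { (inj₁ (inj₁ (_ , near))) → near-≢z (inj₁ near) refl
          ; (inj₁ (inj₂ (eq , _))) → a≢z eq
          ; (inj₂ (inj₁ (eq , _))) → a≢z (sym eq)
          ; (inj₂ (inj₂ (_ , near))) → no-near-a (inj₂ near) })) c-a

        spread : ∀ {p q} → Reach rs (λ _ → ⊥) p q → c p ≡ γ → c q ≡ γ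
        spread here cp = cp
        spread (step {p} {q} pq _ reach) cp with S? (p , q)
        ... | no ¬s = spread reach (trans (sym (c-edge pq ¬s)) cp)
        ... | yes (inj₁ (inj₁ (_ , near))) = spread reach (c-near (inj₁ near))
        ... | yes (inj₁ (inj₂ (_ , near))) = spread reach (c-near (inj₂ near))
        ... | yes (inj₂ (inj₁ (refl , _))) = spread reach c-a
        ... | yes (inj₂ (inj₂ (refl , _))) = spread reach c-z

        all : ∀ p → c p ≡ γ
        all p = spread (connected a p) c-a

      curve : ∀ (f : Dart n → ℕ) → (∀ {d} → IsDart d → f (ϕ d) ≡ f d) →
              (∀ {d} → IsDart d → S d → d ≢ s → α d ≢ s → f (α d) ≡ f d) → f (α s) ≡ f s
      curve f f-ϕ f-cross =
        trans (sym (around-a r₁ ℕ.≤-refl))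
        (trans (sym (f-ϕ (wa r₁)))
        (trans (cong (λ x → f (a , x)) end)
        (trans (sym (f-ϕ chord))
        (trans (sym (cross-z 0 (s≤s z≤n)))
        (trans (sym (around-z r₂ ℕ.≤-refl))
        (trans (cong (λ x → f (x , z)) end′)
        (ϕ-invariant f f-ϕ ab (Outer-SameFace on-outer ez-outer))))))))
        where
        around-a : ∀ i → i ℕ.< r → f (w i , a) ≡ f (b , a)
        around-a zero _ = refl
        around-a (suc i) lt = trans
          (f-cross (a-w (suc i)) (inj₁ (inj₁ (refl , suc i , lt , refl)))
            (λ eq → no-return (next a) min end (ℕ.<⇒≤ lt) (,-injectiveʳ eq))
            (λ eq → w≢a (suc i) (,-injectiveˡ eq)))
          (trans (f-ϕ (wa i)) (around-a i (ℕ.<⇒≤ lt)))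

        cross-z : ∀ i → i ℕ.< r′ → f (w′ (suc i) , z) ≡ f (z , w′ (suc i))
        cross-z i lt = f-cross (z-w′ (suc i)) (inj₁ (inj₂ (refl , i , lt , refl)))
          (λ eq → a≢z (sym (,-injectiveˡ eq))) (λ eq → w′≢a lt (,-injectiveˡ eq))

        around-z : ∀ i → i ℕ.< r′ → f (w′ (suc i) , z) ≡ f (w′ 1 , z)
        around-z zero _ = refl
        around-z (suc i) lt = trans (cross-z (suc i) lt) (trans (f-ϕ (w′z (suc i))) (around-z i (ℕ.<⇒≤ lt)))

  private
    -- The second path starts `δ` steps before the first. If it also reaches at least as far, the
    -- chord of the first is a forbidden chord of the second unless the paths agree. Otherwise its
    -- end `v m` is an inner vertex `u r` of the first path, and its chord either leaves that arc,
    -- against `chord-separates`, or joins two vertices of it.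
    shared : ∀ {d₀ l′ e₀ m} → Arc d₀ (suc l′) → Arc e₀ m → ∀ {i j} → 0 ℕ.< i → i ℕ.< suc l′ → j ℕ.< m →
             i ℕ.≤ j → vertexAt d₀ i ≡ vertexAt e₀ j → d₀ ≡ e₀ × suc l′ ≡ m
    shared {d₀} {l′} {e₀} {m} A B {i} {j} 0<i i<l j<m i≤j same = compare (ℕ.<-≤-connex m (δ + l))
      where
      module A = Arc A
      module B = Arc B
      l = suc l′
      u = vertexAt d₀
      v = vertexAt e₀
      δ = j ∸ i

      d₀≡ : d₀ ≡ iter δ ϕ e₀
      d₀≡ = iter-injective ϕ ϕ-injective i
        (trans (source-determines (Outer-iter i A.on-outer) (Outer-iter j B.on-outer) same)
          (trans (cong (λ k → iter k ϕ e₀) (sym (ℕ.m+[n∸m]≡n i≤j))) (iter-+ ϕ i δ e₀)))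

      u≡v : ∀ k → u k ≡ v (δ + k)
      u≡v k = cong proj₁ (trans (cong (iter k ϕ) d₀≡) (trans (sym (iter-+ ϕ k δ e₀)) (cong (λ q → iter q ϕ e₀) (ℕ.+-comm k δ))))

      compare : m ℕ.< δ + l ⊎ δ + l ℕ.≤ m → d₀ ≡ e₀ × l ≡ m
      compare (inj₂ le) with δ ℕ.≟ 0 | δ + l ℕ.≟ m
      ... | yes δ≡0 | yes eq = trans d₀≡ (cong (λ k → iter k ϕ e₀) δ≡0) , trans (cong (_+ l) (sym δ≡0)) eq
      ... | no δ≢0 | _ = contradiction (subst₂ (Adj rs) (trans (u≡v 0) (cong v (ℕ.+-identityʳ δ))) (u≡v l) A.chord)
        (B.no-chords (subst (ℕ._≤ δ + l) (ℕ.+-comm δ 2) (ℕ.+-monoʳ-≤ δ A.long)) le (δ≢0 ∘ proj₁))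
      ... | yes _ | no ≢m = contradiction (subst₂ (Adj rs) (trans (u≡v 0) (cong v (ℕ.+-identityʳ δ))) (u≡v l) A.chord)
        (B.no-chords (subst (ℕ._≤ δ + l) (ℕ.+-comm δ 2) (ℕ.+-monoʳ-≤ δ A.long)) le (≢m ∘ proj₂))
      compare (inj₁ lt) = ⊥-elim (search (ℕ.anyUpTo? (λ t → u t Fin.≟ v 0) (suc l)))
        where
        r = m ∸ δ
        δ<m : δ ℕ.< m
        δ<m = ℕ.≤-<-trans (ℕ.m∸n≤m j i) j<m
        δ+r : δ + r ≡ m
        δ+r = ℕ.m+[n∸m]≡n (ℕ.<⇒≤ δ<m)
        0<r : 0 ℕ.< r
        0<r = ℕ.m<n⇒0<n∸m δ<m
        r<l : r ℕ.< l
        r<l = ℕ.+-cancelˡ-< δ r l (subst (ℕ._< δ + l) (sym δ+r) lt)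
        ur : u r ≡ v m
        ur = trans (u≡v r) (cong v δ+r)
        y~ : Adj rs (u r) (v 0)
        y~ = subst (λ x → Adj rs x (v 0)) (sym ur) (rot-sym _ _ B.chord)

        search : Dec (∃ λ t → t ℕ.< suc l × u t ≡ v 0) → ⊥
        search (no ∉arc) = chord-separates A 0<r r<l (_ , B.on-outer) (λ t t≤l eq → ∉arc (t , s≤s t≤l , sym eq)) y~
        search (yes (t , s≤s t≤l , ut)) with ℕ.<-cmp t r
        ... | tri≈ _ refl _ = Adj⇒≢ y~ ut
        ... | tri< t<r _ _ with ℕ.m≤n⇒m<n∨m≡n t<r
        ...   | inj₁ gap = A.no-chords gap (ℕ.<⇒≤ r<l) (λ p → ℕ.<⇒≢ r<l (proj₂ p))
                  (subst (λ x → Adj rs x (u r)) (sym ut) (rot-sym _ _ y~))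
        -- Here `u r` follows `v 0` on the exterior face, so `v 1` and `v m` coincide.
        ...   | inj₂ eq = B.distinct {1} {m} B.long ℕ.≤-refl
                  (trans (cong (proj₁ ∘ ϕ) (sym (source-determines (Outer-iter t A.on-outer) B.on-outer ut))) (trans (cong u eq) ur))
        search (yes (t , s≤s t≤l , ut)) | tri> _ _ r<t with ℕ.m≤n⇒m<n∨m≡n r<t
        ...   | inj₁ gap = A.no-chords gap t≤l (λ p → ℕ.<⇒≢ 0<r (sym (proj₁ p))) (subst (Adj rs (u r)) (sym ut) y~)
        -- Here `v 0` follows `v m`, so the chord of the second path would close up the exterior
        -- face.
        ...   | inj₂ refl = B.not-outer (subst₂ (λ x y → Outer (x , y)) ur ut (Outer-iter r A.on-outer))

  arcs-sharing-interior : ∀ {d l e m} → Arc d l → Arc e m → ∀ {i j} → 0 ℕ.< i → i ℕ.< l → 0 ℕ.< j → j ℕ.< m →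
                          vertexAt d i ≡ vertexAt e j → d ≡ e × l ≡ m
  arcs-sharing-interior {l = suc _} {m = suc _} A B {i} {j} 0<i i<l 0<j j<m same with ℕ.≤-total i j
  ... | inj₁ i≤j = shared A B 0<i i<l j<m i≤j same
  ... | inj₂ j≤i = let p , q = shared B A 0<j j<m i<l j≤i (sym same) in sym p , sym q

-- The boundary of a floor plan traversed counterclockwise: Contact i j says that j follows i there.
record Boundary {n : ℕ} (Adjacent : Fin n → Fin n → Set) : Set₁ where
  field
    Contact        : Fin n → Fin n → Set
    adjacent       : ∀ {i j} → Contact i j → Adjacent i j
    unique-common  : ∀ {i j x y} → Contact i j → Adjacent i x → Adjacent j x → Adjacent i y → Adjacent j y → x ≡ y
    two-sided      : ∀ {i j x} → Contact i j → Contact j i → Adjacent i x → Adjacent j x → ⊥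
    advance        : ∀ {i j} → Contact i j → ∃ λ k → Contact j k
    Corner         : Fin 5 → Fin n → Set
    Corner?        : ∀ κ i → Dec (Corner κ i)
    corner-unique  : ∀ {κ i j} → Corner κ i → Corner κ j → i ≡ j
    -- Uniqueness of the next contact is a premise, because it becomes available only once contacts
    -- are identified with exterior darts.
    straight       : (∀ {i j k} → Contact i j → Contact i k → j ≡ k) →
                     ∀ (u : ℕ → Fin n) l → 2 ℕ.≤ l → (∀ i → i ℕ.< l → Contact (u i) (u (suc i))) →
                     (∀ i → 0 ℕ.< i → i ℕ.< l → ∀ κ → ¬ Corner κ (u i)) → ¬ Adjacent (u 0) (u l)

module CornerImplyingPaths {n : ℕ} (G : PlaneGraph n) (isPTPG : IsPTPG G) where
  open PlaneGraph G using (rs; outer)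
  open Darts rs
  open Plane G isPTPG
  open Arcs G isPTPG

  record ArcOf (ps : List (Fin n)) : Set where
    field
      {first} : Dart n
      {l}     : ℕ
      arc     : Arc first l
      path    : ps ≡ tabulate {n = suc l} (λ i → vertexAt first (toℕ i))

  toArc : ∀ {ps} → IsCIP G ps → ArcOf ps
  toArc {p₀ ∷ p₁ ∷ p₂ ∷ ps′} cip = record
    { arc  = record
      { long = s≤s (s≤s z≤n)
      ; on-outer = on-outer
      ; distinct = λ {i} {j} i<j j≤l eq → ℕ.<⇒≢ i<j (Fin.fromℕ<-injective i j
          (ℕ.<-trans i<j (s≤s j≤l)) (s≤s j≤l)
          (Unique⇒lookup-injective (IsCIP.distinct cip) _ _ (trans (at i (ℕ.<-trans i<j (s≤s j≤l))) (trans eq (sym (at j (s≤s j≤l)))))))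
      ; chord = subst (Adj rs p₀) (at l ℕ.≤-refl) (proj₁ ends)
      ; not-outer = λ o → proj₂ ends (subst (λ x → Outer (x , p₀)) (sym (at l ℕ.≤-refl)) o)
      ; no-chords = λ {i} {j} gap j≤l inner adj →
          let i< = ℕ.<-trans (ℕ.<-trans (ℕ.n<1+n i) gap) (s≤s j≤l)
              j< = s≤s j≤l
          in IsCIP.no-chords cip (Fin.fromℕ< i<) (Fin.fromℕ< j<)
               (subst₂ ℕ._<_ (cong suc (sym (Fin.toℕ-fromℕ< i<))) (sym (Fin.toℕ-fromℕ< j<)) gap)
               (λ (p , q) → inner (trans (sym (Fin.toℕ-fromℕ< i<)) p , ℕ.suc-injective (trans (cong suc (sym (Fin.toℕ-fromℕ< j<))) q)))
               (subst₂ (Adj rs) (sym (at i i<)) (sym (at j j<)) adj)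
      }
    ; path = trans (sym (tabulate-lookup qs)) (tabulate-cong (λ i →
        trans (cong (lookup qs) (sym (Fin.fromℕ<-toℕ i (Fin.toℕ<n i)))) (at (toℕ i) (Fin.toℕ<n i)))) }
    where
    qs = p₀ ∷ p₁ ∷ p₂ ∷ ps′
    l = suc (suc (length ps′))
    d₀ = (p₀ , p₁)

    on-outer : Outer d₀
    on-outer = IsCIP.consecutive cip Fin.zero (Fin.suc Fin.zero) refl

    ends = IsCIP.ends cip Fin.zero (Fin.fromℕ< {l} ℕ.≤-refl) refl (cong suc (Fin.toℕ-fromℕ< {l} ℕ.≤-refl))

    at : ∀ k (k< : k ℕ.< length qs) → lookup qs (Fin.fromℕ< k<) ≡ vertexAt d₀ k
    at zero (s≤s _) = refl
    at (suc k) k< =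
      let k<′ = ℕ.<-trans (ℕ.n<1+n k) k<
      in outer-succ-unique
           (subst (λ x → Outer (x , lookup qs (Fin.fromℕ< k<))) (at k k<′)
             (IsCIP.consecutive cip (Fin.fromℕ< k<′) (Fin.fromℕ< k<)
               (trans (cong suc (Fin.toℕ-fromℕ< k<′)) (sym (Fin.toℕ-fromℕ< k<)))))
           (Outer-iter k on-outer)
  toArc {[]} cip with () ← IsCIP.long cip
  toArc {_ ∷ []} cip with s≤s () ← IsCIP.long cip
  toArc {_ ∷ _ ∷ []} cip with s≤s (s≤s ()) ← IsCIP.long cip

  module _ (B : Boundary (Adj rs)) where
    open Boundary B

    contact-outer : ∀ {i j} → Contact i j → Outer (i , j) ⊎ Outer (j , i)
    contact-outer c = unique-common⇒outer (adjacent c) (λ x y (ix , jx) (iy , jy) → unique-common c ix jx iy jy)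

    module _ {i₀ j₀} (c₀ : Contact i₀ j₀) (o₀ : Outer (i₀ , j₀)) where

      private
        -- The direction propagates along the exterior face. If the contact from `b` to `e` is
        -- exterior only in reverse, then `e` is the predecessor `a`; now contacts run both ways,
        -- `two-sided` excludes a common neighbour, and the edge is exterior in this direction too.
        along : ∀ k → let d = iter k ϕ (i₀ , j₀) in Contact (proj₁ d) (proj₂ d)
        along zero = c₀
        along (suc k) = go (advance c)
          where
          a = proj₁ (iter k ϕ (i₀ , j₀))
          b = proj₂ (iter k ϕ (i₀ , j₀))
          c : Contact a b
          c = along k
          o : Outer (a , b)
          o = Outer-iter k o₀
          go : (∃ λ e → Contact b e) → Contact b (next b a)
          go (e , be) with contact-outer be
          ... | inj₁ be-outer = subst (Contact b) (outer-succ-unique be-outer (Outer-ϕ o)) be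
          ... | inj₂ eb-outer with outer-pred-unique eb-outer o
          ...   | refl = subst (Contact b)
            (outer-succ-unique (no-common⇒outer (adjacent be) (λ x (p , q) → two-sided be c p q)) (Outer-ϕ o)) be

      outer⇒contact : ∀ {a b} → Outer (a , b) → Contact a b
      outer⇒contact o with Outer-SameFace o₀ o
      ... | k , refl = along k

      contact⇒outer : ∀ {a b} → Contact a b → Outer (a , b)
      contact⇒outer c with contact-outer c
      ... | inj₁ o = o
      ... | inj₂ o = no-common⇒outer (adjacent c) (λ x (p , q) → two-sided c (outer⇒contact o) p q)

      record CornerInside (ps : List (Fin n)) : Set where
        field
          arcOf     : ArcOf ps
          κ         : Fin 5
          i         : ℕ
          0<i       : 0 ℕ.< i
          i<l       : i ℕ.< ArcOf.l arcOf
          atCorner  : Corner κ (vertexAt (ArcOf.first arcOf) i)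

      cornerInside : ∀ {ps} → IsCIP G ps → CornerInside ps
      cornerInside cip = find (ℕ.anyUpTo? (λ i → (0 ℕ.<? i) ×-dec Fin.any? (λ κ → Corner? κ (vertexAt first i))) l)
        where
        A = toArc cip
        open ArcOf A
        open Arc arc
        find : Dec (∃ λ i → i ℕ.< l × 0 ℕ.< i × ∃ λ κ → Corner κ (vertexAt first i)) → CornerInside _
        find (yes (i , i<l , 0<i , κ , k)) = record { arcOf = A ; κ = κ ; i = i ; 0<i = 0<i ; i<l = i<l ; atCorner = k }
        find (no none) = contradiction chord (straight
          (λ p q → outer-succ-unique (contact⇒outer p) (contact⇒outer q)) (vertexAt first) l long
          (λ i _ → outer⇒contact (Outer-iter i on-outer))
          (λ i 0<i i<l κ k → none (i , i<l , 0<i , κ , k)))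

      same-corner : ∀ {ps qs} (C : CornerInside ps) (D : CornerInside qs) → CornerInside.κ C ≡ CornerInside.κ D → ps ≡ qs
      same-corner C D refl with arcs-sharing-interior (ArcOf.arc C.arcOf) (ArcOf.arc D.arcOf) C.0<i C.i<l D.0<i D.i<l
                                  (corner-unique C.atCorner D.atCorner)
        where module C = CornerInside C
              module D = CornerInside D
      ... | refl , refl = trans (ArcOf.path (CornerInside.arcOf C)) (sym (ArcOf.path (CornerInside.arcOf D)))

      at-most-five : AtMostFiveCIPs G
      at-most-five cs unique cips with length cs ℕ.≤? 5
      ... | yes le = le
      ... | no ¬le =
        let inside = λ i → cornerInside (All.lookup cips (∈-lookup i))
            i , j , i<j , eq = Fin.pigeonhole (ℕ.≰⇒> ¬le) (λ i → CornerInside.κ (inside i))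
        in contradiction (Unique⇒lookup-injective unique i j (same-corner (inside i) (inside j) eq)) (Fin.<⇒≢ i<j)

-- Inequalities in linear orders

-- With `≤` defined as the negation of the reversed `<`, reversing an axis reverses both relations
-- by definition.
record Axis : Set₁ where
  infix 4 _<_ _≤_
  field
    Carrier            : Set
    _<_                : Carrier → Carrier → Set
    isStrictTotalOrder : IsStrictTotalOrder _≡_ _<_
    dense              : ∀ {x y} → x < y → ∃ λ z → x < z × z < y
  open IsStrictTotalOrder isStrictTotalOrder public using (compare; irrefl; asym) renaming (trans to <-trans)

  _≤_ : Carrier → Carrier → Set
  x ≤ y = ¬ (y < x)

  ≤-<-trans : ∀ {x y z} → x ≤ y → y < z → x < z
  ≤-<-trans {x} {y} {z} x≤y y<z with compare x z
  ... | tri< lt _ _   = lt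
  ... | tri≈ _ refl _ = contradiction y<z x≤y
  ... | tri> _ _ gt   = contradiction (<-trans y<z gt) x≤y

  <-≤-trans : ∀ {x y z} → x < y → y ≤ z → x < z
  <-≤-trans {x} {y} {z} x<y y≤z with compare x z
  ... | tri< lt _ _   = lt
  ... | tri≈ _ refl _ = contradiction x<y y≤z
  ... | tri> _ _ gt   = contradiction (<-trans gt x<y) y≤z

  ≤-trans : ∀ {x y z} → x ≤ y → y ≤ z → x ≤ z
  ≤-trans x≤y y≤z z<x = y≤z (<-≤-trans z<x x≤y)

  ≤-antisym : ∀ {x y} → x ≤ y → y ≤ x → x ≡ y
  ≤-antisym {x} {y} p q with compare x y
  ... | tri< lt _ _ = contradiction lt q
  ... | tri≈ _ e _  = e
  ... | tri> _ _ gt = contradiction gt p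

  ≤-reflexive : ∀ {x y} → x ≡ y → x ≤ y
  ≤-reflexive refl = irrefl refl

  <⇒≤ : ∀ {x y} → x < y → x ≤ y
  <⇒≤ p q = asym p q

  <-or-≤ : ∀ x y → x < y ⊎ y ≤ x
  <-or-≤ x y with compare x y
  ... | tri< lt _ _ = inj₁ lt
  ... | tri≈ ¬lt _ _ = inj₂ ¬lt
  ... | tri> ¬lt _ _ = inj₂ ¬lt

  ≤⇒<-or-≡ : ∀ {x y} → x ≤ y → x < y ⊎ x ≡ y
  ≤⇒<-or-≡ {x} {y} p with compare x y
  ... | tri< lt _ _ = inj₁ lt
  ... | tri≈ _ e _  = inj₂ e
  ... | tri> _ _ gt = contradiction gt p

  _≟_ : ∀ x y → Dec (x ≡ y)
  x ≟ y with compare x y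
  ... | tri< _ ne _ = no ne
  ... | tri≈ _ e _  = yes e
  ... | tri> _ ne _ = no ne

reverse : Axis → Axis
reverse A = record
  { Carrier = Carrier
  ; _<_ = λ x y → y < x
  ; isStrictTotalOrder = Flip.isStrictTotalOrder isStrictTotalOrder
  ; dense = λ p → let z , q , r = dense p in z , r , q }
  where open Axis A

-- A decision procedure for implications between conditions on points of two linear orders:
-- case distinction, closing a branch as soon as the collected inequalities contain a strict cycle.

-- The flag `true` means strict. `(s , i , j)` puts point `i` below point `j`; `(s , i)` puts the
-- start of a search below point `i`.
Edge Node : Set
Edge = Bool × ℕ × ℕ
Node = Bool × ℕ

-- At position i the upper bounds of the i-th point.
Graph : Set
Graph = List (List Node)

private
  T-∧ : ∀ {a b} → T (a ∧ b) → T a × T b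
  T-∧ {true} t = tt , t

  T-∨ : ∀ {a b} → T (a ∨ b) → T a ⊎ T b
  T-∨ {true} t = inj₁ t
  T-∨ {false} t = inj₂ t

  same : Node → Node → Bool
  same (s , i) (s′ , i′) = (i ≡ᵇ i′) ∧ (if s then s′ else not s′)

  member : Node → List Node → Bool
  member p [] = false
  member p (q ∷ qs) = same p q ∨ member p qs

  shift : Bool → List Node → List Node
  shift s [] = []
  shift s ((s′ , j) ∷ ps) = (s ∨ s′ , j) ∷ shift s ps

  successors : Graph → ℕ → List Node
  successors []       _       = []
  successors (ps ∷ g) zero    = ps
  successors (ps ∷ g) (suc i) = successors g i

  insert : ℕ → Node → Graph → Graph
  insert zero    p []       = (p ∷ []) ∷ []
  insert zero    p (ps ∷ g) = (p ∷ ps) ∷ g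
  insert (suc i) p []       = [] ∷ insert i p []
  insert (suc i) p (ps ∷ g) = ps ∷ insert i p g

  enqueue : List Node → List Node × List Node → List Node × List Node
  enqueue [] q = q
  enqueue (p ∷ ps) (todo , seen) = if member p seen then enqueue ps (todo , seen) else enqueue ps (p ∷ todo , p ∷ seen)

  search : ℕ → Graph → List Node × List Node → List Node
  search zero es (todo , seen) = seen
  search (suc k) es ([] , seen) = seen
  search (suc k) es (p ∷ todo , seen) = search k es (enqueue (shift (proj₁ p) (successors es (proj₂ p))) (todo , seen))

  closes : Edge → Node → Bool
  closes (s , i , j) (s′ , k) = (k ≡ᵇ i) ∧ (s ∨ s′)

  anyCloses : Edge → List Node → Bool
  anyCloses e [] = false
  anyCloses e (p ∷ ps) = closes e p ∨ anyCloses e ps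

-- A path from `j` back to `i` closes a cycle with the new edge, and one strict link makes it
-- contradictory. Four modules give 11 coordinates per axis, hence at most 22 nodes, so the fuel 100
-- suffices; running out would only miss conflicts.
conflict : Edge → Graph → Bool
conflict e@(s , i , j) es = anyCloses e (search 100 es ((false , j) ∷ [] , (false , j) ∷ []))

module Cycles (A : Axis) (ρ : ℕ → Axis.Carrier A) where
  open Axis A

  rel : Bool → Carrier → Carrier → Set
  rel true  x y = x < y
  rel false x y = x ≤ y

  private
    rel-trans : ∀ s s′ {x y z} → rel s′ x y → rel s y z → rel (s′ ∨ s) x z
    rel-trans true  true  p q = <-trans p q
    rel-trans true  false p q = ≤-<-trans p q
    rel-trans false true  p q = <-≤-trans p q
    rel-trans false false p q = ≤-trans p q

  holds : Edge → Set
  holds (s , i , j) = rel s (ρ i) (ρ j)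

  Sound : Graph → Set
  Sound g = ∀ i → All (λ p → rel (proj₁ p) (ρ i) (ρ (proj₂ p))) (successors g i)

  private
    insert-all : ∀ (P : ℕ → Node → Set) i {p} g → P i p → (∀ k → All (P k) (successors g k)) →
                 ∀ k → All (P k) (successors (insert i p g) k)
    insert-all P zero    []       h hs zero    = h ∷ []
    insert-all P zero    []       h hs (suc k) = []
    insert-all P zero    (ps ∷ g) h hs zero    = h ∷ hs 0
    insert-all P zero    (ps ∷ g) h hs (suc k) = hs (suc k)
    insert-all P (suc i) []       h hs zero    = []
    insert-all P (suc i) []       h hs (suc k) = insert-all (P ∘ suc) i [] h (λ _ → []) k
    insert-all P (suc i) (ps ∷ g) h hs zero    = hs 0
    insert-all P (suc i) (ps ∷ g) h hs (suc k) = insert-all (P ∘ suc) i g h (hs ∘ suc) k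

  insert-sound : ∀ {s i j} g → rel s (ρ i) (ρ j) → Sound g → Sound (insert i (s , j) g)
  insert-sound {i = i} g h hs = insert-all (λ k p → rel (proj₁ p) (ρ k) (ρ (proj₂ p))) i g h hs

  module _ (x : Carrier) where
    private
      Above : Node → Set
      Above (s , i) = rel s x (ρ i)

      shift-sound : ∀ s {y} ps → rel s x y → All (λ p → rel (proj₁ p) y (ρ (proj₂ p))) ps → All Above (shift s ps)
      shift-sound s [] _ _ = []
      shift-sound s ((s′ , j) ∷ ps) a (h ∷ hs) = rel-trans s′ s a h ∷ shift-sound s ps a hs

      enqueue-sound : ∀ ps q → All Above ps → All Above (proj₁ q) × All Above (proj₂ q) →
                      All Above (proj₁ (enqueue ps q)) × All Above (proj₂ (enqueue ps q))
      enqueue-sound [] q _ h = h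
      enqueue-sound (p ∷ ps) (todo , seen) (a ∷ as) (h , h′) with member p seen
      ... | true = enqueue-sound ps _ as (h , h′)
      ... | false = enqueue-sound ps _ as (a ∷ h , a ∷ h′)

    search-sound : ∀ k es q → Sound es → All Above (proj₁ q) × All Above (proj₂ q) → All Above (search k es q)
    search-sound zero es q _ (_ , h) = h
    search-sound (suc k) es ([] , seen) _ (_ , h) = h
    search-sound (suc k) es (p ∷ todo , seen) hs (a ∷ as , h) =
      search-sound k es _ hs (enqueue-sound (shift (proj₁ p) (successors es (proj₂ p))) (todo , seen) (shift-sound (proj₁ p) (successors es (proj₂ p)) a (hs (proj₂ p))) (as , h))

  private
    rel-irrefl : ∀ s s′ {x y} → T (s ∨ s′) → rel s x y → rel s′ y x → ⊥
    rel-irrefl true  true  _ p q = asym p q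
    rel-irrefl true  false _ p q = q p
    rel-irrefl false true  _ p q = p q

    closes-sound : ∀ e ps → holds e → All (λ p → rel (proj₁ p) (ρ (proj₂ (proj₂ e))) (ρ (proj₂ p))) ps → T (anyCloses e ps) → ⊥
    closes-sound e@(s , i , j) ((s′ , k) ∷ ps) h (a ∷ as) t with T-∨ {closes e (s′ , k)} t
    ... | inj₂ t′ = closes-sound e ps h as t′
    ... | inj₁ t′ with T-∧ {k ≡ᵇ i} t′
    ...   | k≡i , st with ℕ.≡ᵇ⇒≡ k i k≡i
    ...     | refl = rel-irrefl s s′ st h a

  conflict-sound : ∀ e es → holds e → Sound es → T (conflict e es) → ⊥
  conflict-sound e@(s , i , j) es h hs = closes-sound e _ h
    (search-sound (ρ j) 100 es _ hs (irrefl refl ∷ [] , irrefl refl ∷ []))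

infixr 6 _∧′_
infixr 5 _∨′_
infix 7 _<x_ _≤x_ _≡x_ _<y_ _≤y_ _≡y_

data Formula : Set where
  _<x_ _≤x_ _≡x_ _<y_ _≤y_ _≡y_ : ℕ → ℕ → Formula
  _∧′_ _∨′_ : Formula → Formula → Formula
  false′ : Formula

private
  State : Set
  State = Graph × Graph

  addˣ addʸ : Edge → (State → Bool) → State → Bool
  addˣ e@(s , i , j) k (es , fs) = conflict e es ∨ k (insert i (s , j) es , fs)
  addʸ e@(s , i , j) k (es , fs) = conflict e fs ∨ k (es , insert i (s , j) fs)

-- A tableau in continuation-passing style: `k` has to close the branch once the formula has been
-- added, a disjunction asks for both branches, and a conflict closes a branch before `k` is
-- consulted.
refute : Formula → (State → Bool) → State → Bool
refute (i <x j) k = addˣ (true , i , j) k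
refute (i ≤x j) k = addˣ (false , i , j) k
refute (i ≡x j) k = addˣ (false , i , j) (addˣ (false , j , i) k)
refute (i <y j) k = addʸ (true , i , j) k
refute (i ≤y j) k = addʸ (false , i , j) k
refute (i ≡y j) k = addʸ (false , i , j) (addʸ (false , j , i) k)
refute (p ∧′ q) k = refute p (refute q k)
refute (p ∨′ q) k st = refute p k st ∧ refute q k st
refute false′ k st = true

negate : Formula → Formula
negate (i <x j) = j ≤x i
negate (i ≤x j) = j <x i
negate (i ≡x j) = i <x j ∨′ j <x i
negate (i <y j) = j ≤y i
negate (i ≤y j) = j <y i
negate (i ≡y j) = i <y j ∨′ j <y i
negate (p ∧′ q) = negate p ∨′ negate q
negate (p ∨′ q) = negate p ∧′ negate q
negate false′ = 0 ≤x 0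

entails : Formula → Formula → Bool
entails p q = refute p (refute (negate q) (λ _ → false)) ([] , [])

module Semantics (X Y : Axis) (ρ : ℕ → Axis.Carrier X) (ρ′ : ℕ → Axis.Carrier Y) where
  private
    module X = Axis X
    module Y = Axis Y
    module CX = Cycles X ρ
    module CY = Cycles Y ρ′

  ⟦_⟧ : Formula → Set
  ⟦ i <x j ⟧ = ρ i X.< ρ j
  ⟦ i ≤x j ⟧ = ρ i X.≤ ρ j
  ⟦ i ≡x j ⟧ = ρ i ≡ ρ j
  ⟦ i <y j ⟧ = ρ′ i Y.< ρ′ j
  ⟦ i ≤y j ⟧ = ρ′ i Y.≤ ρ′ j
  ⟦ i ≡y j ⟧ = ρ′ i ≡ ρ′ j
  ⟦ p ∧′ q ⟧ = ⟦ p ⟧ × ⟦ q ⟧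
  ⟦ p ∨′ q ⟧ = ⟦ p ⟧ ⊎ ⟦ q ⟧
  ⟦ false′ ⟧ = ⊥

  private
    Valid : State → Set
    Valid (es , fs) = CX.Sound es × CY.Sound fs

    Refutes : (State → Bool) → Set
    Refutes k = ∀ st → Valid st → T (k st) → ⊥

    addˣ-sound : ∀ e k → CX.holds e → Refutes k → Refutes (addˣ e k)
    addˣ-sound e k h r (es , fs) (v , v′) t with T-∨ {conflict e es} t
    ... | inj₁ c = CX.conflict-sound e es h v c
    ... | inj₂ t′ = r _ (CX.insert-sound {proj₁ e} {proj₁ (proj₂ e)} {proj₂ (proj₂ e)} es h v , v′) t′

    addʸ-sound : ∀ e k → CY.holds e → Refutes k → Refutes (addʸ e k)
    addʸ-sound e k h r (es , fs) (v , v′) t with T-∨ {conflict e fs} t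
    ... | inj₁ c = CY.conflict-sound e fs h v′ c
    ... | inj₂ t′ = r _ (v , CY.insert-sound {proj₁ e} {proj₁ (proj₂ e)} {proj₂ (proj₂ e)} fs h v′) t′

    refute-sound : ∀ p k → ⟦ p ⟧ → Refutes k → Refutes (refute p k)
    refute-sound (i <x j) k h = addˣ-sound _ k h
    refute-sound (i ≤x j) k h = addˣ-sound _ k h
    refute-sound (i ≡x j) k h r = addˣ-sound _ _ (X.≤-reflexive h) (addˣ-sound _ k (X.≤-reflexive (sym h)) r)
    refute-sound (i <y j) k h = addʸ-sound _ k h
    refute-sound (i ≤y j) k h = addʸ-sound _ k h
    refute-sound (i ≡y j) k h r = addʸ-sound _ _ (Y.≤-reflexive h) (addʸ-sound _ k (Y.≤-reflexive (sym h)) r)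
    refute-sound (p ∧′ q) k (h , h′) r = refute-sound p _ h (refute-sound q k h′ r)
    refute-sound (p ∨′ q) k (inj₁ h) r st v t = refute-sound p k h r st v (proj₁ (T-∧ t))
    refute-sound (p ∨′ q) k (inj₂ h) r st v t = refute-sound q k h r st v (proj₂ (T-∧ {refute p k st} t))

    excluded-middle : ∀ p → ⟦ p ⟧ ⊎ ⟦ negate p ⟧
    excluded-middle (i <x j) = X.<-or-≤ (ρ i) (ρ j)
    excluded-middle (i ≤x j) = [ inj₂ , inj₁ ]′ (X.<-or-≤ (ρ j) (ρ i))
    excluded-middle (i ≡x j) with X.compare (ρ i) (ρ j)
    ... | tri< lt _ _ = inj₂ (inj₁ lt)
    ... | tri≈ _ e _  = inj₁ e
    ... | tri> _ _ gt = inj₂ (inj₂ gt)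
    excluded-middle (i <y j) = Y.<-or-≤ (ρ′ i) (ρ′ j)
    excluded-middle (i ≤y j) = [ inj₂ , inj₁ ]′ (Y.<-or-≤ (ρ′ j) (ρ′ i))
    excluded-middle (i ≡y j) with Y.compare (ρ′ i) (ρ′ j)
    ... | tri< lt _ _ = inj₂ (inj₁ lt)
    ... | tri≈ _ e _  = inj₁ e
    ... | tri> _ _ gt = inj₂ (inj₂ gt)
    excluded-middle (p ∧′ q) with excluded-middle p | excluded-middle q
    ... | inj₁ a | inj₁ b = inj₁ (a , b)
    ... | inj₁ _ | inj₂ b = inj₂ (inj₂ b)
    ... | inj₂ a | _      = inj₂ (inj₁ a)
    excluded-middle (p ∨′ q) with excluded-middle p | excluded-middle q
    ... | inj₁ a | _      = inj₁ (inj₁ a)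
    ... | inj₂ _ | inj₁ b = inj₁ (inj₂ b)
    ... | inj₂ a | inj₂ b = inj₂ (a , b)
    excluded-middle false′ = inj₂ (X.irrefl refl)

  abstract
    entails-sound : ∀ p q → T (entails p q) → ⟦ p ⟧ → ⟦ q ⟧
    entails-sound p q t h with excluded-middle q
    ... | inj₁ c = c
    ... | inj₂ c = contradiction t (refute-sound p _ h (refute-sound (negate q) _ c (λ _ _ ())) ([] , []) ((λ _ → []) , (λ _ → [])))

-- Boundaries of L-shaped floor plans

-- A floor plan of the box [X₀,X₁] × [Y₀,Y₁] without its corner [c,X₁] × [d,Y₁], in terms of the order
-- only. Module i is [l i,r i] × [b i,t i]. In cover↗ the module contains all points up and to the right
-- of (x,y) that are close to (x,y), and similarly for the other directions.
record Plan (X Y : Axis) (n : ℕ) : Set where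
  open Axis X using () renaming (Carrier to |X|; _<_ to _<ˣ_; _≤_ to _≤ˣ_) public
  open Axis Y using () renaming (Carrier to |Y|; _<_ to _<ʸ_; _≤_ to _≤ʸ_) public
  field
    X₀ c X₁ : |X|
    Y₀ d Y₁ : |Y|
    l r     : Fin n → |X|
    b t     : Fin n → |Y|
    c-pos   : X₀ <ˣ c × c <ˣ X₁
    d-pos   : Y₀ <ʸ d × d <ʸ Y₁
    width   : ∀ i → l i <ˣ r i
    height  : ∀ i → b i <ʸ t i
    x-in    : ∀ i → X₀ ≤ˣ l i × r i ≤ˣ X₁
    y-in    : ∀ i → Y₀ ≤ʸ b i × t i ≤ʸ Y₁
    notch   : ∀ i → r i ≤ˣ c ⊎ t i ≤ʸ d
    apart   : ∀ {i j} → i ≢ j → r i ≤ˣ l j ⊎ r j ≤ˣ l i ⊎ t i ≤ʸ b j ⊎ t j ≤ʸ b i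
    cover↗  : ∀ {x y} → X₀ ≤ˣ x × x <ˣ X₁ × Y₀ ≤ʸ y × y <ʸ Y₁ × (x <ˣ c ⊎ y <ʸ d) →
              ∃ λ i → l i ≤ˣ x × x <ˣ r i × b i ≤ʸ y × y <ʸ t i
    cover↖  : ∀ {x y} → X₀ <ˣ x × x ≤ˣ X₁ × Y₀ ≤ʸ y × y <ʸ Y₁ × (x ≤ˣ c ⊎ y <ʸ d) →
              ∃ λ i → l i <ˣ x × x ≤ˣ r i × b i ≤ʸ y × y <ʸ t i
    cover↘  : ∀ {x y} → X₀ ≤ˣ x × x <ˣ X₁ × Y₀ <ʸ y × y ≤ʸ Y₁ × (x <ˣ c ⊎ y ≤ʸ d) →
              ∃ λ i → l i ≤ˣ x × x <ˣ r i × b i <ʸ y × y ≤ʸ t i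
    cover↙  : ∀ {x y} → X₀ <ˣ x × x ≤ˣ X₁ × Y₀ <ʸ y × y ≤ʸ Y₁ × (x ≤ˣ c ⊎ y ≤ʸ d) →
              ∃ λ i → l i <ˣ x × x ≤ˣ r i × b i <ʸ y × y ≤ʸ t i

  Adjacent : Fin n → Fin n → Set
  Adjacent i j = ((r i ≡ l j ⊎ r j ≡ l i) × b i <ʸ t j × b j <ʸ t i)
               ⊎ ((t i ≡ b j ⊎ t j ≡ b i) × l i <ˣ r j × l j <ˣ r i)

-- Coordinates in formulas: 0, 1, 2 are X₀, c, X₁ resp. Y₀, d, Y₁, and lo k, hi k are the
-- lower and upper coordinate of the k-th module under consideration.
lo hi : ℕ → ℕ
lo k = 3 + 2 * k
hi k = 4 + 2 * k

private
  nth : ∀ {A : Set} → A → List A → ℕ → A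
  nth a []       _       = a
  nth a (x ∷ xs) zero    = x
  nth a (x ∷ xs) (suc k) = nth a xs k

box : ℕ → Formula
box i = lo i <x hi i ∧′ lo i <y hi i ∧′ 0 ≤x lo i ∧′ hi i ≤x 2 ∧′ 0 ≤y lo i ∧′ hi i ≤y 2

frame bounds₁ bounds₂ bounds₃ bounds₄ : Formula
frame = 0 <x 1 ∧′ 1 <x 2 ∧′ 0 <y 1 ∧′ 1 <y 2
bounds₁ = frame ∧′ box 0
bounds₂ = bounds₁ ∧′ box 1
bounds₃ = bounds₂ ∧′ box 2
bounds₄ = bounds₃ ∧′ box 3

outsideNotch : ℕ → Formula
outsideNotch i = hi i ≤x 1 ∨′ hi i ≤y 1

-- The upper ends `iᵗ` and `jᵗ` are separate arguments so that index 2, the top of the box, can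
-- replace the own top of a module that is raised over the notch.
separated touching : ℕ → ℕ → ℕ → ℕ → Formula
separated i iᵗ j jᵗ = hi i ≤x lo j ∨′ hi j ≤x lo i ∨′ iᵗ ≤y lo j ∨′ jᵗ ≤y lo i
touching i iᵗ j jᵗ = (hi i ≡x lo j ∨′ hi j ≡x lo i) ∧′ lo i <y jᵗ ∧′ lo j <y iᵗ
                  ∨′ (iᵗ ≡y lo j ∨′ jᵗ ≡y lo i) ∧′ lo i <x hi j ∧′ lo j <x hi i

separate adjacent coincide exclusive : ℕ → ℕ → Formula
separate i j = separated i (hi i) j (hi j)
adjacent i j = touching i (hi i) j (hi j)
coincide i j = lo i ≡x lo j ∧′ hi i ≡x hi j ∧′ lo i ≡y lo j ∧′ hi i ≡y hi j
exclusive i j = separate i j ∨′ coincide i j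

-- The boundary is traversed counterclockwise, so that the shelf, the horizontal wall of the notch, precedes
-- the vertical one. At the concave corner j follows i directly if the horizontal (inner₁) or the vertical
-- (inner₂) wall is continued between them; otherwise a third module comes in between, touching the corner only.
bottom right shelf inner₁ inner₂ wall top left : ℕ → ℕ → Formula
bottom i j = lo i ≡y 0 ∧′ lo j ≡y 0 ∧′ hi i ≡x lo j
right  i j = hi i ≡x 2 ∧′ hi j ≡x 2 ∧′ hi i ≡y lo j
shelf  i j = hi i ≡y 1 ∧′ hi j ≡y 1 ∧′ lo i ≡x hi j ∧′ 1 ≤x hi j
inner₁ i j = hi i ≡y 1 ∧′ lo i <x 1 ∧′ 1 <x hi i ∧′ hi j ≡x 1 ∧′ lo j ≡y 1
inner₂ i j = hi i ≡y 1 ∧′ lo i ≡x 1 ∧′ hi j ≡x 1 ∧′ lo j <y 1 ∧′ 1 <y hi j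
wall   i j = hi i ≡x 1 ∧′ hi j ≡x 1 ∧′ hi i ≡y lo j ∧′ 1 ≤y hi i
top    i j = hi i ≡y 2 ∧′ hi j ≡y 2 ∧′ lo i ≡x hi j
left   i j = lo i ≡x 0 ∧′ lo j ≡x 0 ∧′ lo i ≡y hi j

atNotch contact : ℕ → ℕ → Formula
atNotch i j = shelf i j ∨′ inner₁ i j ∨′ inner₂ i j ∨′ wall i j
contact i j = atNotch i j ∨′ bottom i j ∨′ right i j ∨′ top i j ∨′ left i j

corner : Fin 5 → ℕ → Formula
corner 0F i = lo i ≡x 0 ∧′ lo i ≡y 0
corner 1F i = hi i ≡x 2 ∧′ lo i ≡y 0
corner 2F i = hi i ≡x 2 ∧′ hi i ≡y 1
corner 3F i = hi i ≡x 1 ∧′ hi i ≡y 2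
corner 4F i = lo i ≡x 0 ∧′ hi i ≡y 2

module PlanProperties {X Y : Axis} {n : ℕ} (plan : Plan X Y n) where
  open Plan plan
  private
    module X = Axis X
    module Y = Axis Y

  module For (ms : List (Fin n)) where
    open Semantics X Y (nth X₀ (X₀ ∷ c ∷ X₁ ∷ concatMap (λ i → l i ∷ r i ∷ []) ms))
                       (nth Y₀ (Y₀ ∷ d ∷ Y₁ ∷ concatMap (λ i → b i ∷ t i ∷ []) ms)) public

  private
    in-box : ∀ i → _ 
    in-box i = width i , height i , proj₁ (x-in i) , proj₂ (x-in i) , proj₁ (y-in i) , proj₂ (y-in i)
    in-frame = proj₁ c-pos , proj₂ c-pos , proj₁ d-pos , proj₂ d-pos

  -- The hidden argument is filled by running the decision procedure: once `entails` evaluates to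
  -- `true`, its type is the unit type.
  by₁ : ∀ i p q {_ : T (entails (bounds₁ ∧′ p) q)} → let open For (i ∷ []) in ⟦ p ⟧ → ⟦ q ⟧
  by₁ i p q {ok} h = For.entails-sound (i ∷ []) (bounds₁ ∧′ p) q ok ((in-frame , in-box i) , h)

  by₂ : ∀ i j p q {_ : T (entails (bounds₂ ∧′ p) q)} → let open For (i ∷ j ∷ []) in ⟦ p ⟧ → ⟦ q ⟧
  by₂ i j p q {ok} h = For.entails-sound (i ∷ j ∷ []) (bounds₂ ∧′ p) q ok (((in-frame , in-box i) , in-box j) , h)

  by₃ : ∀ i j k p q {_ : T (entails (bounds₃ ∧′ p) q)} → let open For (i ∷ j ∷ k ∷ []) in ⟦ p ⟧ → ⟦ q ⟧
  by₃ i j k p q {ok} h = For.entails-sound (i ∷ j ∷ k ∷ []) (bounds₃ ∧′ p) q ok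
    ((((in-frame , in-box i) , in-box j) , in-box k) , h)

  by₄ : ∀ i j k m p q {_ : T (entails (bounds₄ ∧′ p) q)} → let open For (i ∷ j ∷ k ∷ m ∷ []) in ⟦ p ⟧ → ⟦ q ⟧
  by₄ i j k m p q {ok} h = For.entails-sound (i ∷ j ∷ k ∷ m ∷ []) (bounds₄ ∧′ p) q ok
    (((((in-frame , in-box i) , in-box j) , in-box k) , in-box m) , h)

  Contact : Fin n → Fin n → Set
  Contact i j = For.⟦_⟧ (i ∷ j ∷ []) (contact 0 1)

  contact-adjacent : ∀ {i j} → Contact i j → Adjacent i j
  contact-adjacent {i} {j} = by₂ i j (contact 0 1) (adjacent 0 1)

  -- Contacts in both directions put both ends of the common wall on the boundary, and no end is
  -- left for a third module.
  two-sided : ∀ {i j x} → Contact i j → Contact j i → Adjacent i x → Adjacent j x → ⊥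
  two-sided {i} {j} {x} ij ji ix jx =
    by₃ i j x (contact 0 1 ∧′ contact 1 0 ∧′ adjacent 0 2 ∧′ adjacent 1 2 ∧′ outsideNotch 2) false′ (ij , ji , ix , jx , notch x)

  unique-common : ∀ {i j x y} → Contact i j → Adjacent i x → Adjacent j x → Adjacent i y → Adjacent j y → x ≡ y
  unique-common {i} {j} {x} {y} ij ix jx iy jy with x Fin.≟ y
  ... | yes e = e
  ... | no x≢y = ⊥-elim (by₄ i j x y
    (contact 0 1 ∧′ adjacent 0 2 ∧′ adjacent 1 2 ∧′ adjacent 0 3 ∧′ adjacent 1 3 ∧′ separate 2 3 ∧′ outsideNotch 2 ∧′ outsideNotch 3) false′
    (ij , ix , jx , iy , jy , apart x≢y , notch x , notch y))

  AtNotch Bottom Right Top Left : Fin n → Fin n → Set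
  AtNotch i j = For.⟦_⟧ (i ∷ j ∷ []) (atNotch 0 1)
  Bottom i j = For.⟦_⟧ (i ∷ j ∷ []) (bottom 0 1)
  Right i j = For.⟦_⟧ (i ∷ j ∷ []) (right 0 1)
  Top i j = For.⟦_⟧ (i ∷ j ∷ []) (top 0 1)
  Left i j = For.⟦_⟧ (i ∷ j ∷ []) (left 0 1)

  -- The successor is the module that covers the small quadrant at the forward boundary corner of
  -- `j`, pointing ahead and into the plan. The direction of the cover turns with the side: ↗, ↖, ↙,
  -- ↘ for bottom, right, top, left.
  bottom-step : ∀ {j} → b j ≡ Y₀ → r j <ˣ X₁ → ∃ λ k → Bottom j k
  bottom-step {j} e lt with cover↗ (by₁ j (lo 0 ≡y 0 ∧′ hi 0 <x 2)
                              (0 ≤x hi 0 ∧′ hi 0 <x 2 ∧′ 0 ≤y 0 ∧′ 0 <y 2 ∧′ (hi 0 <x 1 ∨′ 0 <y 1)) (e , lt))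
  ... | k , p@(_ , r< , _) = k , by₂ j k (lo 0 ≡y 0 ∧′ (lo 1 ≤x hi 0 ∧′ hi 0 <x hi 1 ∧′ lo 1 ≤y 0 ∧′ 0 <y hi 1) ∧′ separate 0 1)
                                   (bottom 0 1) (e , p , apart λ { refl → X.irrefl refl r< })

  right-step : ∀ {j} → r j ≡ X₁ → t j <ʸ d → ∃ λ k → Right j k
  right-step {j} e lt with cover↖ (by₁ j (hi 0 ≡x 2 ∧′ hi 0 <y 1)
                             (0 <x 2 ∧′ 2 ≤x 2 ∧′ 0 ≤y hi 0 ∧′ hi 0 <y 2 ∧′ (2 ≤x 1 ∨′ hi 0 <y 1)) (e , lt))
  ... | k , p@(_ , _ , _ , t<) = k , by₂ j k (hi 0 ≡x 2 ∧′ (lo 1 <x 2 ∧′ 2 ≤x hi 1 ∧′ lo 1 ≤y hi 0 ∧′ hi 0 <y hi 1) ∧′ separate 0 1)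
                                       (right 0 1) (e , p , apart λ { refl → Y.irrefl refl t< })

  top-step : ∀ {j} → t j ≡ Y₁ → X₀ <ˣ l j → ∃ λ k → Top j k
  top-step {j} e lt with cover↙ (by₁ j (hi 0 ≡y 2 ∧′ 0 <x lo 0 ∧′ outsideNotch 0)
                           (0 <x lo 0 ∧′ lo 0 ≤x 2 ∧′ 0 <y 2 ∧′ 2 ≤y 2 ∧′ (lo 0 ≤x 1 ∨′ 2 ≤y 1)) (e , lt , notch j))
  ... | k , p@(l< , _) = k , by₂ j k (hi 0 ≡y 2 ∧′ (lo 1 <x lo 0 ∧′ lo 0 ≤x hi 1 ∧′ lo 1 <y 2 ∧′ 2 ≤y hi 1) ∧′ separate 0 1)
                               (top 0 1) (e , p , apart λ { refl → X.irrefl refl l< })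

  left-step : ∀ {j} → l j ≡ X₀ → Y₀ <ʸ b j → ∃ λ k → Left j k
  left-step {j} e lt with cover↘ (by₁ j (lo 0 ≡x 0 ∧′ 0 <y lo 0)
                            (0 ≤x 0 ∧′ 0 <x 2 ∧′ 0 <y lo 0 ∧′ lo 0 ≤y 2 ∧′ (0 <x 1 ∨′ lo 0 ≤y 1)) (e , lt))
  ... | k , p@(_ , _ , b< , _) = k , by₂ j k (lo 0 ≡x 0 ∧′ (lo 1 ≤x 0 ∧′ 0 <x hi 1 ∧′ lo 1 <y lo 0 ∧′ lo 0 ≤y hi 1) ∧′ separate 0 1)
                                       (left 0 1) (e , p , apart λ { refl → Y.irrefl refl b< })

  wall-step : ∀ {j} → r j ≡ c → d ≤ʸ t j → t j <ʸ Y₁ → ∃ λ k → For.⟦_⟧ (j ∷ k ∷ []) (wall 0 1)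
  wall-step {j} e le lt with cover↖ (by₁ j (1 ≤y hi 0 ∧′ hi 0 <y 2)
                               (0 <x 1 ∧′ 1 ≤x 2 ∧′ 0 ≤y hi 0 ∧′ hi 0 <y 2 ∧′ (1 ≤x 1 ∨′ hi 0 <y 1)) (le , lt))
  ... | k , p@(_ , _ , _ , t<) = k , by₂ j k
    (hi 0 ≡x 1 ∧′ 1 ≤y hi 0 ∧′ (lo 1 <x 1 ∧′ 1 ≤x hi 1 ∧′ lo 1 ≤y hi 0 ∧′ hi 0 <y hi 1) ∧′ separate 0 1 ∧′ outsideNotch 1)
    (wall 0 1) (e , le , p , apart (λ { refl → Y.irrefl refl t< }) , notch k)

  -- Three positions of `j` matter: wholly to the right of the concave corner, where the shelf goes
  -- on; passing below it, where the module above and to the left comes next; starting exactly at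
  -- it, where the module below and to the left comes next and may or may not rise above the shelf.
  shelf-step : ∀ {j} → t j ≡ d → c <ˣ r j → ∃ λ k → AtNotch j k
  shelf-step {j} e c<r with X.<-or-≤ c (l j)
  ... | inj₁ c<l =
    let k , p = cover↙ (by₁ j (1 <x lo 0) (0 <x lo 0 ∧′ lo 0 ≤x 2 ∧′ 0 <y 1 ∧′ 1 ≤y 2 ∧′ (lo 0 ≤x 1 ∨′ 1 ≤y 1)) c<l)
    in k , by₂ j k
         (hi 0 ≡y 1 ∧′ 1 <x lo 0 ∧′ (lo 1 <x lo 0 ∧′ lo 0 ≤x hi 1 ∧′ lo 1 <y 1 ∧′ 1 ≤y hi 1) ∧′ separate 0 1 ∧′ outsideNotch 1)
         (atNotch 0 1) (e , c<l , p , apart (λ j≡k → X.irrefl (cong l (sym j≡k)) (proj₁ p)) , notch k)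
  ... | inj₂ l≤c with X.≤⇒<-or-≡ l≤c
  ...   | inj₁ l<c =
    let k , p = cover↖ (by₁ j (lo 0 <x 1) (0 <x 1 ∧′ 1 ≤x 2 ∧′ 0 ≤y 1 ∧′ 1 <y 2 ∧′ (1 ≤x 1 ∨′ 1 <y 1)) l<c)
    in k , by₂ j k
         (hi 0 ≡y 1 ∧′ 1 <x hi 0 ∧′ lo 0 <x 1 ∧′ (lo 1 <x 1 ∧′ 1 ≤x hi 1 ∧′ lo 1 ≤y 1 ∧′ 1 <y hi 1) ∧′ separate 0 1 ∧′ outsideNotch 1)
         (atNotch 0 1) (e , c<r , l<c , p , apart (λ j≡k → Y.irrefl (trans (sym e) (cong t j≡k)) (proj₂ (proj₂ (proj₂ p)))) , notch k)
  ...   | inj₂ l≡c =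
    let k , p = cover↙ (by₁ j (lo 0 ≡x 1) (0 <x 1 ∧′ 1 ≤x 2 ∧′ 0 <y 1 ∧′ 1 ≤y 2 ∧′ (1 ≤x 1 ∨′ 1 ≤y 1)) l≡c)
    in k , by₂ j k
         (hi 0 ≡y 1 ∧′ 1 <x hi 0 ∧′ lo 0 ≡x 1 ∧′ (lo 1 <x 1 ∧′ 1 ≤x hi 1 ∧′ lo 1 <y 1 ∧′ 1 ≤y hi 1) ∧′ separate 0 1 ∧′ outsideNotch 1)
         (atNotch 0 1) (e , c<r , l≡c , p , apart (λ j≡k → X.irrefl (trans (cong l (sym j≡k)) l≡c) (proj₁ p)) , notch k)

  -- A module at the end of a side occupies a convex corner and is passed on to the next side. The
  -- chain wall, top, left, bottom, right, shelf stops there, because `shelf-step` always succeeds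
  -- and turns the concave corner itself.
  from-shelf : ∀ {j} → t j ≡ d → c <ˣ r j → ∃ λ k → Contact j k
  from-shelf e c<r = let k , p = shelf-step e c<r in k , inj₁ p

  from-right : ∀ {j} → r j ≡ X₁ → ∃ λ k → Contact j k
  from-right {j} e with Y.≤⇒<-or-≡ (by₁ j (hi 0 ≡x 2 ∧′ outsideNotch 0) (hi 0 ≤y 1) (e , notch j))
  ... | inj₁ lt = let k , p = right-step e lt in k , inj₂ (inj₂ (inj₁ p))
  ... | inj₂ t≡d = from-shelf t≡d (by₁ j (hi 0 ≡x 2) (1 <x hi 0) e)

  from-bottom : ∀ {j} → b j ≡ Y₀ → ∃ λ k → Contact j k
  from-bottom {j} e with X.≤⇒<-or-≡ (proj₂ (x-in j))
  ... | inj₁ lt = let k , p = bottom-step e lt in k , inj₂ (inj₁ p)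
  ... | inj₂ r≡X₁ = from-right r≡X₁

  from-left : ∀ {j} → l j ≡ X₀ → ∃ λ k → Contact j k
  from-left {j} e with Y.≤⇒<-or-≡ (proj₁ (y-in j))
  ... | inj₁ lt = let k , p = left-step e lt in k , inj₂ (inj₂ (inj₂ (inj₂ p)))
  ... | inj₂ b≡Y₀ = from-bottom (sym b≡Y₀)

  from-top : ∀ {j} → t j ≡ Y₁ → ∃ λ k → Contact j k
  from-top {j} e with X.≤⇒<-or-≡ (proj₁ (x-in j))
  ... | inj₁ lt = let k , p = top-step e lt in k , inj₂ (inj₂ (inj₂ (inj₁ p)))
  ... | inj₂ l≡X₀ = from-left (sym l≡X₀)

  from-wall : ∀ {j} → r j ≡ c → d ≤ʸ t j → ∃ λ k → Contact j k
  from-wall {j} e le with Y.≤⇒<-or-≡ (proj₂ (y-in j))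
  ... | inj₁ lt = let k , p = wall-step e le lt in k , inj₁ (inj₂ (inj₂ (inj₂ p)))
  ... | inj₂ t≡Y₁ = from-top t≡Y₁

  notch-cases : ∀ {i j} → AtNotch i j → (t j ≡ d × c <ˣ r j) ⊎ (r j ≡ c × d ≤ʸ t j)
  notch-cases {i} {j} = by₂ i j (atNotch 0 1) (hi 1 ≡y 1 ∧′ 1 <x hi 1 ∨′ hi 1 ≡x 1 ∧′ 1 ≤y hi 1)

  advance : ∀ {i j} → Contact i j → ∃ λ k → Contact j k
  advance (inj₁ p) with notch-cases p
  ... | inj₁ (e , c<r) = from-shelf e c<r
  ... | inj₂ (e , le) = from-wall e le
  advance (inj₂ (inj₁ (_ , e , _))) = from-bottom e
  advance (inj₂ (inj₂ (inj₁ (_ , e , _)))) = from-right e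
  advance (inj₂ (inj₂ (inj₂ (inj₁ (_ , e , _))))) = from-top e
  advance (inj₂ (inj₂ (inj₂ (inj₂ (_ , e , _))))) = from-left e

  Corner : Fin 5 → Fin n → Set
  Corner κ i = For.⟦_⟧ (i ∷ []) (corner κ 0)

  Corner? : ∀ κ i → Dec (Corner κ i)
  Corner? 0F i = (l i X.≟ X₀) ×-dec (b i Y.≟ Y₀)
  Corner? 1F i = (r i X.≟ X₁) ×-dec (b i Y.≟ Y₀)
  Corner? 2F i = (r i X.≟ X₁) ×-dec (t i Y.≟ d)
  Corner? 3F i = (r i X.≟ c) ×-dec (t i Y.≟ Y₁)
  Corner? 4F i = (l i X.≟ X₀) ×-dec (t i Y.≟ Y₁)

  corner-unique : ∀ {κ i j} → Corner κ i → Corner κ j → i ≡ j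
  corner-unique {κ} {i} {j} p q with i Fin.≟ j
  ... | yes e = e
  ... | no i≢j = ⊥-elim (go κ p q)
    where
    go : ∀ κ → Corner κ i → Corner κ j → ⊥
    go 0F p q = by₂ i j (corner 0F 0 ∧′ corner 0F 1 ∧′ separate 0 1) false′ (p , q , apart i≢j)
    go 1F p q = by₂ i j (corner 1F 0 ∧′ corner 1F 1 ∧′ separate 0 1) false′ (p , q , apart i≢j)
    go 2F p q = by₂ i j (corner 2F 0 ∧′ corner 2F 1 ∧′ separate 0 1) false′ (p , q , apart i≢j)
    go 3F p q = by₂ i j (corner 3F 0 ∧′ corner 3F 1 ∧′ separate 0 1) false′ (p , q , apart i≢j)
    go 4F p q = by₂ i j (corner 4F 0 ∧′ corner 4F 1 ∧′ separate 0 1) false′ (p , q , apart i≢j)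

  module _ (functional : ∀ {i j k} → Contact i j → Contact i k → j ≡ k)
           (u : ℕ → Fin n) (m : ℕ) (path : ∀ i → i ℕ.< 2 + m → Contact (u i) (u (suc i)))
           (noCorner : ∀ i → 0 ℕ.< i → i ℕ.< 2 + m → ∀ κ → ¬ Corner κ (u i)) where

    private
      -- One kind of contact continues along a path without corners, and far from its start the path
      -- is separated from it by an invariant that later contacts preserve.
      continue : ∀ (Side : Fin n → Fin n → Set) → (∀ {i j} → Side i j → Contact i j) →
                 (∀ {i j} → Side i j → (∀ κ → ¬ Corner κ j) → ∃ λ k → Side j k) →
                 (Far : Fin n → Fin n → Set) → (∀ {i j k} → Side i j → Side j k → Far i k) →
                 (∀ {i j k} → Far i j → Side j k → Far i k) → (∀ {i j} → Far i j → ¬ Adjacent i j) →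
                 Side (u 0) (u 1) → ¬ Adjacent (u 0) (u (2 + m))
      continue Side sound proceed Far far₀ far⁺ far⇒ s₀ = far⇒ (far m (ℕ.n<1+n (suc m)))
        where
        side : ∀ i → i ℕ.< 2 + m → Side (u i) (u (suc i))
        side zero _ = s₀
        side (suc i) lt =
          let s = side i (ℕ.<⇒≤ lt)
              k , s′ = proceed s (noCorner (suc i) (s≤s z≤n) lt)
          in subst (Side (u (suc i))) (functional (sound s′) (path (suc i) lt)) s′
        far : ∀ i → suc i ℕ.< 2 + m → Far (u 0) (u (2 + i))
        far zero lt = far₀ s₀ (side 1 lt)
        far (suc i) lt = far⁺ (far i (ℕ.<⇒≤ lt)) (side (2 + i) lt)

      -- Around the bend the path goes first left, then up, so no single coordinate separates its
      -- members from the start. The third alternative covers modules that meet at most in a point,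
      -- as happens across the concave corner.
      far-notch : ℕ → ℕ → Formula
      far-notch i k = 1 ≤y hi i ∧′ (hi k <x lo i ∨′ hi i <y lo k ∨′ hi k ≤x lo i ∧′ hi i ≤y lo k)

    -- The first contact decides on which side the whole path runs. Shelf and wall count as one
    -- side, since the concave corner between them is not among the five.
    bent-path : ¬ Adjacent (u 0) (u (2 + m))
    bent-path with path 0 (s≤s z≤n)
    ... | inj₁ s₀ = continue AtNotch inj₁
      (λ {i} {j} s none → [ (λ (e , c<r) → shelf-step e c<r)
                          , (λ (e , le) → let k , w = wall-step e le (below-top e none) in k , inj₂ (inj₂ (inj₂ w))) ]′ (notch-cases s))
      (λ i k → For.⟦_⟧ (i ∷ k ∷ []) (far-notch 0 1))
      (λ {i} {j} {k} p q → by₃ i j k (atNotch 0 1 ∧′ atNotch 1 2) (far-notch 0 2) (p , q))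
      (λ {i} {j} {k} p q → by₃ i j k (far-notch 0 1 ∧′ atNotch 1 2) (far-notch 0 2) (p , q))
      (λ {i} {j} p q → by₂ i j (far-notch 0 1 ∧′ adjacent 0 1) false′ (p , q)) s₀
      where
      below-top : ∀ {j} → r j ≡ c → (∀ κ → ¬ Corner κ j) → t j <ʸ Y₁
      below-top {j} e none = [ (λ lt → lt) , (λ t≡Y₁ → contradiction (e , t≡Y₁) (none 3F)) ]′ (Y.≤⇒<-or-≡ (proj₂ (y-in j)))
    ... | inj₂ (inj₁ s₀) = continue Bottom (inj₂ ∘ inj₁)
      (λ {i} {j} (_ , e , _) none → bottom-step e
        ([ (λ lt → lt) , (λ e′ → contradiction (e′ , e) (none 1F)) ]′ (X.≤⇒<-or-≡ (proj₂ (x-in j)))))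
      (λ i k → r i <ˣ l k)
      (λ {i} {j} {k} p q → by₃ i j k (bottom 0 1 ∧′ bottom 1 2) (hi 0 <x lo 2) (p , q))
      (λ {i} {j} {k} p q → by₃ i j k (hi 0 <x lo 1 ∧′ bottom 1 2) (hi 0 <x lo 2) (p , q))
      (λ {i} {j} p q → by₂ i j (hi 0 <x lo 1 ∧′ adjacent 0 1) false′ (p , q)) s₀
    ... | inj₂ (inj₂ (inj₁ s₀)) = continue Right (inj₂ ∘ inj₂ ∘ inj₁)
      (λ {i} {j} (_ , e , _) none → right-step e
        ([ (λ lt → lt) , (λ e′ → contradiction (e , e′) (none 2F)) ]′
          (Y.≤⇒<-or-≡ (by₁ j (hi 0 ≡x 2 ∧′ outsideNotch 0) (hi 0 ≤y 1) (e , notch j)))))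
      (λ i k → t i <ʸ b k)
      (λ {i} {j} {k} p q → by₃ i j k (right 0 1 ∧′ right 1 2) (hi 0 <y lo 2) (p , q))
      (λ {i} {j} {k} p q → by₃ i j k (hi 0 <y lo 1 ∧′ right 1 2) (hi 0 <y lo 2) (p , q))
      (λ {i} {j} p q → by₂ i j (hi 0 <y lo 1 ∧′ adjacent 0 1) false′ (p , q)) s₀
    ... | inj₂ (inj₂ (inj₂ (inj₁ s₀))) = continue Top (inj₂ ∘ inj₂ ∘ inj₂ ∘ inj₁)
      (λ {i} {j} (_ , e , _) none → top-step e
        ([ (λ lt → lt) , (λ e′ → contradiction (sym e′ , e) (none 4F)) ]′ (X.≤⇒<-or-≡ (proj₁ (x-in j)))))
      (λ i k → r k <ˣ l i)
      (λ {i} {j} {k} p q → by₃ i j k (top 0 1 ∧′ top 1 2) (hi 2 <x lo 0) (p , q))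
      (λ {i} {j} {k} p q → by₃ i j k (hi 1 <x lo 0 ∧′ top 1 2) (hi 2 <x lo 0) (p , q))
      (λ {i} {j} p q → by₂ i j (hi 1 <x lo 0 ∧′ adjacent 0 1) false′ (p , q)) s₀
    ... | inj₂ (inj₂ (inj₂ (inj₂ s₀))) = continue Left (inj₂ ∘ inj₂ ∘ inj₂ ∘ inj₂)
      (λ {i} {j} (_ , e , _) none → left-step e
        ([ (λ lt → lt) , (λ e′ → contradiction (e , sym e′) (none 0F)) ]′ (Y.≤⇒<-or-≡ (proj₁ (y-in j)))))
      (λ i k → t k <ʸ b i)
      (λ {i} {j} {k} p q → by₃ i j k (left 0 1 ∧′ left 1 2) (hi 2 <y lo 0) (p , q))
      (λ {i} {j} {k} p q → by₃ i j k (hi 1 <y lo 0 ∧′ left 1 2) (hi 2 <y lo 0) (p , q))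
      (λ {i} {j} p q → by₂ i j (hi 1 <y lo 0 ∧′ adjacent 0 1) false′ (p , q)) s₀

  straight : (∀ {i j k} → Contact i j → Contact i k → j ≡ k) →
             ∀ (u : ℕ → Fin n) l → 2 ℕ.≤ l → (∀ i → i ℕ.< l → Contact (u i) (u (suc i))) →
             (∀ i → 0 ℕ.< i → i ℕ.< l → ∀ κ → ¬ Corner κ (u i)) → ¬ Adjacent (u 0) (u l)
  straight functional u (suc (suc m)) _ path noCorner = bent-path functional u m path noCorner
  straight functional u (suc zero) (s≤s ()) path noCorner

  some-contact : ∃₂ λ i j → Contact i j
  some-contact =
    let i , p = cover↘ (proj₂ c≤ , proj₂ c-pos , proj₁ d-pos , Y.<⇒≤ (proj₂ d-pos) , inj₂ (Y.irrefl refl))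
        k , q = from-shelf (by₁ i (1 <x hi 0 ∧′ 1 ≤y hi 0 ∧′ outsideNotch 0) (hi 0 ≡y 1)
                             (proj₁ (proj₂ p) , proj₂ (proj₂ (proj₂ p)) , notch i)) (proj₁ (proj₂ p))
    in i , k , q
    where
    c≤ : c ≤ˣ c × X₀ ≤ˣ c
    c≤ = X.irrefl refl , X.<⇒≤ (proj₁ c-pos)

-- The concave corner

-- The uniqueness of common neighbours is carried along because it is what makes both edges exterior
-- in the graph. An arbitrary relation `R` lets triplets pass between the plan, its transpose and
-- the graph.
record Triplet {n : ℕ} (R : Fin n → Fin n → Set) : Set where
  field
    {u v w}    : Fin n
    uv         : R u v
    vw         : R v w
    uv-unique  : ∀ {x y} → R u x → R v x → R u y → R v y → x ≡ y
    vw-unique  : ∀ {x y} → R v x → R w x → R v y → R w y → x ≡ y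
    u≢w        : u ≢ w
    ¬uw        : ¬ R u w
    only-v     : ∀ x → R u x → R w x → x ≡ v

Triplet-map : ∀ {n} {R S : Fin n → Fin n → Set} → (∀ {i j} → R i j → S i j) → (∀ {i j} → S i j → R i j) → Triplet R → Triplet S
Triplet-map f g T = record
  { uv = f uv ; vw = f vw
  ; uv-unique = λ p q p′ q′ → uv-unique (g p) (g q) (g p′) (g q′)
  ; vw-unique = λ p q p′ q′ → vw-unique (g p) (g q) (g p′) (g q′)
  ; u≢w = u≢w ; ¬uw = ¬uw ∘ g ; only-v = λ x p q → only-v x (g p) (g q) }
  where open Triplet T

-- A floor plan of the whole box that arises by moving the two walls at the notch outwards.
record Stretch {X Y : Axis} {n : ℕ} (plan : Plan X Y n) : Set where
  open Plan plan
  field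
    r′ : Fin n → |X|
    t′ : Fin n → |Y|
    r′-moved : ∀ i → r′ i ≡ r i ⊎ (r i ≡ c × d <ʸ t i)
    t′-moved : ∀ i → t′ i ≡ t i ⊎ (t i ≡ d × c <ˣ r i)
    r≤r′     : ∀ i → r i ≤ˣ r′ i
    t≤t′     : ∀ i → t i ≤ʸ t′ i
    r′≤X₁    : ∀ i → r′ i ≤ˣ X₁
    t′≤Y₁    : ∀ i → t′ i ≤ʸ Y₁
    apart′   : ∀ {i j} → i ≢ j → r′ i ≤ˣ l j ⊎ r′ j ≤ˣ l i ⊎ t′ i ≤ʸ b j ⊎ t′ j ≤ʸ b i
    cover′   : ∀ {x y} → X₀ <ˣ x × x <ˣ X₁ × Y₀ <ʸ y × y <ʸ Y₁ →
               ∃ λ i → l i ≤ˣ x × x ≤ˣ r′ i × b i ≤ʸ y × y ≤ʸ t′ i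

  Adjacent′ : Fin n → Fin n → Set
  Adjacent′ i j = ((r′ i ≡ l j ⊎ r′ j ≡ l i) × b i <ʸ t′ j × b j <ʸ t′ i)
                ⊎ ((t′ i ≡ b j ⊎ t′ j ≡ b i) × l i <ˣ r′ j × l j <ˣ r′ i)

  field
    adjacent′⇒ : ∀ {i j} → Adjacent′ i j → Adjacent i j
    ⇒adjacent′ : ∀ {i j} → Adjacent i j → Adjacent′ i j

module Transpose {X Y : Axis} {n : ℕ} (plan : Plan X Y n) where
  open Plan plan

  private
    around : ∀ {A B C D : Set} → A ⊎ B ⊎ C ⊎ D → C ⊎ D ⊎ A ⊎ B
    around (inj₁ p) = inj₂ (inj₂ (inj₁ p))
    around (inj₂ (inj₁ p)) = inj₂ (inj₂ (inj₂ p))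
    around (inj₂ (inj₂ (inj₁ p))) = inj₁ p
    around (inj₂ (inj₂ (inj₂ p))) = inj₂ (inj₁ p)

    turn : ∀ {A : Set} {P Q R S : A → Set} → (∃ λ i → P i × Q i × R i × S i) → ∃ λ i → R i × S i × P i × Q i
    turn (i , p , q , r , s) = i , r , s , p , q

  transpose : Plan Y X n
  transpose = record
    { X₀ = Y₀ ; c = d ; X₁ = Y₁ ; Y₀ = X₀ ; d = c ; Y₁ = X₁ ; l = b ; r = t ; b = l ; t = r
    ; c-pos = d-pos ; d-pos = c-pos ; width = height ; height = width ; x-in = y-in ; y-in = x-in
    ; notch = Sum.swap ∘ notch ; apart = around ∘ apart
    ; cover↗ = λ (p , q , p′ , q′ , h) → turn (cover↗ (p′ , q′ , p , q , Sum.swap h))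
    ; cover↖ = λ (p , q , p′ , q′ , h) → turn (cover↘ (p′ , q′ , p , q , Sum.swap h))
    ; cover↘ = λ (p , q , p′ , q′ , h) → turn (cover↖ (p′ , q′ , p , q , Sum.swap h))
    ; cover↙ = λ (p , q , p′ , q′ , h) → turn (cover↙ (p′ , q′ , p , q , Sum.swap h)) }

  -- Reflection in the diagonal reverses the direction of traversal, hence the swapped modules. It
  -- exchanges bottom with left, right with top, shelf with wall, and `inner₁` with `inner₂`.
  contact-transpose : ∀ {i j} → PlanProperties.Contact plan i j → PlanProperties.Contact transpose j i
  contact-transpose (inj₁ (inj₁ (p , q , e , h))) = inj₁ (inj₂ (inj₂ (inj₂ (q , p , sym e , h))))
  contact-transpose (inj₁ (inj₂ (inj₁ (p , q , q′ , e , e′)))) = inj₁ (inj₂ (inj₂ (inj₁ (e , e′ , p , q , q′))))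
  contact-transpose (inj₁ (inj₂ (inj₂ (inj₁ (p , q , e , h , h′))))) = inj₁ (inj₂ (inj₁ (e , h , h′ , p , q)))
  contact-transpose (inj₁ (inj₂ (inj₂ (inj₂ (p , q , e , h))))) = inj₁ (inj₁ (q , p , sym e , h))
  contact-transpose (inj₂ (inj₁ (p , q , e))) = inj₂ (inj₂ (inj₂ (inj₂ (q , p , sym e))))
  contact-transpose (inj₂ (inj₂ (inj₁ (p , q , e)))) = inj₂ (inj₂ (inj₂ (inj₁ (q , p , sym e))))
  contact-transpose (inj₂ (inj₂ (inj₂ (inj₁ (p , q , e))))) = inj₂ (inj₂ (inj₁ (q , p , sym e)))
  contact-transpose (inj₂ (inj₂ (inj₂ (inj₂ (p , q , e))))) = inj₂ (inj₁ (q , p , sym e))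

  Stretch-transpose : Stretch transpose → Stretch plan
  Stretch-transpose S = record
    { r′ = t′ ; t′ = r′ ; r′-moved = t′-moved ; t′-moved = r′-moved ; r≤r′ = t≤t′ ; t≤t′ = r≤r′
    ; r′≤X₁ = t′≤Y₁ ; t′≤Y₁ = r′≤X₁ ; apart′ = around ∘ apart′
    ; cover′ = λ (p , q , p′ , q′) → turn (cover′ (p′ , q′ , p , q))
    ; adjacent′⇒ = Sum.swap ∘ adjacent′⇒ ∘ Sum.swap
    ; ⇒adjacent′ = Sum.swap ∘ ⇒adjacent′ ∘ Sum.swap }
    where open Stretch S

module ConcaveCorner {X Y : Axis} {n : ℕ} (plan : Plan X Y n) where
  open Plan plan
  open PlanProperties plan
  private
    module X = Axis X
    module Y = Axis Y

  triplet : ∀ {u v w} → Contact u v → Contact v w → u ≢ w → ¬ Adjacent u w →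
            (∀ x → Adjacent u x → Adjacent w x → x ≡ v) → Triplet Adjacent
  triplet uv vw u≢w ¬uw only-v = record
    { uv = contact-adjacent uv ; vw = contact-adjacent vw ; uv-unique = unique-common uv ; vw-unique = unique-common vw
    ; u≢w = u≢w ; ¬uw = ¬uw ; only-v = only-v }

  -- At the concave corner `A` covers the upper left quadrant, `C` the lower right and `D` the lower
  -- left one. `D` may coincide with `A` or with `C`, but these two differ because of the notch.
  record Around : Set where
    field
      A C D : Fin n
      atA : l A <ˣ c × c ≤ˣ r A × b A ≤ʸ d × d <ʸ t A
      atC : l C ≤ˣ c × c <ˣ r C × b C <ʸ d × d ≤ʸ t C
      atD : l D <ˣ c × c ≤ˣ r D × b D <ʸ d × d ≤ʸ t D

  around : Around
  around = record { atA = proj₂ (cover↖ (X₀<c , c≤X₁ , Y₀≤d , d<Y₁ , inj₁ c≤c))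
                  ; atC = proj₂ (cover↘ (X₀≤c , c<X₁ , Y₀<d , d≤Y₁ , inj₂ d≤d))
                  ; atD = proj₂ (cover↙ (X₀<c , c≤X₁ , Y₀<d , d≤Y₁ , inj₁ c≤c)) }
    where
    X₀<c = proj₁ c-pos ; c<X₁ = proj₂ c-pos ; Y₀<d = proj₁ d-pos ; d<Y₁ = proj₂ d-pos
    X₀≤c = X.<⇒≤ X₀<c ; c≤X₁ = X.<⇒≤ c<X₁ ; Y₀≤d = Y.<⇒≤ Y₀<d ; d≤Y₁ = Y.<⇒≤ d<Y₁
    c≤c : c ≤ˣ c
    c≤c = X.irrefl refl
    d≤d : d ≤ʸ d
    d≤d = Y.irrefl refl

  open Around around public

  nw se sw : ℕ → Formula
  nw i = lo i <x 1 ∧′ 1 ≤x hi i ∧′ lo i ≤y 1 ∧′ 1 <y hi i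
  se i = lo i ≤x 1 ∧′ 1 <x hi i ∧′ lo i <y 1 ∧′ 1 ≤y hi i
  sw i = lo i <x 1 ∧′ 1 ≤x hi i ∧′ lo i <y 1 ∧′ 1 ≤y hi i

  A≢C : A ≢ C
  A≢C e = by₁ A (nw 0 ∧′ se 0 ∧′ outsideNotch 0) false′ (atA , subst (λ i → For.⟦_⟧ (i ∷ []) (se 0)) (sym e) atC , notch A)

  se-unique : ∀ {i j} → For.⟦_⟧ (i ∷ []) (se 0) → For.⟦_⟧ (j ∷ []) (se 0) → i ≡ j
  se-unique {i} {j} p q with i Fin.≟ j
  ... | yes e = e
  ... | no i≢j = ⊥-elim (by₂ i j (se 0 ∧′ se 1 ∧′ separate 0 1) false′ (p , q , apart i≢j))

  sw-unique : ∀ {i j} → For.⟦_⟧ (i ∷ []) (sw 0) → For.⟦_⟧ (j ∷ []) (sw 0) → i ≡ j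
  sw-unique {i} {j} p q with i Fin.≟ j
  ... | yes e = e
  ... | no i≢j = ⊥-elim (by₂ i j (sw 0 ∧′ sw 1 ∧′ separate 0 1) false′ (p , q , apart i≢j))

  -- `A` and `C` meet only in the concave corner. A module adjacent to both reaches that corner from
  -- the lower left, a quadrant already covered by `D`.
  three-modules : A ≢ D → C ≢ D → Triplet Adjacent
  three-modules A≢D C≢D = triplet {C} {D} {A}
    (by₂ C D (se 0 ∧′ sw 1 ∧′ outsideNotch 0 ∧′ separate 0 1 ∧′ lo 1 <y hi 0 ∧′ hi 1 ≤y 1) (contact 0 1)
      (atC , atD , notch C , apart C≢D , bD<tC , tD≤d))
    (by₂ D A (sw 0 ∧′ nw 1 ∧′ outsideNotch 1 ∧′ separate 0 1) (contact 0 1) (atD , atA , notch A , apart (A≢D ∘ sym)))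
    (A≢C ∘ sym)
    (λ adj → by₃ C A D (se 0 ∧′ nw 1 ∧′ sw 2 ∧′ outsideNotch 0 ∧′ outsideNotch 1 ∧′ adjacent 0 1 ∧′ separate 0 2 ∧′ separate 1 2) false′
      (atC , atA , atD , notch C , notch A , adj , apart C≢D , apart A≢D))
    only
    where
    tD≤d : t D ≤ʸ d
    tD≤d = by₂ D A (sw 0 ∧′ nw 1 ∧′ separate 0 1) (hi 0 ≤y 1) (atD , atA , apart (A≢D ∘ sym))
    bD<tC : b D <ʸ t C
    bD<tC = by₂ D C (sw 0 ∧′ se 1) (lo 0 <y hi 1) (atD , atC)
    only : ∀ x → Adjacent C x → Adjacent A x → x ≡ D
    only x Cx Ax with x Fin.≟ D
    ... | yes e = e
    ... | no x≢D = ⊥-elim (by₄ C D A x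
      (se 0 ∧′ sw 1 ∧′ nw 2 ∧′ outsideNotch 0 ∧′ outsideNotch 2 ∧′ separate 0 1 ∧′ separate 1 2 ∧′ adjacent 0 3 ∧′ adjacent 2 3 ∧′ outsideNotch 3 ∧′ separate 3 1) false′
      (atC , atD , atA , notch C , notch A , apart C≢D , apart (A≢D ∘ sym) , Cx , Ax , notch x , apart x≢D))

  -- The vertical wall of the notch is continued downwards, with A on its left.
  module Through (A≡D : A ≡ D) where

    through : ℕ → Formula
    through i = lo i <x 1 ∧′ hi i ≡x 1 ∧′ lo i <y 1 ∧′ 1 <y hi i

    atA′ : For.⟦_⟧ (A ∷ []) (through 0)
    atA′ = by₁ A (nw 0 ∧′ sw 0 ∧′ outsideNotch 0) (through 0)
      (atA , subst (λ i → For.⟦_⟧ (i ∷ []) (sw 0)) (sym A≡D) atD , notch A)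

    CA : Contact C A
    CA = by₂ C A (se 0 ∧′ through 1 ∧′ outsideNotch 0 ∧′ separate 0 1) (contact 0 1) (atC , atA′ , notch C , apart (A≢C ∘ sym))

    -- The triplet is `C`, `A` and the next module `k` up the wall. A common neighbour of `C` and
    -- `k` other than `A` would end at the same vertical line as `A` and reach from below the shelf
    -- to the top of `A`, overlapping it.
    above : t A <ʸ Y₁ → Triplet Adjacent
    above t<Y₁ with wall-step (proj₁ (proj₂ atA′)) (Y.<⇒≤ (proj₂ (proj₂ (proj₂ atA′)))) t<Y₁
    ... | k , Ak = triplet {C} {A} {k} CA (inj₁ (inj₂ (inj₂ (inj₂ Ak)))) C≢k
      (λ adj → by₃ C A k (se 0 ∧′ through 1 ∧′ wall 1 2 ∧′ outsideNotch 0 ∧′ adjacent 0 2) false′ (atC , atA′ , Ak , notch C , adj))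
      only
      where
      C≢k : C ≢ k
      C≢k e = X.irrefl (sym (trans (cong r e) (proj₁ (proj₂ Ak)))) (proj₁ (proj₂ atC))
      only : ∀ x → Adjacent C x → Adjacent k x → x ≡ A
      only x Cx kx with x Fin.≟ A
      ... | yes e = e
      ... | no x≢A = ⊥-elim (by₄ C A k x
        (se 0 ∧′ through 1 ∧′ wall 1 2 ∧′ outsideNotch 0 ∧′ separate 0 1 ∧′ adjacent 0 3 ∧′ adjacent 2 3 ∧′ outsideNotch 3 ∧′ separate 3 1) false′
        (atC , atA′ , Ak , notch C , apart (A≢C ∘ sym) , Cx , kx , notch x , apart x≢A))

    -- A bounds the whole vertical wall of the notch: the modules below the notch can be raised.
    module Full (tA : t A ≡ Y₁) where

      full : ℕ → Formula
      full i = lo i <x 1 ∧′ hi i ≡x 1 ∧′ lo i <y 1 ∧′ hi i ≡y 2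

      atA″ : For.⟦_⟧ (A ∷ []) (full 0)
      atA″ = proj₁ atA′ , proj₁ (proj₂ atA′) , proj₁ (proj₂ (proj₂ atA′)) , tA

      raised plain : ℕ → Formula
      raised i = hi i ≡y 1 ∧′ 1 <x hi i
      plain i = hi i ≤x 1 ∨′ hi i <y 1

      Raised? : ∀ i → Dec (For.⟦_⟧ (i ∷ []) (raised 0))
      Raised? i = (t i Y.≟ d) ×-dec Fin-dec
        where
        Fin-dec : Dec (c <ˣ r i)
        Fin-dec = [ yes , (λ h → no h) ]′ (X.<-or-≤ c (r i))

      height′ : ∀ i → Dec (For.⟦_⟧ (i ∷ []) (raised 0)) → |Y|
      height′ i (yes _) = Y₁
      height′ i (no _)  = t i

      t′ : Fin n → |Y|
      t′ i = height′ i (Raised? i)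

      View : Fin n → Set
      View i = (t′ i ≡ Y₁ × For.⟦_⟧ (i ∷ []) (raised 0)) ⊎ (t′ i ≡ t i × For.⟦_⟧ (i ∷ []) (plain 0))

      view : ∀ i → View i
      view i = go (Raised? i)
        where
        go : ∀ p → (height′ i p ≡ Y₁ × For.⟦_⟧ (i ∷ []) (raised 0)) ⊎ (height′ i p ≡ t i × For.⟦_⟧ (i ∷ []) (plain 0))
        go (yes p) = inj₁ (refl , p)
        go (no ¬p) with X.<-or-≤ c (r i) | notch i
        ... | inj₂ r≤c | _ = inj₂ (refl , inj₁ r≤c)
        ... | inj₁ c<r | inj₁ r≤c = contradiction c<r r≤c
        ... | inj₁ c<r | inj₂ t≤d with Y.≤⇒<-or-≡ t≤d
        ...   | inj₁ t<d = inj₂ (refl , inj₂ t<d)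
        ...   | inj₂ t≡d = contradiction (t≡d , c<r) ¬p

      -- The modules under consideration may include `A` itself, so the formulas must allow
      -- coincidence besides separation.
      exclude : ∀ i j → For.⟦_⟧ (i ∷ j ∷ []) (exclusive 0 1)
      exclude i j with i Fin.≟ j
      ... | yes refl = inj₂ (refl , refl , refl , refl)
      ... | no i≢j = inj₁ (apart i≢j)

      private
        Meets Apart : Fin n → |Y| → Fin n → |Y| → Set
        Meets i y j z = ((r i ≡ l j ⊎ r j ≡ l i) × b i <ʸ z × b j <ʸ y) ⊎ ((y ≡ b j ⊎ z ≡ b i) × l i <ˣ r j × l j <ˣ r i)
        Apart i y j z = r i ≤ˣ l j ⊎ r j ≤ˣ l i ⊎ y ≤ʸ b j ⊎ z ≤ʸ b i

        context : Formula → Formula → Formula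
        context p q = p ∧′ q ∧′ full 2 ∧′ exclusive 0 2 ∧′ exclusive 1 2 ∧′ outsideNotch 0 ∧′ outsideNotch 1

        given : ∀ {P Q : Set} i j → P → Q → P × Q × _
        given i j p q = p , q , atA″ , exclude i A , exclude j A , notch i , notch j

      -- No adjacency is new: neighbouring raised modules already shared a wall below the shelf, and
      -- the leftmost one already touched `A`, which reaches below the shelf.
      shrink : ∀ {i j} → Meets i (t′ i) j (t′ j) → Adjacent i j
      shrink {i} {j} adj with view i | view j
      ... | inj₁ (e , p) | inj₁ (e′ , q) = by₃ i j A (context (raised 0) (raised 1) ∧′ touching 0 2 1 2) (adjacent 0 1)
        (given i j p q , subst₂ (λ y z → Meets i y j z) e e′ adj)
      ... | inj₁ (e , p) | inj₂ (e′ , q) = by₃ i j A (context (raised 0) (plain 1) ∧′ touching 0 2 1 (hi 1)) (adjacent 0 1)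
        (given i j p q , subst₂ (λ y z → Meets i y j z) e e′ adj)
      ... | inj₂ (e , p) | inj₁ (e′ , q) = by₃ i j A (context (plain 0) (raised 1) ∧′ touching 0 (hi 0) 1 2) (adjacent 0 1)
        (given i j p q , subst₂ (λ y z → Meets i y j z) e e′ adj)
      ... | inj₂ (e , p) | inj₂ (e′ , q) = subst₂ (λ y z → Meets i y j z) e e′ adj

      grow : ∀ {i j} → Adjacent i j → Meets i (t′ i) j (t′ j)
      grow {i} {j} adj with view i | view j
      ... | inj₁ (e , p) | inj₁ (e′ , q) = subst₂ (λ y z → Meets i y j z) (sym e) (sym e′)
        (by₃ i j A (context (raised 0) (raised 1) ∧′ adjacent 0 1) (touching 0 2 1 2) (given i j p q , adj))
      ... | inj₁ (e , p) | inj₂ (e′ , q) = subst₂ (λ y z → Meets i y j z) (sym e) (sym e′)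
        (by₃ i j A (context (raised 0) (plain 1) ∧′ adjacent 0 1) (touching 0 2 1 (hi 1)) (given i j p q , adj))
      ... | inj₂ (e , p) | inj₁ (e′ , q) = subst₂ (λ y z → Meets i y j z) (sym e) (sym e′)
        (by₃ i j A (context (plain 0) (raised 1) ∧′ adjacent 0 1) (touching 0 (hi 0) 1 2) (given i j p q , adj))
      ... | inj₂ (e , p) | inj₂ (e′ , q) = subst₂ (λ y z → Meets i y j z) (sym e) (sym e′) adj

      still-apart : ∀ {i j} → i ≢ j → Apart i (t′ i) j (t′ j)
      still-apart {i} {j} i≢j with view i | view j
      ... | inj₁ (e , p) | inj₁ (e′ , q) = subst₂ (λ y z → Apart i y j z) (sym e) (sym e′)
        (by₃ i j A (context (raised 0) (raised 1) ∧′ separate 0 1) (separated 0 2 1 2) (given i j p q , apart i≢j))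
      ... | inj₁ (e , p) | inj₂ (e′ , q) = subst₂ (λ y z → Apart i y j z) (sym e) (sym e′)
        (by₃ i j A (context (raised 0) (plain 1) ∧′ separate 0 1) (separated 0 2 1 (hi 1)) (given i j p q , apart i≢j))
      ... | inj₂ (e , p) | inj₁ (e′ , q) = subst₂ (λ y z → Apart i y j z) (sym e) (sym e′)
        (by₃ i j A (context (plain 0) (raised 1) ∧′ separate 0 1) (separated 0 (hi 0) 1 2) (given i j p q , apart i≢j))
      ... | inj₂ (e , p) | inj₂ (e′ , q) = subst₂ (λ y z → Apart i y j z) (sym e) (sym e′) (apart i≢j)

      t≤t′ : ∀ i → t i ≤ʸ t′ i
      t≤t′ i with view i
      ... | inj₁ (e , _) = subst (t i ≤ʸ_) (sym e) (proj₂ (y-in i))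
      ... | inj₂ (e , _) = Y.≤-reflexive (sym e)

      t′≤Y₁ : ∀ i → t′ i ≤ʸ Y₁
      t′≤Y₁ i with view i
      ... | inj₁ (e , _) = Y.≤-reflexive e
      ... | inj₂ (e , _) = subst (_≤ʸ Y₁) (sym e) (proj₂ (y-in i))

      filled : ∀ {x y} → X₀ <ˣ x × x <ˣ X₁ × Y₀ <ʸ y × y <ʸ Y₁ → ∃ λ i → l i ≤ˣ x × x ≤ˣ r i × b i ≤ʸ y × y ≤ʸ t′ i
      filled {x} {y} (X₀<x , x<X₁ , Y₀<y , y<Y₁) with X.<-or-≤ x c | Y.<-or-≤ y d
      ... | inj₁ x<c | _ =
        let i , p , q , p′ , q′ = cover↗ (X.<⇒≤ X₀<x , x<X₁ , Y.<⇒≤ Y₀<y , y<Y₁ , inj₁ x<c)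
        in i , p , X.<⇒≤ q , p′ , Y.≤-trans (Y.<⇒≤ q′) (t≤t′ i)
      ... | inj₂ _ | inj₁ y<d =
        let i , p , q , p′ , q′ = cover↗ (X.<⇒≤ X₀<x , x<X₁ , Y.<⇒≤ Y₀<y , y<Y₁ , inj₂ y<d)
        in i , p , X.<⇒≤ q , p′ , Y.≤-trans (Y.<⇒≤ q′) (t≤t′ i)
      -- A point over the notch is taken down to the shelf at height `d`; the module directly below
      -- it there is one of those raised to `Y₁`.
      ... | inj₂ c≤x | inj₂ d≤y =
        let i , p , q , p′ , q′ = cover↘ {x} {d} (X.<⇒≤ X₀<x , x<X₁ , proj₁ d-pos , Y.<⇒≤ (proj₂ d-pos) , inj₂ (Y.irrefl refl))
        in i , p , X.<⇒≤ q , Y.≤-trans (Y.<⇒≤ p′) d≤y , top-reached i (X.≤-<-trans c≤x q) q′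
        where
        top-reached : ∀ i → c <ˣ r i → d ≤ʸ t i → y ≤ʸ t′ i
        top-reached i c<r d≤t with view i
        ... | inj₁ (e , _) = subst (y ≤ʸ_) (sym e) (Y.<⇒≤ y<Y₁)
        ... | inj₂ (_ , inj₁ r≤c) = contradiction c<r r≤c
        ... | inj₂ (_ , inj₂ t<d) = contradiction t<d d≤t

      stretch : Stretch plan
      stretch = record
        { r′ = r ; t′ = t′ ; r′-moved = λ _ → inj₁ refl
        ; t′-moved = λ i → [ (λ (_ , p) → inj₂ p) , (λ (e , _) → inj₁ e) ]′ (view i)
        ; r≤r′ = λ _ → X.irrefl refl ; t≤t′ = t≤t′ ; r′≤X₁ = λ i → proj₂ (x-in i) ; t′≤Y₁ = t′≤Y₁
        ; apart′ = still-apart ; cover′ = filled ; adjacent′⇒ = shrink ; ⇒adjacent′ = grow }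

    result : Triplet Adjacent ⊎ Stretch plan
    result with Y.≤⇒<-or-≡ (proj₂ (y-in A))
    ... | inj₁ t<Y₁ = inj₁ (above t<Y₁)
    ... | inj₂ t≡Y₁ = inj₂ (Full.stretch t≡Y₁)

triplet-or-stretch : ∀ {X Y n} (plan : Plan X Y n) → Triplet (Plan.Adjacent plan) ⊎ Stretch plan
triplet-or-stretch plan = go
  where
  open ConcaveCorner plan
  open Transpose plan
  reorder : ∀ {P Q R S : Set} → P × Q × R × S → R × S × P × Q
  reorder (p , q , r , s) = r , s , p , q
  go : Triplet (Plan.Adjacent plan) ⊎ Stretch plan
  go with A Fin.≟ D | C Fin.≟ D
  ... | yes A≡D | _ = Through.result A≡D
  ... | no A≢D | no C≢D = inj₁ (three-modules A≢D C≢D)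
  -- Transposition exchanges the roles of `A` and `C`, so this is the preceding case. The transposed
  -- plan chooses its modules by its own cover, hence the appeal to uniqueness.
  ... | no _ | yes C≡D = Sum.map (Triplet-map Sum.swap Sum.swap) Stretch-transpose transposed
    where
    module T = ConcaveCorner transpose
    same-C : T.A ≡ C
    same-C = se-unique (reorder T.atA) atC
    same-D : T.D ≡ D
    same-D = sw-unique (reorder T.atD) atD
    transposed : Triplet (Plan.Adjacent transpose) ⊎ Stretch transpose
    transposed = T.Through.result (trans same-C (trans C≡D (sym same-D)))

-- Floor plans with rational coordinates

module Germs (A : Axis) where
  open Axis A

  just-above : ∀ zs {x y} → x < y → ∃ λ z → x < z × z < y × All (λ w → x < w → z < w) zs
  just-above [] x<y = let z , p , q = dense x<y in z , p , q , []
  just-above (w ∷ zs) {x} {y} x<y with <-or-≤ x w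
  ... | inj₂ w≤x = let z , p , q , h = just-above zs x<y in z , p , q , (λ x<w → contradiction x<w w≤x) ∷ h
  ... | inj₁ x<w with <-or-≤ w y
  ...   | inj₁ w<y = let z , p , q , h = just-above zs x<w in z , p , <-trans q w<y , (λ _ → q) ∷ h
  ...   | inj₂ y≤w = let z , p , q , h = just-above zs x<y in z , p , q , (λ _ → <-≤-trans q y≤w) ∷ h

-- A point close to x on either side lies on the same side of all the given coordinates as x,
-- up to equality with x.
module Approach (A : Axis) {n : ℕ} (l r : Fin n → Axis.Carrier A) (c : Axis.Carrier A) where
  open Axis A

  private
    coords : List Carrier
    coords = c ∷ map l (allFin n) ++ map r (allFin n)

    module _ {P : Carrier → Set} (h : All P coords) where
      at-c : P c
      at-c = All.lookup h (here refl)
      at-l : ∀ i → P (l i)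
      at-l i = All.lookup h (there (∈-++⁺ˡ (∈-map⁺ l (∈-allFin i))))
      at-r : ∀ i → P (r i)
      at-r i = All.lookup h (there (∈-++⁺ʳ (map l (allFin n)) (∈-map⁺ r (∈-allFin i))))

  record Above (x y : Carrier) : Set where
    field
      z   : Carrier
      x<z : x < z
      z<y : z < y
      c⁺  : x < c → z < c
      l⁺  : ∀ {i} → l i ≤ z → l i ≤ x
      r⁺  : ∀ {i} → z ≤ r i → x < r i

  above : ∀ {x y} → x < y → Above x y
  above x<y with Germs.just-above A coords x<y
  ... | z , x<z , z<y , h = record
    { z = z ; x<z = x<z ; z<y = z<y ; c⁺ = at-c h
    ; l⁺ = λ {i} l≤z x<l → l≤z (at-l h i x<l)
    ; r⁺ = λ {i} z≤r → <-≤-trans x<z z≤r }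

  record Below (y x : Carrier) : Set where
    field
      z   : Carrier
      y<z : y < z
      z<x : z < x
      c⁻  : x ≤ c → z < c
      l⁻  : ∀ {i} → l i ≤ z → l i < x
      r⁻  : ∀ {i} → z ≤ r i → x ≤ r i

  below : ∀ {x y} → y < x → Below y x
  below y<x with Germs.just-above (reverse A) coords y<x
  ... | z , z<x , y<z , h = record
    { z = z ; y<z = y<z ; z<x = z<x ; c⁻ = λ x≤c → <-≤-trans z<x x≤c
    ; l⁻ = λ l≤z → ≤-<-trans l≤z z<x
    ; r⁻ = λ {i} z≤r r<x → z≤r (at-r h i r<x) }

module ToPlan (X Y : Axis) {n : ℕ}
  (X₀ c X₁ : Axis.Carrier X) (Y₀ d Y₁ : Axis.Carrier Y) (l r : Fin n → Axis.Carrier X) (b t : Fin n → Axis.Carrier Y) where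
  private
    module X = Axis X
    module Y = Axis Y
    module AX = Approach X l r c
    module AY = Approach Y b t d

  InBox InRegion : X.Carrier → Y.Carrier → Set
  InBox x y = (X₀ X.< x × x X.< X₁) × (Y₀ Y.< y × y Y.< Y₁)
  InRegion x y = InBox x y × (x X.< c ⊎ y Y.< d)

  InModule InClosedModule : Fin n → X.Carrier → Y.Carrier → Set
  InModule i x y = (l i X.< x × x X.< r i) × (b i Y.< y × y Y.< t i)
  InClosedModule i x y = (l i X.≤ x × x X.≤ r i) × (b i Y.≤ y × y Y.≤ t i)

  module _
    (c-pos : X₀ X.< c × c X.< X₁) (d-pos : Y₀ Y.< d × d Y.< Y₁)
    (width : ∀ i → l i X.< r i) (height : ∀ i → b i Y.< t i)
    (within : ∀ i {x y} → InModule i x y → InRegion x y)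
    (disjoint : ∀ {i j} → i ≢ j → ∀ {x y} → InModule i x y → ¬ InModule j x y)
    (cover : ∀ {x y} → InRegion x y → ∃ λ i → InClosedModule i x y) where

    private
      some-x : ∀ i → ∃ λ x → l i X.< x × x X.< r i
      some-x i = X.dense (width i)
      some-y : ∀ i → ∃ λ y → b i Y.< y × y Y.< t i
      some-y i = Y.dense (height i)

      below-r : ∀ i {x} → x X.< r i → ∃ λ z → l i X.< z × z X.< r i × x X.< z
      below-r i {x} x<r with X.<-or-≤ x (l i)
      ... | inj₁ x<l = let z , p , q = some-x i in z , p , q , X.<-trans x<l p
      ... | inj₂ l≤x = let z , p , q = X.dense x<r in z , X.≤-<-trans l≤x p , q , p

      below-t : ∀ i {y} → y Y.< t i → ∃ λ z → b i Y.< z × z Y.< t i × y Y.< z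
      below-t i {y} y<t with Y.<-or-≤ y (b i)
      ... | inj₁ y<b = let z , p , q = some-y i in z , p , q , Y.<-trans y<b p
      ... | inj₂ b≤y = let z , p , q = Y.dense y<t in z , Y.≤-<-trans b≤y p , q , p

      x-in : ∀ i → X₀ X.≤ l i × r i X.≤ X₁
      x-in i = (λ l<X₀ →
          let z , p , q , h = Germs.just-above X (X₀ ∷ []) (width i)
              y , p′ , q′ = some-y i
          in X.asym (All.lookup h (here refl) l<X₀) (proj₁ (proj₁ (proj₁ (within i ((p , q) , (p′ , q′)))))))
        , (λ X₁<r →
          let z , p , q , h = below-r i X₁<r
              y , p′ , q′ = some-y i
          in X.asym h (proj₂ (proj₁ (proj₁ (within i ((p , q) , (p′ , q′)))))))

      y-in : ∀ i → Y₀ Y.≤ b i × t i Y.≤ Y₁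
      y-in i = (λ b<Y₀ →
          let z , p , q , h = Germs.just-above Y (Y₀ ∷ []) (height i)
              x , p′ , q′ = some-x i
          in Y.asym (All.lookup h (here refl) b<Y₀) (proj₁ (proj₂ (proj₁ (within i ((p′ , q′) , (p , q)))))))
        , (λ Y₁<t →
          let z , p , q , h = below-t i Y₁<t
              x , p′ , q′ = some-x i
          in Y.asym h (proj₂ (proj₂ (proj₁ (within i ((p′ , q′) , (p , q)))))))

      notch : ∀ i → r i X.≤ c ⊎ t i Y.≤ d
      notch i with X.<-or-≤ c (r i) | Y.<-or-≤ d (t i)
      ... | inj₂ r≤c | _ = inj₁ r≤c
      ... | inj₁ _ | inj₂ t≤d = inj₂ t≤d
      ... | inj₁ c<r | inj₁ d<t with below-r i c<r | below-t i d<t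
      ...   | x , p , q , c<x | y , p′ , q′ , d<y with proj₂ (within i ((p , q) , (p′ , q′)))
      ...     | inj₁ x<c = contradiction x<c (X.asym c<x)
      ...     | inj₂ y<d = contradiction y<d (Y.asym d<y)

      module Overlap (A : Axis) where
        open Axis A
        common : ∀ {p q p′ q′} → p < q → p < q′ → p′ < q → p′ < q′ → ∃ λ z → (p < z × z < q) × (p′ < z × z < q′)
        common {p} {q} {p′} {q′} pq pq′ p′q p′q′ with <-or-≤ p p′
        ... | inj₁ p<p′ =
          let z , u , v , h = Germs.just-above A (q′ ∷ []) p′q
          in z , (<-trans p<p′ u , v) , u , All.lookup h (here refl) p′q′
        ... | inj₂ p′≤p =
          let z , u , v , h = Germs.just-above A (q′ ∷ []) pq
          in z , (u , v) , ≤-<-trans p′≤p u , All.lookup h (here refl) pq′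

      apart : ∀ {i j} → i ≢ j → r i X.≤ l j ⊎ r j X.≤ l i ⊎ t i Y.≤ b j ⊎ t j Y.≤ b i
      apart {i} {j} i≢j with X.<-or-≤ (l j) (r i) | X.<-or-≤ (l i) (r j) | Y.<-or-≤ (b j) (t i) | Y.<-or-≤ (b i) (t j)
      ... | inj₂ p | _ | _ | _ = inj₁ p
      ... | inj₁ _ | inj₂ p | _ | _ = inj₂ (inj₁ p)
      ... | inj₁ _ | inj₁ _ | inj₂ p | _ = inj₂ (inj₂ (inj₁ p))
      ... | inj₁ _ | inj₁ _ | inj₁ _ | inj₂ p = inj₂ (inj₂ (inj₂ p))
      ... | inj₁ p | inj₁ q | inj₁ p′ | inj₁ q′ =
        let x , h , k = Overlap.common X (width i) q p (width j)
            y , h′ , k′ = Overlap.common Y (height i) q′ p′ (height j)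
        in contradiction (k , k′) (disjoint i≢j (h , h′))

    -- The given cover is by closed modules at interior points. It is applied to a nearby point in
    -- the wanted direction, with no coordinate of the plan strictly in between, so the module found
    -- contains the whole small quadrant.
    toPlan : Plan X Y n
    toPlan = record
      { X₀ = X₀ ; c = c ; X₁ = X₁ ; Y₀ = Y₀ ; d = d ; Y₁ = Y₁ ; l = l ; r = r ; b = b ; t = t
      ; c-pos = c-pos ; d-pos = d-pos ; width = width ; height = height ; x-in = x-in ; y-in = y-in
      ; notch = notch ; apart = apart
      ; cover↗ = λ (p , q , p′ , q′ , h) →
          let module P = AX.Above (AX.above q)
              module Q = AY.Above (AY.above q′)
              i , (u , v) , (u′ , v′) = cover (((X.≤-<-trans p P.x<z , P.z<y) , (Y.≤-<-trans p′ Q.x<z , Q.z<y)) , Sum.map P.c⁺ Q.c⁺ h)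
          in i , P.l⁺ u , P.r⁺ v , Q.l⁺ u′ , Q.r⁺ v′
      ; cover↖ = λ (p , q , p′ , q′ , h) →
          let module P = AX.Below (AX.below p)
              module Q = AY.Above (AY.above q′)
              i , (u , v) , (u′ , v′) = cover (((P.y<z , X.<-≤-trans P.z<x q) , (Y.≤-<-trans p′ Q.x<z , Q.z<y)) , Sum.map P.c⁻ Q.c⁺ h)
          in i , P.l⁻ u , P.r⁻ v , Q.l⁺ u′ , Q.r⁺ v′
      ; cover↘ = λ (p , q , p′ , q′ , h) →
          let module P = AX.Above (AX.above q)
              module Q = AY.Below (AY.below p′)
              i , (u , v) , (u′ , v′) = cover (((X.≤-<-trans p P.x<z , P.z<y) , (Q.y<z , Y.<-≤-trans Q.z<x q′)) , Sum.map P.c⁺ Q.c⁻ h)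
          in i , P.l⁺ u , P.r⁺ v , Q.l⁻ u′ , Q.r⁻ v′
      ; cover↙ = λ (p , q , p′ , q′ , h) →
          let module P = AX.Below (AX.below p)
              module Q = AY.Below (AY.below p′)
              i , (u , v) , (u′ , v′) = cover (((P.y<z , X.<-≤-trans P.z<x q) , (Q.y<z , Y.<-≤-trans Q.z<x q′)) , Sum.map P.c⁻ Q.c⁻ h)
          in i , P.l⁻ u , P.r⁻ v , Q.l⁻ u′ , Q.r⁻ v′ }

-- The rational line, reversed if the flag is set. Reversing the axes moves the notch into the upper right corner.
line : Bool → Axis
line f = record { Carrier = ℚ ; _<_ = order f ; isStrictTotalOrder = total f ; dense = dense f }
  where
  order : Bool → ℚ → ℚ → Set
  order false x y = x ℚ.< y
  order true  x y = y ℚ.< x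
  total : ∀ f → IsStrictTotalOrder _≡_ (order f)
  total false = ℚ.<-isStrictTotalOrder
  total true  = Flip.isStrictTotalOrder ℚ.<-isStrictTotalOrder
  dense : ∀ f {x y} → order f x y → ∃ λ z → order f x z × order f z y
  dense false p = let z , q , r = ℚ.<-dense p in z , q , r
  dense true  p = let z , q , r = ℚ.<-dense p in z , r , q

low high : Bool → ℚ → ℚ → ℚ
low  f p q = if f then q else p
high f p q = if f then p else q

-- [p,q] is the interval from l to r along the possibly reversed line.
Oriented : Bool → (p q l r : ℚ) → Set
Oriented false p q l r = p ≡ l × q ≡ r
Oriented true  p q l r = p ≡ r × q ≡ l

oriented : ∀ f p q → Oriented f p q (low f p q) (high f p q)
oriented false p q = refl , refl
oriented true  p q = refl , refl

oriented⁻ : ∀ f l r → Oriented f (low f l r) (high f l r) l r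
oriented⁻ false l r = refl , refl
oriented⁻ true  l r = refl , refl

oriented-< : ∀ f {p q l r} → Oriented f p q l r → p ℚ.< q → Axis._<_ (line f) l r
oriented-< false (refl , refl) lt = lt
oriented-< true  (refl , refl) lt = lt

oriented-<⁻ : ∀ f {p q l r} → Oriented f p q l r → Axis._<_ (line f) l r → p ℚ.< q
oriented-<⁻ false (refl , refl) lt = lt
oriented-<⁻ true  (refl , refl) lt = lt

≤⇒≯ : ∀ {p q} → p ℚ.≤ q → ¬ (q ℚ.< p)
≤⇒≯ p≤q q<p = ℚ.<-irrefl refl (ℚ.≤-<-trans p≤q q<p)

strictly : ∀ f {p q l r x} → Oriented f p q l r → p ℚ.< x × x ℚ.< q → Axis._<_ (line f) l x × Axis._<_ (line f) x r
strictly false (refl , refl) h = h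
strictly true  (refl , refl) h = swap h

strictly⁻ : ∀ f {p q l r x} → Oriented f p q l r → Axis._<_ (line f) l x × Axis._<_ (line f) x r → p ℚ.< x × x ℚ.< q
strictly⁻ false (refl , refl) h = h
strictly⁻ true  (refl , refl) h = swap h

weakly : ∀ f {p q l r x} → Oriented f p q l r → p ℚ.≤ x × x ℚ.≤ q → Axis._≤_ (line f) l x × Axis._≤_ (line f) x r
weakly false (refl , refl) (h , h′) = (λ lt → ≤⇒≯ h lt) , (λ lt → ≤⇒≯ h′ lt)
weakly true  (refl , refl) (h , h′) = (λ lt → ≤⇒≯ h′ lt) , (λ lt → ≤⇒≯ h lt)

weakly⁻ : ∀ f {p q l r x} → Oriented f p q l r → Axis._≤_ (line f) l x × Axis._≤_ (line f) x r → p ℚ.≤ x × x ℚ.≤ q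
weakly⁻ false (refl , refl) (h , h′) = ℚ.≮⇒≥ h , ℚ.≮⇒≥ h′
weakly⁻ true  (refl , refl) (h , h′) = ℚ.≮⇒≥ h′ , ℚ.≮⇒≥ h

module _ {p q p′ q′ : ℚ} where

  abut : ∀ f {l r l′ r′} → Oriented f p q l r → Oriented f p′ q′ l′ r′ → q ≡ p′ ⊎ q′ ≡ p → r ≡ l′ ⊎ r′ ≡ l
  abut false (refl , refl) (refl , refl) h = h
  abut true  (refl , refl) (refl , refl) h = Sum.swap (Sum.map sym sym h)

  abut⁻ : ∀ f {l r l′ r′} → Oriented f p q l r → Oriented f p′ q′ l′ r′ → r ≡ l′ ⊎ r′ ≡ l → q ≡ p′ ⊎ q′ ≡ p
  abut⁻ false (refl , refl) (refl , refl) h = h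
  abut⁻ true  (refl , refl) (refl , refl) h = Sum.swap (Sum.map sym sym h)

  overlaps : ∀ f {l r l′ r′} → Oriented f p q l r → Oriented f p′ q′ l′ r′ → p ⊔ p′ ℚ.< q ℚ.⊓ q′ →
            Axis._<_ (line f) l r′ × Axis._<_ (line f) l′ r
  overlaps f o o′ h = go f o o′
    where
    p<q′ : p ℚ.< q′
    p<q′ = ℚ.≤-<-trans (ℚ.p≤p⊔q p p′) (ℚ.<-≤-trans h (ℚ.p⊓q≤q q q′))
    p′<q : p′ ℚ.< q
    p′<q = ℚ.≤-<-trans (ℚ.p≤q⊔p p p′) (ℚ.<-≤-trans h (ℚ.p⊓q≤p q q′))
    go : ∀ f {l r l′ r′} → Oriented f p q l r → Oriented f p′ q′ l′ r′ → Axis._<_ (line f) l r′ × Axis._<_ (line f) l′ r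
    go false (refl , refl) (refl , refl) = p<q′ , p′<q
    go true  (refl , refl) (refl , refl) = p′<q , p<q′

  overlaps⁻ : ∀ f {l r l′ r′} → Oriented f p q l r → Oriented f p′ q′ l′ r′ → p ℚ.< q → p′ ℚ.< q′ →
             Axis._<_ (line f) l r′ × Axis._<_ (line f) l′ r → p ⊔ p′ ℚ.< q ℚ.⊓ q′
  overlaps⁻ f o o′ p<q p′<q′ h = less (both f o o′ h) (ℚ.⊔-sel p p′) (ℚ.⊓-sel q q′)
    where
    both : ∀ f {l r l′ r′} → Oriented f p q l r → Oriented f p′ q′ l′ r′ → Axis._<_ (line f) l r′ × Axis._<_ (line f) l′ r →
            p ℚ.< q′ × p′ ℚ.< q
    both false (refl , refl) (refl , refl) h = h
    both true  (refl , refl) (refl , refl) h = swap h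
    less : p ℚ.< q′ × p′ ℚ.< q → p ⊔ p′ ≡ p ⊎ p ⊔ p′ ≡ p′ → q ℚ.⊓ q′ ≡ q ⊎ q ℚ.⊓ q′ ≡ q′ → p ⊔ p′ ℚ.< q ℚ.⊓ q′
    less _            (inj₁ e) (inj₁ e′) = subst₂ ℚ._<_ (sym e) (sym e′) p<q
    less (p<q′ , _)   (inj₁ e) (inj₂ e′) = subst₂ ℚ._<_ (sym e) (sym e′) p<q′
    less (_ , p′<q)   (inj₂ e) (inj₁ e′) = subst₂ ℚ._<_ (sym e) (sym e′) p′<q
    less _            (inj₂ e) (inj₂ e′) = subst₂ ℚ._<_ (sym e) (sym e′) p′<q′

-- The flag is chosen so that, within the box, the extent of the notch along this axis is exactly
-- what lies at or beyond `c`.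
record NotchSide (p q np nq : ℚ) : Set where
  field
    flip    : Bool
    c       : ℚ
    c-pos   : Axis._<_ (line flip) (low flip p q) c × Axis._<_ (line flip) c (high flip p q)
    beyond  : ∀ {x} → np ℚ.≤ x × x ℚ.≤ nq → Axis._≤_ (line flip) c x
    beyond⁻ : ∀ {x} → p ℚ.< x × x ℚ.< q → Axis._≤_ (line flip) c x → np ℚ.≤ x × x ℚ.≤ nq

notchSide : ∀ {p q np nq} → (np ≡ p × p ℚ.< nq × nq ℚ.< q) ⊎ (nq ≡ q × p ℚ.< np × np ℚ.< q) → NotchSide p q np nq
notchSide (inj₁ (refl , p<c , c<q)) = record
  { flip = true ; c-pos = c<q , p<c
  ; beyond = λ (_ , x≤c) c<x → ≤⇒≯ x≤c c<x
  ; beyond⁻ = λ (p<x , _) x≯c → ℚ.<⇒≤ p<x , ℚ.≮⇒≥ x≯c }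
notchSide (inj₂ (refl , p<c , c<q)) = record
  { flip = false ; c-pos = p<c , c<q
  ; beyond = λ (c≤x , _) x<c → ≤⇒≯ c≤x x<c
  ; beyond⁻ = λ (_ , x<q) x≮c → ℚ.≮⇒≥ x≮c , ℚ.<⇒≤ x<q }

module LShape {n : ℕ} (F : LFloorPlan n) where
  open LFloorPlan F
  open LRegion region
  open FloorPlanOn plan

  module H = NotchSide (notchSide nx)
  module V = NotchSide (notchSide ny)

  X Y : Axis
  X = line H.flip
  Y = line V.flip
  module X = Axis X
  module Y = Axis Y

  x₁ x₂ y₁ y₂ l r b t : Fin n → ℚ
  x₁ i = Rect.x₁ (mod i)
  x₂ i = Rect.x₂ (mod i)
  y₁ i = Rect.y₁ (mod i)
  y₂ i = Rect.y₂ (mod i)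
  l i = low  H.flip (x₁ i) (x₂ i)
  r i = high H.flip (x₁ i) (x₂ i)
  b i = low  V.flip (y₁ i) (y₂ i)
  t i = high V.flip (y₁ i) (y₂ i)

  ox : ∀ i → Oriented H.flip (x₁ i) (x₂ i) (l i) (r i)
  ox i = oriented H.flip (x₁ i) (x₂ i)
  oy : ∀ i → Oriented V.flip (y₁ i) (y₂ i) (b i) (t i)
  oy i = oriented V.flip (y₁ i) (y₂ i)
  oX = oriented H.flip X₀ X₁
  oY = oriented V.flip Y₀ Y₁

  private
    module P = ToPlan X Y (low H.flip X₀ X₁) H.c (high H.flip X₀ X₁) (low V.flip Y₀ Y₁) V.c (high V.flip Y₀ Y₁) l r b t

  inside⇒region : ∀ {x y} → LInside region x y → P.InRegion x y
  inside⇒region {x} {y} (hx , hy , outside) = (strictly H.flip oX hx , strictly V.flip oY hy) , off-notch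
    where
    off-notch : x X.< H.c ⊎ y Y.< V.c
    off-notch with X.<-or-≤ x H.c | Y.<-or-≤ y V.c
    ... | inj₁ p | _ = inj₁ p
    ... | inj₂ _ | inj₁ q = inj₂ q
    ... | inj₂ p | inj₂ q = contradiction (H.beyond⁻ hx p , V.beyond⁻ hy q) outside

  region⇒inside : ∀ {x y} → P.InRegion x y → LInside region x y
  region⇒inside ((hx , hy) , off-notch) =
    strictly⁻ H.flip oX hx , strictly⁻ V.flip oY hy ,
    λ (p , q) → [ H.beyond p , V.beyond q ]′ off-notch

  module⇒open : ∀ i {x y} → P.InModule i x y → InOpen (mod i) x y
  module⇒open i (hx , hy) = strictly⁻ H.flip (ox i) hx , strictly⁻ V.flip (oy i) hy

  layout : Plan X Y n
  layout = P.toPlan H.c-pos V.c-pos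
    (λ i → oriented-< H.flip (ox i) (Rect.wpos (mod i)))
    (λ i → oriented-< V.flip (oy i) (Rect.hpos (mod i)))
    (λ i h → inside⇒region (within i _ _ (module⇒open i h)))
    (λ {i} {j} i≢j h h′ → disjoint i j i≢j _ _ (module⇒open i h) (module⇒open j h′))
    (λ h → let i , hx , hy = cover _ _ (region⇒inside h) in i , weakly H.flip (ox i) hx , weakly V.flip (oy i) hy)

  module _ {p p′ q q′ : Fin n → ℚ} {l r b t : Fin n → ℚ}
    (ox : ∀ i → Oriented H.flip (p i) (p′ i) (l i) (r i)) (oy : ∀ i → Oriented V.flip (q i) (q′ i) (b i) (t i))
    (wpos : ∀ i → p i ℚ.< p′ i) (hpos : ∀ i → q i ℚ.< q′ i) where

    rect : Fin n → Rect
    rect i = record { x₁ = p i ; x₂ = p′ i ; y₁ = q i ; y₂ = q′ i ; wpos = wpos i ; hpos = hpos i }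

    -- Both `Plan.Adjacent` and `Stretch.Adjacent′` are instances, so one translation to rectangles
    -- serves the given plan and the stretched one.
    Abstract : Fin n → Fin n → Set
    Abstract i j = ((r i ≡ l j ⊎ r j ≡ l i) × b i Y.< t j × b j Y.< t i)
                 ⊎ ((t i ≡ b j ⊎ t j ≡ b i) × l i X.< r j × l j X.< r i)

    rect⇒abstract : ∀ {i j} → RectAdjacent (rect i) (rect j) → Abstract i j
    rect⇒abstract {i} {j} (inj₁ (h , k)) = inj₁ (abut H.flip (ox i) (ox j) h , overlaps V.flip (oy i) (oy j) k)
    rect⇒abstract {i} {j} (inj₂ (h , k)) = inj₂ (abut V.flip (oy i) (oy j) h , overlaps H.flip (ox i) (ox j) k)

    abstract⇒rect : ∀ {i j} → Abstract i j → RectAdjacent (rect i) (rect j)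
    abstract⇒rect {i} {j} (inj₁ (h , k)) = inj₁ (abut⁻ H.flip (ox i) (ox j) h , overlaps⁻ V.flip (oy i) (oy j) (hpos i) (hpos j) k)
    abstract⇒rect {i} {j} (inj₂ (h , k)) = inj₂ (abut⁻ V.flip (oy i) (oy j) h , overlaps⁻ H.flip (ox i) (ox j) (wpos i) (wpos j) k)

  mod⇒layout : ∀ {i j} → RectAdjacent (mod i) (mod j) → Plan.Adjacent layout i j
  mod⇒layout = rect⇒abstract ox oy (λ i → Rect.wpos (mod i)) (λ i → Rect.hpos (mod i))

  layout⇒mod : ∀ {i j} → Plan.Adjacent layout i j → RectAdjacent (mod i) (mod j)
  layout⇒mod = abstract⇒rect ox oy (λ i → Rect.wpos (mod i)) (λ i → Rect.hpos (mod i))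

  module Rectangular (S : Stretch layout) where
    open Stretch S
    open Plan layout using (c-pos; d-pos; width; height; x-in; y-in)

    x₁′ x₂′ y₁′ y₂′ : Fin n → ℚ
    x₁′ i = low  H.flip (l i) (r′ i)
    x₂′ i = high H.flip (l i) (r′ i)
    y₁′ i = low  V.flip (b i) (t′ i)
    y₂′ i = high V.flip (b i) (t′ i)

    ox′ : ∀ i → Oriented H.flip (x₁′ i) (x₂′ i) (l i) (r′ i)
    ox′ i = oriented⁻ H.flip (l i) (r′ i)
    oy′ : ∀ i → Oriented V.flip (y₁′ i) (y₂′ i) (b i) (t′ i)
    oy′ i = oriented⁻ V.flip (b i) (t′ i)

    wpos′ : ∀ i → x₁′ i ℚ.< x₂′ i
    wpos′ i = oriented-<⁻ H.flip (ox′ i) (X.<-≤-trans (width i) (r≤r′ i))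
    hpos′ : ∀ i → y₁′ i ℚ.< y₂′ i
    hpos′ i = oriented-<⁻ V.flip (oy′ i) (Y.<-≤-trans (height i) (t≤t′ i))

    floorPlan : RFloorPlan n
    floorPlan = record
      { region = record { X₀ = X₀ ; X₁ = X₁ ; Y₀ = Y₀ ; Y₁ = Y₁
                        ; wpos = oriented-<⁻ H.flip oX (X.<-trans (proj₁ c-pos) (proj₂ c-pos))
                        ; hpos = oriented-<⁻ V.flip oY (Y.<-trans (proj₁ d-pos) (proj₂ d-pos)) }
      ; plan = record
        { mod = rect ox′ oy′ wpos′ hpos′
        ; within = λ i x y (hx , hy) →
            let p , q = strictly H.flip (ox′ i) hx
                p′ , q′ = strictly V.flip (oy′ i) hy
            in strictly⁻ H.flip oX (X.≤-<-trans (proj₁ (x-in i)) p , X.<-≤-trans q (r′≤X₁ i)) ,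
               strictly⁻ V.flip oY (Y.≤-<-trans (proj₁ (y-in i)) p′ , Y.<-≤-trans q′ (t′≤Y₁ i))
        ; disjoint = λ i j i≢j x y (hx , hy) (kx , ky) →
            let p , q = strictly H.flip (ox′ i) hx
                p′ , q′ = strictly V.flip (oy′ i) hy
                u , v = strictly H.flip (ox′ j) kx
                u′ , v′ = strictly V.flip (oy′ j) ky
            in [ (λ le → le (X.<-trans u q)) , [ (λ le → le (X.<-trans p v))
               , [ (λ le → le (Y.<-trans u′ q′)) , (λ le → le (Y.<-trans p′ v′)) ]′ ]′ ]′ (apart′ i≢j)
        ; cover = λ x y (hx , hy) →
            let p , q = strictly H.flip oX hx
                p′ , q′ = strictly V.flip oY hy
                i , u , v , u′ , v′ = cover′ (p , q , p′ , q′)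
            in i , weakly⁻ H.flip (ox′ i) (u , v) , weakly⁻ V.flip (oy′ i) (u′ , v′) } }

    private
      m′ = FloorPlanOn.mod (RFloorPlan.plan floorPlan)

    same-adjacency : ∀ {i j} → (RectAdjacent (m′ i) (m′ j) → RectAdjacent (mod i) (mod j)) ×
                               (RectAdjacent (mod i) (mod j) → RectAdjacent (m′ i) (m′ j))
    same-adjacency = (λ h → layout⇒mod (adjacent′⇒ (rect⇒abstract ox′ oy′ wpos′ hpos′ h)))
                   , (λ h → abstract⇒rect ox′ oy′ wpos′ hpos′ (⇒adjacent′ (mod⇒layout h)))

    private
      -- A wall that moves lies on the line `c` and extends beyond height `d`. Its points near the
      -- upper end bound the notch, so it is not an inner wall.
      x-wall : ∀ i → (∀ y → y₁ i ℚ.< y → y ℚ.< y₂ i → LInside region (r i) y) → r′ i ≡ r i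
      x-wall i inside with r′-moved i
      ... | inj₁ e = e
      ... | inj₂ (r≡c , d<t) = ⊥-elim (contra (Germs.just-above (reverse Y) (V.c ∷ []) (height i)))
        where
        contra : (∃ λ y → y Y.< t i × b i Y.< y × All (λ w → w Y.< t i → w Y.< y) (V.c ∷ [])) → ⊥
        contra (y , y<t , b<y , h ∷ []) with strictly⁻ V.flip (oy i) (b<y , y<t)
        ... | p , q with proj₂ (inside⇒region (inside y p q))
        ...   | inj₁ r<c = X.irrefl r≡c r<c
        ...   | inj₂ y<c = Y.asym y<c (h d<t)

      y-wall : ∀ i → (∀ x → x₁ i ℚ.< x → x ℚ.< x₂ i → LInside region x (t i)) → t′ i ≡ t i
      y-wall i inside with t′-moved i
      ... | inj₁ e = e
      ... | inj₂ (t≡d , c<r) = ⊥-elim (contra (Germs.just-above (reverse X) (H.c ∷ []) (width i)))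
        where
        contra : (∃ λ x → x X.< r i × l i X.< x × All (λ w → w X.< r i → w X.< x) (H.c ∷ [])) → ⊥
        contra (x , x<r , l<x , h ∷ []) with strictly⁻ H.flip (ox i) (l<x , x<r)
        ... | p , q with proj₂ (inside⇒region (inside x p q))
        ...   | inj₁ x<c = X.asym x<c (h c<r)
        ...   | inj₂ t<d = Y.irrefl t≡d t<d

      keep : ∀ f {p q r′} {P : ℚ → Set} → (P (high f p q) → r′ ≡ high f p q) →
             (P p → low f (low f p q) r′ ≡ p) × (P q → high f (low f p q) r′ ≡ q)
      keep false h = (λ _ → refl) , h
      keep true  h = h , (λ _ → refl)

    keeps : KeepsInnerWalls F floorPlan
    keeps i = proj₁ kx , proj₂ kx , proj₁ ky , proj₂ ky
      where
      kx = keep H.flip {P = λ x → ∀ y → y₁ i ℚ.< y → y ℚ.< y₂ i → LInside region x y} (x-wall i)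
      ky = keep V.flip {P = λ y → ∀ x → x₁ i ℚ.< x → x ℚ.< x₂ i → LInside region x y} (y-wall i)

-- From the floor plan back to the graph

module _ {n : ℕ} (G : PlaneGraph n) (isPTPG : IsPTPG G) where
  open PlaneGraph G using (rs)
  open Darts rs
  open Plane G isPTPG
  open CornerImplyingPaths G isPTPG

  good-triplet : Triplet (Adj rs) → ∃ λ u → ∃ λ v → ∃ λ w → GoodTriplet G u v w
  good-triplet T = u , v , w , proj₁ ext-uv , proj₂ ext-uv , proj₂ ext-vw , u≢w , uv , vw , ¬uw , only-v
    where
    open Triplet T
    exterior : ∀ {i j} → Outer (i , j) ⊎ Outer (j , i) → ExteriorVertex G i × ExteriorVertex G j
    exterior (inj₁ o) = (_ , o) , (_ , Outer-ϕ o)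
    exterior (inj₂ o) = (_ , Outer-ϕ o) , (_ , o)
    ext-uv = exterior (unique-common⇒outer uv (λ x y (p , q) (p′ , q′) → uv-unique p q p′ q′))
    ext-vw = exterior (unique-common⇒outer vw (λ x y (p , q) (p′ , q′) → vw-unique p q p′ q′))

  module _ {X Y : Axis} (plan : Plan X Y n)
    (sound : ∀ {i j} → Plan.Adjacent plan i j → Adj rs i j) (complete : ∀ {i j} → Adj rs i j → Plan.Adjacent plan i j) where
    open PlanProperties plan

    graphBoundary : Boundary (Adj rs)
    graphBoundary = record
      { Contact = Contact ; adjacent = sound ∘ contact-adjacent
      ; unique-common = λ p q q′ u u′ → unique-common p (complete q) (complete q′) (complete u) (complete u′)
      ; two-sided = λ p p′ q q′ → two-sided p p′ (complete q) (complete q′)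
      ; advance = advance ; Corner = Corner ; Corner? = Corner? ; corner-unique = λ {κ} → corner-unique {κ}
      ; straight = λ f u l 2≤l path none → straight f u l 2≤l path none ∘ complete }

  -- The orientations of G and of the floor plan agree, possibly after reflecting the floor plan in the diagonal.
  few-CIPs : ∀ {X Y : Axis} (plan : Plan X Y n) → (∀ {i j} → Plan.Adjacent plan i j → Adj rs i j) →
             (∀ {i j} → Adj rs i j → Plan.Adjacent plan i j) → AtMostFiveCIPs G
  few-CIPs plan sound complete with PlanProperties.some-contact plan
  ... | i , j , ij with contact-outer (graphBoundary plan sound complete) ij
  ...   | inj₁ o = at-most-five (graphBoundary plan sound complete) ij o
  ...   | inj₂ o = at-most-five (graphBoundary (Transpose.transpose plan) (sound ∘ Sum.swap) (Sum.swap ∘ complete))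
                     (Transpose.contact-transpose plan ij) o

theorem3 : ∀ {n} (G : PlaneGraph n) → IsPTPG G →
    (∃ λ (F : LFloorPlan n) → Corresponds G (LFloorPlan.plan F) × NonTrivial G F) →
    AtMostFiveCIPs G × (∃ λ a → ∃ λ b → ∃ λ c → GoodTriplet G a b c)
theorem3 {n} G isPTPG (F , corresponds , nonTrivial) =
  few-CIPs G isPTPG layout sound complete , triple (triplet-or-stretch layout)
  where
  open PlaneGraph G using (rs)
  open LShape F
  open LFloorPlan F using (plan)

  sound : ∀ {i j} → Plan.Adjacent layout i j → Adj rs i j
  sound {i} {j} adj with i Fin.≟ j
  ... | yes refl = ⊥-elim (PlanProperties.by₁ layout i (adjacent 0 0) false′ adj)
  ... | no i≢j = proj₁ (corresponds i j i≢j) (layout⇒mod adj)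

  complete : ∀ {i j} → Adj rs i j → Plan.Adjacent layout i j
  complete {i} {j} adj = mod⇒layout (proj₂ (corresponds i j (Darts.Adj⇒≢ rs adj)) adj)

  triple : Triplet (Plan.Adjacent layout) ⊎ Stretch layout → ∃ λ a → ∃ λ b → ∃ λ c → GoodTriplet G a b c
  triple (inj₁ T) = good-triplet G isPTPG (Triplet-map sound complete T)
  triple (inj₂ S) = contradiction
    (floorPlan , (λ i j i≢j → let fwd , back = same-adjacency {i} {j}
                                  sound′ , complete′ = corresponds i j i≢j
                              in sound′ ∘ fwd , back ∘ complete′) , keeps)
    nonTrivial
    where open Rectangular S
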